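{- Fix finite alphabets $\Sigma\subseteq\Gamma$ with $0,1\in\Sigma$ and a blank in $\Gamma\setminus\Sigma$. Let $C\in\mathbb N$ and $D\geq 1$ be constants. Then the problem $\mathrm{Run}_{Cn+D}$ cannot be solved by a multi-tape non-deterministic Turing machine in time $o(q^{(C-1)/4})$, where $q$ is the number of states of the input machine.
   Context: A one-tape NTM is a tuple $M=(Q,\Sigma,\Gamma,\sqcup,\delta,q_0,q_{acc},q_{rej})$ with transition function $\delta:(Q\setminus\{q_{acc},q_{rej}\})\times\Gamma\to\mathcal P(Q\times\Gamma\times\{ -1,1\})\setminus\{\emptyset\}$ (the head moves every step), with pairwise distinct start, accept and reject states. $M$ runs in time $T(n)$ if for every $n$, every computation of $M$ on every input of length $n$ makes at most $T(n)$ steps. $\mathrm{Run}_{Cn+D}$ is the set of codes of one-tape NTMs with input alphabet $\Sigma$ and tape alphabet $\Gamma$ that run in time $Cn+D$. A $q$-state machine is encoded by a code of length $\Theta(q^2)$ (from which a multi-tape NTM can simulate each step in $O(q^2)$ time, and codes of compositions are computable in linear time); running times of algorithms on such inputs are measured in terms of $q$. -}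

module Defs where

open import Data.Nat using (ℕ; zero; suc; _+_; _*_; _^_; _≤_; _<?_)
open import Data.Fin using (Fin; toℕ; _↑ˡ_; _↑ʳ_; fromℕ<)
import Data.Fin as Fin
open import Data.Integer as ℤ using (ℤ; +_; -[1+_])
open import Data.Bool using (Bool; true; false; if_then_else_)
open import Data.List as List using (List; []; _∷_; _++_; replicate; concatMap; allFin)
open import Data.Vec as Vec using (Vec)
open import Data.Product using (Σ; ∃; ∃₂; _×_; _,_; proj₁)
open import Relation.Binary.PropositionalEquality using (_≡_; _≢_)
open import Relation.Nullary using (¬_; yes; no; does)

-- Alphabets of the input machines.
-- Σ = Fin (2 + a)   (symbol 0 and symbol 1 are the letters 0 and 1)
-- Γ = Fin ((2 + a) + suc b), where Σ is embedded as the first 2+a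
-- symbols and the blank is the symbol with index 2+a (so blank ∈ Γ ∖ Σ).

Σsym : ℕ → Set
Σsym a = Fin (2 + a)

Γsym : ℕ → ℕ → Set
Γsym a b = Fin ((2 + a) + suc b)

inΓ : ∀ {a} b → Σsym a → Γsym a b
inΓ b x = x ↑ˡ suc b

blank : ∀ a b → Γsym a b
blank a b = (2 + a) ↑ʳ Fin.zero

dir : Bool → ℤ
dir false = -[1+ 0 ]
dir true  = + 1

update : {A : Set} → (ℤ → A) → ℤ → A → ℤ → A
update τ h y i = if does (i ℤ.≟ h) then y else τ i

-- One-tape NTMs (the inputs of Run).  States Fin q.  The transition
-- relation is given by its characteristic function δ p x p' y d;
-- it is required to be nonempty on non-halting states.  (Values of δ
-- at the halting states are irrelevant for the semantics.)

record NTM1 (a b : ℕ) : Set where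
  field
    q      : ℕ
    start  : Fin q
    acc    : Fin q
    rej    : Fin q
    start≢acc : start ≢ acc
    start≢rej : start ≢ rej
    acc≢rej   : acc ≢ rej
    δ      : Fin q → Γsym a b → Fin q → Γsym a b → Bool → Bool
    δ-nonempty : ∀ p → p ≢ acc → p ≢ rej → ∀ x →
                 ∃ λ p' → ∃ λ y → ∃ λ d → δ p x p' y d ≡ true

module _ {a b : ℕ} (M : NTM1 a b) where
  open NTM1 M

  Config1 : Set
  Config1 = Fin q × ℤ × (ℤ → Γsym a b)

  data Step1 : Config1 → Config1 → Set where
    step : ∀ {p h τ p' y d} → p ≢ acc → p ≢ rej → δ p (τ h) p' y d ≡ true →
           Step1 (p , h , τ) (p' , h ℤ.+ dir d , update τ h y)

  data Steps1 : ℕ → Config1 → Config1 → Set where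
    done : ∀ {c} → Steps1 0 c c
    more : ∀ {k c c' c''} → Step1 c c' → Steps1 k c' c'' → Steps1 (suc k) c c''

  inputTape : ∀ {n} → Vec (Σsym a) n → ℤ → Γsym a b
  inputTape {n} w (+ i) with i <? n
  ... | yes i<n = inΓ b (Vec.lookup w (fromℕ< i<n))
  ... | no  _   = blank a b
  inputTape w -[1+ _ ] = blank a b

  init1 : ∀ {n} → Vec (Σsym a) n → Config1
  init1 w = start , + 0 , inputTape w

  RunsIn : (ℕ → ℕ) → Set
  RunsIn T = ∀ n (w : Vec (Σsym a) n) c → ¬ Steps1 (suc (T n)) (init1 w) c

-- Binary code of a one-tape NTM: q, start, acc, rej in unary, then the
-- q·|Γ|·q·|Γ|·2 bits of the transition relation.  Length Θ(q²).

unary : ℕ → List Bool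
unary n = replicate n true ++ (false ∷ [])

code : ∀ {a b} → NTM1 a b → List Bool
code {a} {b} M =
  unary q ++ unary (toℕ start) ++ unary (toℕ acc) ++ unary (toℕ rej) ++
  concatMap (λ p → concatMap (λ x → concatMap (λ p' → concatMap (λ y →
     List.map (δ p x p' y) (false ∷ true ∷ []))
     (allFin _)) (allFin q)) (allFin _)) (allFin q)
  where open NTM1 M

-- Multi-tape NTMs (the deciders): suc k tapes, r states, tape alphabet
-- Fin (3 + m) with 0 ↦ bit false, 1 ↦ bit true, 2 = blank.  Moves
-- Fin 3: 0 = left, 1 = stay, 2 = right.  Input is written on tape 0.

record MNTM : Set where
  field
    k r m  : ℕ
    start  : Fin r
    acc    : Fin r
    rej    : Fin r
    acc≢rej : acc ≢ rej
    δ      : Fin r → Vec (Fin (3 + m)) (suc k) → Fin r →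
             Vec (Fin (3 + m)) (suc k) → Vec (Fin 3) (suc k) → Bool

move : Fin 3 → ℤ
move Fin.zero = -[1+ 0 ]
move (Fin.suc Fin.zero) = + 0
move (Fin.suc (Fin.suc Fin.zero)) = + 1

module _ (N : MNTM) where
  open MNTM N

  ConfigM : Set
  ConfigM = Fin r × Vec ℤ (suc k) × Vec (ℤ → Fin (3 + m)) (suc k)

  data StepM : ConfigM → ConfigM → Set where
    step : ∀ {p hs τs p' ys ds} → p ≢ acc → p ≢ rej →
           δ p (Vec.zipWith (λ τ h → τ h) τs hs) p' ys ds ≡ true →
           StepM (p , hs , τs)
                 (p' , Vec.zipWith (λ h d → h ℤ.+ move d) hs ds
                     , Vec.zipWith (λ f y → f y) (Vec.zipWith update τs hs) ys)

  data StepsM : ℕ → ConfigM → ConfigM → Set where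
    done : ∀ {c} → StepsM 0 c c
    more : ∀ {j c c' c''} → StepM c c' → StepsM j c' c'' → StepsM (suc j) c c''

  bitSym : Bool → Fin (3 + m)
  bitSym false = Fin.zero
  bitSym true  = Fin.suc Fin.zero

  nth : List Bool → ℕ → Fin (3 + m)
  nth [] _ = Fin.suc (Fin.suc Fin.zero)
  nth (x ∷ w) zero = bitSym x
  nth (x ∷ w) (suc i) = nth w i

  inTape : List Bool → ℤ → Fin (3 + m)
  inTape w (+ i) = nth w i
  inTape w -[1+ _ ] = Fin.suc (Fin.suc Fin.zero)

  initM : List Bool → ConfigM
  initM w = start , Vec.replicate _ (+ 0)
          , (inTape w Vec.∷ Vec.replicate _ (λ _ → Fin.suc (Fin.suc Fin.zero)))

  Accepts : List Bool → Set
  Accepts w = ∃₂ λ j c → StepsM j (initM w) c × proj₁ c ≡ acc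

  TimeBound : List Bool → ℕ → Set
  TimeBound w t = ∀ c → ¬ StepsM (suc t) (initM w) c

-- t(q) = o(q^((C-1)/4)):  for every ε = 1/(e+1) there is q₀ with
-- t(q) ≤ ε q^((C-1)/4) for all q ≥ q₀, i.e. ((e+1)·t(q))⁴ · q ≤ q^C.

LittleO : (ℕ → ℕ) → ℕ → Set
LittleO t C = ∀ e → ∃ λ q₀ → ∀ q → q₀ ≤ q → ((suc e * t q) ^ 4) * q ≤ q ^ C

module Submission where

open import Defs
open import Data.Nat as ℕ using (ℕ; zero; suc; _+_; _*_; _^_; _∸_; _≤_; _<_; z≤n; s≤s; _<?_; >-nonZero)
open import Data.Nat.Properties as ℕₚ
open import Data.Nat.Tactic.RingSolver using (solve-∀)
open import Data.Fin as Fin using (Fin; toℕ; fromℕ<; _↑ˡ_; _↑ʳ_; splitAt; join; combine; remQuot)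
open import Data.Fin.Patterns using (0F; 1F; 2F; 3F; 4F; 5F; 6F; 7F)
import Data.Fin.Properties as Finₚ
open import Data.Integer as ℤ using (ℤ; -[1+_]) renaming (+_ to pos)
import Data.Integer.Properties as ℤₚ
import Algebra.Properties.AbelianGroup ℤₚ.+-0-abelianGroup as GroupP
open import Data.Bool using (Bool; true; false; if_then_else_; _∧_; _∨_; not)
import Data.Bool.Properties as Boolₚ
open import Data.List as List using (List; []; _∷_; _++_; replicate; concatMap; allFin; length; map; _ʳ++_)
import Data.List.Properties as Listₚ
open import Data.List.Relation.Unary.All using (All; []; _∷_)
open import Data.Vec as Vec using (Vec; []; _∷_; lookup; toList; zipWith)
import Data.Vec.Properties as Vecₚ
open import Data.Maybe using (Maybe; just; nothing)
open import Data.Product using (Σ; ∃; ∃₂; _×_; _,_; proj₁; proj₂)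
open import Data.Sum using (_⊎_; inj₁; inj₂; [_,_]′; fromInj₁)
open import Data.Unit using (⊤; tt)
open import Data.Empty using (⊥; ⊥-elim)
open import Function using (_∘_; id)
open import Function.Bundles using (_⇔_; Equivalence)
open import Relation.Binary.PropositionalEquality hiding (J)
open import Relation.Nullary using (¬_; yes; no; does; Dec; contradiction)
open import Relation.Nullary.Decidable using (dec-true; dec-false; map′)

-- If C ≤ 5 then t(q) ≤ q for large q, and the decider sees only the initial ones of the code
-- of a q-state machine.
--
-- Otherwise put s = C - 1.  From a decider N we build machines M whose states are a fixed core
-- together with P copies of O(1) states.  In s passes over the input, the i-th pass replaces every
-- P-th mark by a mark of the next pass, M checks that P^s divides n + 1, halting if not; so n is
-- of order q^s.  The last pass erases the input.  In its final linear-time phase M then writes P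
-- items of a data string, from which it prints its own code, and simulates N on it, looping forever
-- as soon as N accepts.  The data string contains the transition table of the core, which does not
-- depend on P, so there is no circularity.  The simulation takes time O((P² + t(q))²), which is less
-- than P^s because C ≥ 6 and t(q)⁴ ≤ q^s.  Hence N accepts the code of M exactly if M does not run
-- in time Cn + D.
--
-- The core simulates a machine with several stacks, whose columns are stored side by side on the
-- tape; one step is one round trip of the head.  Every state may also move to the rejecting state,
-- which is harmless for lower bounds on long computations and makes all rows of the table nonempty.

-- The core must print a code of length of order P² without knowing P, which reaches it only as the
-- number of items on the tape. Outside the core a transition depends on the item numbers of its two
-- states only through flags of the items, their equality and their succession, so nested loops over
-- the items can regenerate the table. The order of the definitions breaks the circle: `N` fixes the
-- stack alphabet and the row width, these and s fix the modes, then come the script, the core and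
-- its table. The number `r` of padding items comes last and makes room for one bit of that table
-- per item.
--
-- The rows grow by one in every round trip, so S steps of the stack machine are bounded by order
-- S², and printing alone takes S of order P². A constant times P⁴ stays below P^s for large P only
-- from s = 5 on, that is, from C = 6 on; for C at most 5 the bound on t becomes t(q) ≤ q. If `N`
-- does not accept, the passes use s(n + 1) of the Cn + D steps, so about n steps must suffice for
-- the final phase, and n + 1 is then a multiple of P^s.

does⇒ : ∀ {P : Set} (d : Dec P) → does d ≡ true → P
does⇒ (yes p) _ = p

-- Finite types and lists of bounded length

record Finite (X : Set) : Set where
  field
    card    : ℕ
    to      : X → Fin card
    from    : Fin card → X
    from-to : ∀ x → from (to x) ≡ x

  to-injective : ∀ {x y} → to x ≡ to y → x ≡ y
  to-injective {x} {y} eq = trans (sym (from-to x)) (trans (cong from eq) (from-to y))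

  infix 4 _≟ᶠ_
  _≟ᶠ_ : (x y : X) → Dec (x ≡ y)
  x ≟ᶠ y = map′ to-injective (cong to) (to x Fin.≟ to y)

open Finite using (card)

finFin : ∀ n → Finite (Fin n)
finFin n = record { card = n ; to = id ; from = id ; from-to = λ _ → refl }

finRetract : ∀ {X Y : Set} (f : X → Y) (g : Y → X) → (∀ x → g (f x) ≡ x) → Finite Y → Finite X
finRetract f g gf F = record
  { card = card F ; to = F.to ∘ f ; from = g ∘ F.from
  ; from-to = λ x → trans (cong g (F.from-to (f x))) (gf x) }
  where module F = Finite F

fin⊤ : Finite ⊤
fin⊤ = record { card = 1 ; to = λ _ → 0F ; from = λ _ → tt ; from-to = λ _ → refl }

infixr 2 _fin×_
infixr 1 _fin⊎_

_fin×_ : ∀ {X Y : Set} → Finite X → Finite Y → Finite (X × Y)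
_fin×_ {X} {Y} F G = record
  { card = card F * card G
  ; to = λ (x , y) → combine (F.to x) (G.to y)
  ; from = λ i → pair (remQuot (card G) i)
  ; from-to = λ (x , y) → trans (cong pair (Finₚ.remQuot-combine (F.to x) (G.to y)))
                                (cong₂ _,_ (F.from-to x) (G.from-to y)) }
  where
  module F = Finite F
  module G = Finite G
  pair : Fin (card F) × Fin (card G) → X × Y
  pair (i , j) = F.from i , G.from j

_fin⊎_ : ∀ {X Y : Set} → Finite X → Finite Y → Finite (X ⊎ Y)
_fin⊎_ {X} {Y} F G = record
  { card = card F + card G
  ; to = λ z → join (card F) (card G) (img z)
  ; from = λ i → pre (splitAt (card F) i)
  ; from-to = λ z → trans (cong pre (Finₚ.splitAt-join (card F) (card G) (img z))) (pre-img z) }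
  where
  module F = Finite F
  module G = Finite G
  img : X ⊎ Y → Fin (card F) ⊎ Fin (card G)
  img (inj₁ x) = inj₁ (F.to x)
  img (inj₂ y) = inj₂ (G.to y)
  pre : Fin (card F) ⊎ Fin (card G) → X ⊎ Y
  pre (inj₁ i) = inj₁ (F.from i)
  pre (inj₂ j) = inj₂ (G.from j)
  pre-img : ∀ z → pre (img z) ≡ z
  pre-img (inj₁ x) = cong inj₁ (F.from-to x)
  pre-img (inj₂ y) = cong inj₂ (G.from-to y)

finBool : Finite Bool
finBool = finRetract f g (λ { true → refl ; false → refl }) (finFin 2)
  where
  f : Bool → Fin 2
  f false = 0F
  f true  = 1F
  g : Fin 2 → Bool
  g 0F = false
  g (Fin.suc _) = true

finVec : ∀ {X : Set} → Finite X → ∀ n → Finite (Vec X n)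
finVec F zero = finRetract (λ _ → tt) (λ _ → []) (λ { [] → refl }) fin⊤
finVec F (suc n) = finRetract (λ { (x ∷ xs) → x , xs }) (λ (x , xs) → x ∷ xs)
                     (λ { (x ∷ xs) → refl }) (F fin× finVec F n)

-- Pending tokens and kinds are part of a control state; the bound keeps the set of control states
-- finite.
data BList (X : Set) : ℕ → Set where
  []  : ∀ {n} → BList X n
  _∷_ : ∀ {n} → X → BList X n → BList X (suc n)

finBList : ∀ {X : Set} → Finite X → ∀ n → Finite (BList X n)
finBList F zero = finRetract (λ _ → tt) (λ _ → []) (λ { [] → refl }) fin⊤
finBList {X} F (suc n) = finRetract f g gf (fin⊤ fin⊎ (F fin× finBList F n))
  where
  f : BList X (suc n) → ⊤ ⊎ (X × BList X n)
  f [] = inj₁ tt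
  f (x ∷ xs) = inj₂ (x , xs)
  g : ⊤ ⊎ (X × BList X n) → BList X (suc n)
  g (inj₁ _) = []
  g (inj₂ (x , xs)) = x ∷ xs
  gf : ∀ l → g (f l) ≡ l
  gf [] = refl
  gf (x ∷ l) = refl

module _ {X : Set} where

  unbound : ∀ {n} → BList X n → List X
  unbound [] = []
  unbound (x ∷ l) = x ∷ unbound l

  -- Popping keeps the bound, so the rest lives in the same finite type and a loop runs over one set
  -- of states.
  weaken : ∀ {n} → BList X n → BList X (suc n)
  weaken [] = []
  weaken (x ∷ l) = x ∷ weaken l

  unbound-weaken : ∀ {n} (l : BList X n) → unbound (weaken l) ≡ unbound l
  unbound-weaken [] = refl
  unbound-weaken (x ∷ l) = cong (x ∷_) (unbound-weaken l)

  pop : ∀ {n} → BList X n → Maybe (X × BList X n)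
  pop [] = nothing
  pop (x ∷ l) = just (x , weaken l)

  pop-[] : ∀ {n} (l : BList X n) → unbound l ≡ [] → pop l ≡ nothing
  pop-[] [] _ = refl

  pop-∷ : ∀ {n} (l : BList X n) {x xs} → unbound l ≡ x ∷ xs →
          ∃ λ l′ → pop l ≡ just (x , l′) × unbound l′ ≡ xs
  pop-∷ (x ∷ l) refl = weaken l , refl , unbound-weaken l

  bound : ∀ n → List X → BList X n
  bound zero _ = []
  bound (suc n) [] = []
  bound (suc n) (x ∷ xs) = x ∷ bound n xs

  unbound-bound : ∀ n xs → length xs ≤ n → unbound (bound n xs) ≡ xs
  unbound-bound zero [] _ = refl
  unbound-bound (suc n) [] _ = refl
  unbound-bound (suc n) (x ∷ xs) (s≤s le) = cong (x ∷_) (unbound-bound n xs le)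

-- Two-way infinite tapes as pairs of lists

tl : ∀ {X : Set} → List X → List X
tl [] = []
tl (_ ∷ xs) = xs

-- A half-tape is a list, continued by the default symbol.
module HalfTape {X : Set} (dflt : X) where

  hd : List X → X
  hd [] = dflt
  hd (x ∷ _) = x

  at : List X → ℕ → X
  at [] _ = dflt
  at (x ∷ xs) zero = x
  at (x ∷ xs) (suc i) = at xs i

  at-0 : ∀ xs → at xs 0 ≡ hd xs
  at-0 [] = refl
  at-0 (x ∷ xs) = refl

  at-tl : ∀ xs i → at (tl xs) i ≡ at xs (suc i)
  at-tl [] i = refl
  at-tl (x ∷ xs) i = refl

  Blank : List X → Set
  Blank xs = ∀ i → at xs i ≡ dflt

  blank-hd : ∀ {xs} → Blank xs → hd xs ≡ dflt
  blank-hd {xs} b = trans (sym (at-0 xs)) (b 0)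

  blank-tl : ∀ {xs} → Blank xs → Blank (tl xs)
  blank-tl {xs} b i = trans (at-tl xs i) (b (suc i))

  blank-[] : Blank []
  blank-[] i = refl

  blank-∷ : ∀ {xs} → Blank xs → Blank (dflt ∷ xs)
  blank-∷ b zero = refl
  blank-∷ b (suc i) = b i

  Tape : Set
  Tape = List X × List X

  cellAt : Tape → ℤ → X
  cellAt (L , R) (pos i) = at R i
  cellAt (L , R) -[1+ i ] = at L i

  shift : Fin 3 → X → Tape → Tape
  shift 0F y (L , R) = tl L , hd L ∷ y ∷ tl R
  shift 1F y (L , R) = L , y ∷ tl R
  shift 2F y (L , R) = y ∷ L , tl R

  -- Cells are compared by their offset from the head, so a move becomes a shift of the two lists.
  record Rep (z : Tape) (h : ℤ) (τ : ℤ → X) : Set where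
    constructor rep
    field cell : ∀ i → τ (h ℤ.+ i) ≡ cellAt z i
  open Rep public

  rep-read : ∀ {L R h τ} → Rep (L , R) h τ → τ h ≡ hd R
  rep-read {L} {R} {h} {τ} r = trans (cong τ (sym (ℤₚ.+-identityʳ h))) (trans (cell r (pos 0)) (at-0 R))

  private
    cell-shift : ∀ m y z i → cellAt (shift m y z) i ≡ cellAt (shift 1F y z) (move m ℤ.+ i)
    cell-shift 0F y (L , R) (pos zero) = sym (at-0 L)
    cell-shift 0F y (L , R) (pos (suc zero)) = refl
    cell-shift 0F y (L , R) (pos (suc (suc i))) = refl
    cell-shift 0F y (L , R) -[1+ i ] = at-tl L i
    cell-shift 1F y (L , R) (pos i) = refl
    cell-shift 1F y (L , R) -[1+ i ] = refl
    cell-shift 2F y (L , R) (pos i) = refl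
    cell-shift 2F y (L , R) -[1+ zero ] = refl
    cell-shift 2F y (L , R) -[1+ suc i ] = refl

    write-ne : ∀ y z {i} → i ≢ pos 0 → cellAt z i ≡ cellAt (shift 1F y z) i
    write-ne y z {pos zero} ne = contradiction refl ne
    write-ne y (L , R) {pos (suc i)} ne = sym (at-tl R i)
    write-ne y z { -[1+ i ]} ne = refl

  rep-update : ∀ {z h τ} y → Rep z h τ → ∀ i →
               update τ h y (h ℤ.+ i) ≡ cellAt (shift 1F y z) i
  rep-update {z} {h} {τ} y r i with h ℤ.+ i ℤ.≟ h
  ... | yes e = sym (cong (cellAt (shift 1F y z))
                  (GroupP.∙-cancelˡ h i (pos 0) (trans e (sym (ℤₚ.+-identityʳ h)))))
  ... | no ne = trans (cell r i) (write-ne y z λ e → ne (trans (cong (λ k → h ℤ.+ k) e) (ℤₚ.+-identityʳ h)))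

  rep-shift : ∀ {z h τ} m y → Rep z h τ → Rep (shift m y z) (h ℤ.+ move m) (update τ h y)
  rep-shift {z} {h} {τ} m y r = rep λ i →
    trans (cong (update τ h y) (ℤₚ.+-assoc h (move m) i))
      (trans (rep-update y r (move m ℤ.+ i)) (sym (cell-shift m y z i)))

-- Runs of a one-tape machine, described along the direction of motion

-- Zipper configurations of a one-tape machine: a state, the direction of the
-- last move, the half-tape behind the head and the half-tape ahead of it, the
-- scanned cell being the first cell ahead.
module Zip {a b : ℕ} (M : NTM1 a b) where
  open NTM1 M
  open HalfTape (blank a b) public

  Sym : Set
  Sym = Γsym a b

  -- With the halves named behind and ahead, a leftward and a rightward sweep are the same
  -- computation, and one lemma serves passes in both directions; a turn swaps the halves.
  go : Bool → Bool → Sym → List Sym → List Sym → Bool × List Sym × List Sym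
  go false false y B F = false , y ∷ B , tl F
  go true  true  y B F = true  , y ∷ B , tl F
  go false true  y B F = true  , y ∷ tl F , B
  go true  false y B F = false , y ∷ tl F , B

  ZConf : Set
  ZConf = Fin q × Bool × List Sym × List Sym

  data ZStep : ZConf → ZConf → Set where
    zstep : ∀ {p d B F p′} y e → p ≢ acc → p ≢ rej → δ p (hd F) p′ y e ≡ true →
            ZStep (p , d , B , F) (p′ , go d e y B F)

  data ZSteps : ℕ → ZConf → ZConf → Set where
    []  : ∀ {c} → ZSteps 0 c c
    _∷_ : ∀ {k c c′ c″} → ZStep c c′ → ZSteps k c′ c″ → ZSteps (suc k) c c″

  infixr 5 _+++_
  _+++_ : ∀ {j k c c′ c″} → ZSteps j c c′ → ZSteps k c′ c″ → ZSteps (j + k) c c″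
  [] +++ t = t
  (s ∷ ss) +++ t = s ∷ (ss +++ t)

  ztruncate : ∀ j {k c c″} → ZSteps (j + k) c c″ → ∃ (ZSteps j c)
  ztruncate zero _ = _ , []
  ztruncate (suc j) (s ∷ ss) with ztruncate j ss
  ... | _ , ts = _ , s ∷ ts

  tape : Bool × List Sym × List Sym → Tape
  tape (true , B , F) = B , F
  tape (false , B , F) = tl F , hd F ∷ B

  dirMove : Bool → Fin 3
  dirMove false = 0F
  dirMove true = 2F

  go-shift : ∀ d e y B F → tape (go d e y B F) ≡ shift (dirMove e) y (tape (d , B , F))
  go-shift false false y B F = refl
  go-shift true true y B F = refl
  go-shift false true y B F = refl
  go-shift true false y B F = refl

  ZRep : ZConf → Config1 M → Set
  ZRep (p , z) (p′ , h , τ) = p ≡ p′ × Rep (tape z) h τ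

  private
    read : ∀ {d B F h τ} → Rep (tape (d , B , F)) h τ → τ h ≡ hd F
    read {true} {B} {F} r = rep-read r
    read {false} {B} {F} r = rep-read r

    rep-go : ∀ {z h τ} e y → Rep (tape z) h τ →
             Rep (tape (go (proj₁ z) e y (proj₁ (proj₂ z)) (proj₂ (proj₂ z)))) (h ℤ.+ dir e) (update τ h y)
    rep-go {d , B , F} {h} {τ} false y r rewrite go-shift d false y B F = rep-shift 0F y r
    rep-go {d , B , F} {h} {τ} true y r rewrite go-shift d true y B F = rep-shift 2F y r

  from-steps : ∀ {k z c c′} → ZRep z c → Steps1 M k c c′ → ∃ (ZSteps k z)
  from-steps _ done = _ , []
  from-steps {z = p , d , B , F} (refl , r) (more (step {τ = τ} {y = y} {d = e} na nr t) ss)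
    with from-steps (refl , rep-go e y r) ss
  ... | _ , zs = _ , zstep y e na nr (trans (cong (λ x → δ p x _ y e) (sym (read {d} r))) t) ∷ zs

  to-steps : ∀ {k z c z′} → ZRep z c → ZSteps k z z′ → ∃ (Steps1 M k c)
  to-steps _ [] = _ , done
  to-steps {z = p , d , B , F} (refl , r) (zstep y e na nr t ∷ zs)
    with to-steps (refl , rep-go e y r) zs
  ... | _ , ss = _ , more (step na nr (trans (cong (λ x → δ p x _ y e) (read {d} r)) t)) ss

  zinit : ∀ {n} → Vec (Σsym a) n → ZConf
  zinit w = start , true , [] , map (inΓ b) (toList w)

  private
    at-input : ∀ {n} (w : Vec (Σsym a) n) i (i<n : i < n) →
               at (map (inΓ b) (toList w)) i ≡ inΓ b (lookup w (fromℕ< i<n))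
    at-input (x ∷ w) zero (s≤s _) = refl
    at-input (x ∷ w) (suc i) (s≤s i<n) = at-input w i i<n

    at-beyond : ∀ {n} (w : Vec (Σsym a) n) i → ¬ i < n → at (map (inΓ b) (toList w)) i ≡ blank a b
    at-beyond [] i _ = refl
    at-beyond (x ∷ w) zero ¬p = contradiction (s≤s z≤n) ¬p
    at-beyond (x ∷ w) (suc i) ¬p = at-beyond w i (λ p → ¬p (s≤s p))

  zinit-rep : ∀ {n} (w : Vec (Σsym a) n) → ZRep (zinit w) (init1 M w)
  zinit-rep {n} w = refl , rep go′
    where
    go′ : ∀ i → inputTape M w (pos 0 ℤ.+ i) ≡ cellAt ([] , map (inΓ b) (toList w)) i
    go′ (pos i) with i <? n
    ... | yes p = sym (at-input w i p)
    ... | no ¬p = sym (at-beyond w i ¬p)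
    go′ -[1+ i ] = refl

  -- c leads to c′ in k steps, and no computation of more than k steps avoids c′.
  record Det (k : ℕ) (c c′ : ZConf) : Set where
    constructor mkDet
    field
      run    : ZSteps k c c′
      follow : ∀ {j c″} → ZSteps (k + suc j) c c″ → ZSteps (suc j) c′ c″
  open Det public

  det-refl : ∀ {c} → Det 0 c c
  det-refl = mkDet [] id

  det-trans : ∀ {k l c c′ c″} → Det k c c′ → Det l c′ c″ → Det (k + l) c c″
  det-trans {k} {l} {c} {c′} D E = mkDet (run D +++ run E) λ {j} {c‴} s →
    follow E (subst (λ m → ZSteps m c′ c‴) (sym (+-suc l j))
      (follow D (subst (λ m → ZSteps m c c‴)
        (trans (+-assoc k l (suc j)) (cong (k +_) (+-suc l j))) s)))

  stuck : ∀ {k p z c} → p ≡ rej → ¬ ZSteps (suc k) (p , z) c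
  stuck eq (zstep _ _ _ nr _ ∷ _) = nr eq

  stuck-+ : ∀ k {j p z c} → p ≡ rej → ¬ ZSteps (k + suc j) (p , z) c
  stuck-+ zero = stuck
  stuck-+ (suc k) = stuck

  det-to : ∀ {k c c′ c″} → c′ ≡ c″ → Det k c c′ → Det k c c″
  det-to refl D = D

  det-cast : ∀ {k l c c′} → k ≡ l → Det k c c′ → Det l c c′
  det-cast refl D = D

  -- A halting alternative does not affect longer computations.
  det-step : ∀ {p d B F p′} y e → p ≢ acc → p ≢ rej → δ p (hd F) p′ y e ≡ true →
             (∀ p″ y′ e′ → δ p (hd F) p″ y′ e′ ≡ true →
                p″ ≡ rej ⊎ (p″ ≡ p′ × y′ ≡ y × e′ ≡ e)) →
             Det 1 (p , d , B , F) (p′ , go d e y B F)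
  det-step {p} {d} {B} {F} {p′} y e na nr t uniq = mkDet (zstep y e na nr t ∷ []) fol
    where
    fol : ∀ {j c″} → ZSteps (1 + suc j) (p , d , B , F) c″ → ZSteps (suc j) (p′ , go d e y B F) c″
    fol (zstep y′ e′ _ _ t′ ∷ ss) with uniq _ y′ e′ t′
    ... | inj₁ eq = ⊥-elim (stuck eq ss)
    ... | inj₂ (refl , refl , refl) = ss

  -- The rejecting state can still be entered, so it is the second step that is excluded.
  no-step : ∀ {j p z c} → (∀ p″ y′ e′ → δ p (hd (proj₂ (proj₂ z))) p″ y′ e′ ≡ true → p″ ≡ rej) →
            ¬ ZSteps (suc (suc j)) (p , z) c
  no-step all (zstep y e _ _ t ∷ ss) = stuck (all _ _ _ t) ss

-- Parallel stacks and the two carries of a round trip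

data Op (A : Set) : Set where
  keep pops   : Op A
  pushes puts : A → Op A
  pushes₂     : A → A → Op A

-- `pushes₂` replaces the top by two symbols: the right half of a tape needs this when its head
-- writes and moves left.
apply : ∀ {A : Set} → Op A → List A → List A
apply keep l = l
apply pops l = tl l
apply (pushes x) l = x ∷ l
apply (puts x) l = x ∷ tl l
apply (pushes₂ x y) l = x ∷ y ∷ tl l

-- Stacks are stored in parallel: a row holds one symbol of every stack.
-- A push moves a column away from the top by a carry travelling down the rows,
-- a pop moves it back by a carry travelling up.
module Rows {A : Set} (dflt : A) where
  open HalfTape dflt

  sel : ∀ {n} → Vec Bool n → Vec A n → Vec A n → Vec A n
  sel [] [] [] = []
  sel (m ∷ ms) (c ∷ cs) (x ∷ xs) = (if m then c else x) ∷ sel ms cs xs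

  lookup-sel : ∀ {n} (m : Vec Bool n) c x j →
               lookup (sel m c x) j ≡ (if lookup m j then lookup c j else lookup x j)
  lookup-sel (m ∷ ms) (c ∷ cs) (x ∷ xs) 0F = refl
  lookup-sel (m ∷ ms) (c ∷ cs) (x ∷ xs) (Fin.suc j) = lookup-sel ms cs xs j

  Row : ℕ → Set
  Row n = Vec A n

  blanks : ∀ n → Row n
  blanks n = Vec.replicate n dflt

  col : ∀ {n} → Fin n → List (Row n) → List A
  col j = map (λ r → lookup r j)

  lastCarry : ∀ {n} → Vec Bool n → Row n → List (Row n) → Row n
  lastCarry m c [] = c
  lastCarry m c (r ∷ rs) = lastCarry m (sel m r c) rs

  shiftDown : ∀ {n} → Vec Bool n → Row n → List (Row n) → List (Row n)
  shiftDown m c [] = []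
  shiftDown m c (r ∷ rs) = sel m c r ∷ shiftDown m (sel m r c) rs

  -- What is carried past the last row opens a new one, so the height grows by one in every round
  -- trip, whether or not anything is pushed.
  down : ∀ {n} → Vec Bool n → Row n → List (Row n) → List (Row n)
  down m c rs = shiftDown m c rs ++ sel m (lastCarry m c rs) (blanks _) ∷ []

  up : ∀ {n} → Vec Bool n → List (Row n) → Row n × List (Row n)
  up m [] = blanks _ , []
  up m (r ∷ rs) = sel m r (proj₁ (up m rs)) , sel m (proj₁ (up m rs)) r ∷ proj₂ (up m rs)

  length-down : ∀ {n} (m : Vec Bool n) c rs → length (down m c rs) ≡ suc (length rs)
  length-down m c [] = refl
  length-down m c (r ∷ rs) = cong suc (length-down m (sel m r c) rs)

  length-up : ∀ {n} (m : Vec Bool n) rs → length (proj₂ (up m rs)) ≡ length rs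
  length-up m [] = refl
  length-up m (r ∷ rs) = cong suc (length-up m rs)

  -- The new row ends the columns that are not pushed with a default symbol, so columns agree only
  -- cell by cell, through `at`.
  col-down : ∀ {n} (m : Vec Bool n) c rs j i →
             at (col j (down m c rs)) i ≡ at (if lookup m j then lookup c j ∷ col j rs else col j rs) i
  col-down m c [] j i with lookup m j | lookup-sel m c (blanks _) j
  col-down m c [] j i | true | eq = cong (λ x → at (x ∷ []) i) eq
  col-down m c [] j zero | false | eq = trans eq (Vecₚ.lookup-replicate j dflt)
  col-down m c [] j (suc i) | false | eq = refl
  col-down m c (r ∷ rs) j i with lookup m j | lookup-sel m c r j | lookup-sel m r c j | col-down m (sel m r c) rs j
  col-down m c (r ∷ rs) j zero | true | e | e′ | ih = e
  col-down m c (r ∷ rs) j (suc i) | true | e | e′ | ih = trans (ih i) (cong (λ x → at (x ∷ col j rs) i) e′)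
  col-down m c (r ∷ rs) j zero | false | e | e′ | ih = e
  col-down m c (r ∷ rs) j (suc i) | false | e | e′ | ih = ih i

  up-carry : ∀ {n} (m : Vec Bool n) rs j → lookup m j ≡ true → lookup (proj₁ (up m rs)) j ≡ hd (col j rs)
  up-carry m [] j eq = Vecₚ.lookup-replicate j dflt
  up-carry m (r ∷ rs) j eq = trans (lookup-sel m r _ j) (cong (λ b → if b then lookup r j else lookup (proj₁ (up m rs)) j) eq)

  col-up : ∀ {n} (m : Vec Bool n) rs j i →
           at (col j (proj₂ (up m rs))) i ≡ at (if lookup m j then tl (col j rs) else col j rs) i
  col-up m [] j i with lookup m j
  ... | true = refl
  ... | false = refl
  col-up m (r ∷ rs) j i with lookup m j in eq | lookup-sel m (proj₁ (up m rs)) r j | col-up m rs j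
  col-up m (r ∷ rs) j zero | true | e | ih = trans e (trans (up-carry m rs j eq) (sym (at-0 (col j rs))))
  col-up m (r ∷ rs) j (suc i) | true | e | ih = trans (ih i) (at-tl (col j rs) i)
  col-up m (r ∷ rs) j zero | false | e | ih = e
  col-up m (r ∷ rs) j (suc i) | false | e | ih = ih i

  isPush isPop : Op A → Bool
  isPush (pushes _) = true
  isPush (pushes₂ _ _) = true
  isPush _ = false
  isPop pops = true
  isPop _ = false

  -- The tops are held in the finite control and not on the tape: a push sends the old top down into
  -- the rows, and a pop fetches the new top from them.
  carry newTop : Op A → A → A
  carry (pushes₂ _ y) t = y
  carry _ t = t
  newTop (pushes x) t = x
  newTop (puts x) t = x
  newTop (pushes₂ x _) t = x
  newTop _ t = t

  pushMask popMask : ∀ {n} → Vec (Op A) n → Vec Bool n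
  pushMask = Vec.map isPush
  popMask = Vec.map isPop
  carries newTops : ∀ {n} → Vec (Op A) n → Row n → Row n
  carries = Vec.zipWith carry
  newTops = Vec.zipWith newTop

  roundTrip : ∀ {n} → Vec (Op A) n → Row n → List (Row n) → Row n × List (Row n)
  roundTrip os t rs = sel (popMask os) (proj₁ u) (newTops os t) , proj₂ u
    where u = up (popMask os) (down (pushMask os) (carries os t) rs)

  Stores : ∀ {n} → Row n → List (Row n) → Vec (List A) n → Set
  Stores t rs st = ∀ j i → at (col j (t ∷ rs)) i ≡ at (lookup st j) i

  applies : ∀ {n} → Vec (Op A) n → Vec (List A) n → Vec (List A) n
  applies = Vec.zipWith apply

  private
    at-tl-cong : ∀ {xs ys} → (∀ i → at xs i ≡ at ys i) → ∀ i → at (tl xs) i ≡ at (tl ys) i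
    at-tl-cong {xs} {ys} eq i = trans (at-tl xs i) (trans (eq (suc i)) (sym (at-tl ys i)))

    at-∷-cong : ∀ {x y xs ys} → x ≡ y → (∀ i → at xs i ≡ at ys i) → ∀ i → at (x ∷ xs) i ≡ at (y ∷ ys) i
    at-∷-cong e eq zero = e
    at-∷-cong e eq (suc i) = eq i

  -- Every column can be checked alone because `sel` acts columnwise. A push is done by the downward
  -- carry, a pop by the upward one, and no operation uses both.
  roundTrip-stores : ∀ {n} (os : Vec (Op A) n) {t rs st} → Stores t rs st →
                     Stores (proj₁ (roundTrip os t rs)) (proj₂ (roundTrip os t rs)) (applies os st)
  roundTrip-stores {n} os {t} {rs} {st} S j = result
    where
    D = down (pushMask os) (carries os t) rs
    o = lookup os j
    T = lookup t j
    C = col j rs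
    L = lookup st j
    tlC : ∀ i → at C i ≡ at (tl L) i
    tlC = at-tl-cong {xs = T ∷ C} {ys = L} (S j)
    eD : ∀ i → at (col j D) i ≡ at (if isPush o then carry o T ∷ C else C) i
    eD i = trans (col-down (pushMask os) (carries os t) rs j i)
      (cong₂ (λ p c → at (if p then c ∷ C else C) i) (Vecₚ.lookup-map j isPush os) (Vecₚ.lookup-zipWith carry j os t))
    popj = Vecₚ.lookup-map j isPop os
    eU : ∀ i → at (col j (proj₂ (roundTrip os t rs))) i ≡ at (if isPop o then tl (col j D) else col j D) i
    eU i = trans (col-up (popMask os) D j i) (cong (λ p → at (if p then tl (col j D) else col j D) i) popj)
    eT : lookup (proj₁ (roundTrip os t rs)) j ≡ (if isPop o then lookup (proj₁ (up (popMask os) D)) j else newTop o T)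
    eT = trans (lookup-sel (popMask os) _ (newTops os t) j)
           (cong₂ (λ p x → if p then lookup (proj₁ (up (popMask os) D)) j else x) popj (Vecₚ.lookup-zipWith newTop j os t))
    eP : isPop o ≡ true → lookup (proj₁ (up (popMask os) D)) j ≡ hd (col j D)
    eP e = up-carry (popMask os) D j (trans popj e)
    fin : ∀ o →
          (∀ i → at (col j D) i ≡ at (if isPush o then carry o T ∷ C else C) i) →
          (∀ i → at (col j (proj₂ (roundTrip os t rs))) i ≡ at (if isPop o then tl (col j D) else col j D) i) →
          lookup (proj₁ (roundTrip os t rs)) j ≡ (if isPop o then lookup (proj₁ (up (popMask os) D)) j else newTop o T) →
          (isPop o ≡ true → lookup (proj₁ (up (popMask os) D)) j ≡ hd (col j D)) →
          ∀ i → at (col j (proj₁ (roundTrip os t rs) ∷ proj₂ (roundTrip os t rs))) i ≡ at (apply o L) i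
    fin keep d u t′ p i = trans (at-∷-cong t′ (λ i → trans (u i) (d i)) i) (S j i)
    fin pops d u t′ p zero = trans t′ (trans (p refl) (trans (sym (at-0 (col j D))) (trans (d 0) (tlC 0))))
    fin pops d u t′ p (suc i) = trans (u i) (trans (at-tl-cong {xs = col j D} {ys = tl L} (λ i → trans (d i) (tlC i)) i) (at-tl (tl L) i))
    fin (pushes x) d u t′ p = at-∷-cong t′ λ i → trans (u i) (trans (d i) (S j i))
    fin (puts x) d u t′ p = at-∷-cong t′ λ i → trans (u i) (trans (d i) (tlC i))
    fin (pushes₂ x y) d u t′ p = at-∷-cong t′ λ i → trans (u i) (trans (d i) (at-∷-cong refl tlC i))
    result : ∀ i → at (col j (proj₁ (roundTrip os t rs) ∷ proj₂ (roundTrip os t rs))) i ≡ at (lookup (applies os st) j) i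
    result i = trans (fin o eD eU eT eP i) (cong (λ l → at l i) (sym (Vecₚ.lookup-zipWith apply j os st)))

module _ {X : Set} where
  toList-inj : ∀ {n} {u v : Vec X n} → toList u ≡ toList v → u ≡ v
  toList-inj {u = []} {[]} _ = refl
  toList-inj {u = x ∷ u} {y ∷ v} eq = cong₂ _∷_ (Listₚ.∷-injectiveˡ eq) (toList-inj (Listₚ.∷-injectiveʳ eq))

  lookup-ext : ∀ {n} {u v : Vec X n} → (∀ j → lookup u j ≡ lookup v j) → u ≡ v
  lookup-ext {u = []} {[]} _ = refl
  lookup-ext {u = x ∷ u} {y ∷ v} eq = cong₂ _∷_ (eq 0F) (lookup-ext (eq ∘ Fin.suc))

toList-zipWith : ∀ {X Y Z : Set} (f : X → Y → Z) {n} (u : Vec X n) v →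
                 toList (zipWith f u v) ≡ List.zipWith f (toList u) (toList v)
toList-zipWith f [] [] = refl
toList-zipWith f (x ∷ u) (y ∷ v) = cong (f x y ∷_) (toList-zipWith f u v)

zipWith-∷ʳ : ∀ {X Y Z : Set} (f : X → Y → Z) {n} (u : Vec X n) v x y →
             zipWith f (u Vec.∷ʳ x) (v Vec.∷ʳ y) ≡ zipWith f u v Vec.∷ʳ f x y
zipWith-∷ʳ f [] [] x y = refl
zipWith-∷ʳ f (a ∷ u) (b ∷ v) x y = cong (f a b ∷_) (zipWith-∷ʳ f u v x y)

zipWith-reverse : ∀ {X Y Z : Set} (f : X → Y → Z) {n} (u : Vec X n) v →
                  zipWith f (Vec.reverse u) (Vec.reverse v) ≡ Vec.reverse (zipWith f u v)
zipWith-reverse f [] [] = refl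
zipWith-reverse f (x ∷ u) (y ∷ v)
  rewrite Vecₚ.reverse-∷ x u | Vecₚ.reverse-∷ y v | Vecₚ.reverse-∷ (f x y) (zipWith f u v) =
  trans (zipWith-∷ʳ f (Vec.reverse u) (Vec.reverse v) x y) (cong (Vec._∷ʳ f x y) (zipWith-reverse f u v))

-- Carries and symbols bit by bit

-- Queues of (mask , carried bit), consumed in step with the bits of a row.
Entry : Set
Entry = Bool × Bool

emit : Entry → Bool → Bool
emit (m , c) x = if m then c else x

absorb : Entry → Bool → Entry
absorb (m , c) x = m , (if m then x else c)

front : ∀ {n} → Vec Entry n → Entry
front [] = false , false
front (e ∷ _) = e

-- A row occupies many cells, since a cell of the simulation holds one bit. The entry used for a
-- cell goes to the back of the queue and is due again at the same place of the next row.
rotate : ∀ {n} → Vec Entry n → Bool → Vec Entry n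
rotate [] x = []
rotate (e ∷ q) x = q Vec.∷ʳ absorb e x

rotates : ∀ {n} → Vec Entry n → List Bool → Vec Entry n
rotates q [] = q
rotates q (x ∷ xs) = rotates (rotate q x) xs

emits : ∀ {n} → Vec Entry n → List Bool → List Bool
emits q [] = []
emits q (x ∷ xs) = emit (front q) x ∷ emits (rotate q x) xs

private
  queue-run : ∀ {n} (q : Vec Entry n) xs as bs → toList q ≡ as ++ bs → length as ≡ length xs →
              toList (rotates q xs) ≡ bs ++ List.zipWith absorb as xs × emits q xs ≡ List.zipWith emit as xs
  queue-run q [] [] bs eq _ = trans eq (sym (Listₚ.++-identityʳ bs)) , refl
  queue-run (a ∷ q) (x ∷ xs) (_ ∷ as) bs eq₀ len with Listₚ.∷-injective eq₀
  ... | refl , eq with queue-run (q Vec.∷ʳ absorb a x) xs as (bs ++ List.[ absorb a x ])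
          (trans (Vecₚ.toList-∷ʳ (absorb a x) q)
            (trans (cong (_++ List.[ absorb a x ]) eq) (Listₚ.++-assoc as bs _)))
          (suc-injective len)
  ... | e₁ , e₂ = trans e₁ (Listₚ.++-assoc bs _ _) , cong (emit a x ∷_) e₂

-- The queue is as long as the row: each entry meets the bit of its own place once, and afterwards
-- the queue is in its old order.
rotates-row : ∀ {n} (q : Vec Entry n) r → rotates q (toList r) ≡ zipWith absorb q r
rotates-row q r = toList-inj (trans
  (proj₁ (queue-run q (toList r) (toList q) [] (sym (Listₚ.++-identityʳ _))
    (trans (Vecₚ.length-toList q) (sym (Vecₚ.length-toList r)))))
  (sym (toList-zipWith absorb q r)))

emits-row : ∀ {n} (q : Vec Entry n) r → emits q (toList r) ≡ toList (zipWith emit q r)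
emits-row q r = trans
  (proj₂ (queue-run q (toList r) (toList q) [] (sym (Listₚ.++-identityʳ _))
    (trans (Vecₚ.length-toList q) (sym (Vecₚ.length-toList r)))))
  (sym (toList-zipWith emit q r))

idle : ∀ n → Vec Entry n
idle n = Vec.replicate n (false , false)

rotate-idle : ∀ n x → rotate (idle n) x ≡ idle n
rotate-idle zero x = refl
rotate-idle (suc n) x = go n
  where
  go : ∀ n → idle n Vec.∷ʳ (false , false) ≡ (false , false) ∷ idle n
  go zero = refl
  go (suc n) = cong ((false , false) ∷_) (go n)

emit-idle : ∀ n x → emit (front (idle n)) x ≡ x
emit-idle zero x = refl
emit-idle (suc n) x = refl

-- Symbols of a finite alphabet as bit vectors, the default symbol being all false.
module Coding {A : Set} (F : Finite A) (dflt : A) where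
  private module F = Finite F
  open Rows dflt

  width : ℕ
  width = F.card

  private
    _xor_ : Bool → Bool → Bool
    true xor y = not y
    false xor y = y

    xor-self : ∀ x → x xor x ≡ false
    xor-self true = refl
    xor-self false = refl

    xor-cancel : ∀ {x y} z → x xor z ≡ y xor z → x ≡ y
    xor-cancel {true} {true} z _ = refl
    xor-cancel {false} {false} z _ = refl
    xor-cancel {true} {false} true ()
    xor-cancel {true} {false} false ()
    xor-cancel {false} {true} true ()
    xor-cancel {false} {true} false ()

    -- One-hot code, xored with that of `dflt`, so that `dflt` becomes the zero word and fresh blank
    -- cells can be taken for a row of defaults.
    bitOf : A → Fin width → Bool
    bitOf a v = does (v Fin.≟ F.to a) xor does (v Fin.≟ F.to dflt)

  enc : A → Vec Bool width
  enc a = Vec.tabulate (bitOf a)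

  enc-dflt : enc dflt ≡ Vec.replicate width false
  enc-dflt = lookup-ext λ v → trans (Vecₚ.lookup∘tabulate (bitOf dflt) v)
    (trans (xor-self (does (v Fin.≟ F.to dflt))) (sym (Vecₚ.lookup-replicate v false)))

  enc-injective : ∀ {x y} → enc x ≡ enc y → x ≡ y
  enc-injective {x} {y} eq = F.to-injective (does⇒ (F.to x Fin.≟ F.to y) same)
    where
    same : does (F.to x Fin.≟ F.to y) ≡ true
    same = trans (sym (xor-cancel (does (F.to x Fin.≟ F.to dflt))
      (trans (sym (Vecₚ.lookup∘tabulate (bitOf x) (F.to x)))
        (trans (cong (λ u → lookup u (F.to x)) eq) (Vecₚ.lookup∘tabulate (bitOf y) (F.to x))))))
      (dec-true (F.to x Fin.≟ F.to x) refl)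

  dec : Vec Bool width → A
  dec u with Finₚ.any? (λ i → Vecₚ.≡-dec Boolₚ._≟_ (enc (F.from i)) u)
  ... | yes (i , _) = F.from i
  ... | no _ = dflt

  dec-enc : ∀ a → dec (enc a) ≡ a
  dec-enc a with Finₚ.any? (λ i → Vecₚ.≡-dec Boolₚ._≟_ (enc (F.from i)) (enc a))
  ... | yes (i , e) = enc-injective e
  ... | no ne = contradiction (F.to a , cong enc (F.from-to a)) ne

  encRow : ∀ {n} → Row n → Vec Bool (n * width)
  encRow [] = []
  encRow (x ∷ r) = enc x Vec.++ encRow r

  decRow : ∀ n → Vec Bool (n * width) → Row n
  decRow zero _ = []
  decRow (suc n) u = dec (Vec.take width u) ∷ decRow n (Vec.drop width u)

  private
    take-++ : ∀ {X : Set} {m n} (u : Vec X m) (v : Vec X n) → Vec.take m (u Vec.++ v) ≡ u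
    take-++ [] v = refl
    take-++ (x ∷ u) v = cong (x ∷_) (take-++ u v)
    drop-++ : ∀ {X : Set} {m n} (u : Vec X m) (v : Vec X n) → Vec.drop m (u Vec.++ v) ≡ v
    drop-++ [] v = refl
    drop-++ (x ∷ u) v = drop-++ u v

  decRow-encRow : ∀ {n} (r : Row n) → decRow n (encRow r) ≡ r
  decRow-encRow [] = refl
  decRow-encRow (x ∷ r) = cong₂ _∷_
    (trans (cong dec (take-++ (enc x) (encRow r))) (dec-enc x))
    (trans (cong (decRow _) (drop-++ (enc x) (encRow r))) (decRow-encRow r))

  queue : ∀ {n} → Vec Bool n → Row n → Vec Entry (n * width)
  queue [] [] = []
  queue (m ∷ ms) (c ∷ cs) = Vec.map (m ,_) (enc c) Vec.++ queue ms cs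

  private
    ++-zipWith : ∀ {X Y Z : Set} (f : X → Y → Z) {m n} (u : Vec X m) (u′ : Vec X n) v v′ →
                 zipWith f (u Vec.++ u′) (v Vec.++ v′) ≡ zipWith f u v Vec.++ zipWith f u′ v′
    ++-zipWith f [] u′ [] v′ = refl
    ++-zipWith f (x ∷ u) u′ (y ∷ v) v′ = cong (f x y ∷_) (++-zipWith f u u′ v v′)

    emit-map : ∀ m {n} (u v : Vec Bool n) → zipWith emit (Vec.map (m ,_) u) v ≡ (if m then u else v)
    emit-map true [] [] = refl
    emit-map false [] [] = refl
    emit-map true (x ∷ u) (y ∷ v) = cong (x ∷_) (emit-map true u v)
    emit-map false (x ∷ u) (y ∷ v) = cong (y ∷_) (emit-map false u v)

    absorb-map : ∀ m {n} (u v : Vec Bool n) →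
                 zipWith absorb (Vec.map (m ,_) u) v ≡ Vec.map (m ,_) (if m then v else u)
    absorb-map true [] [] = refl
    absorb-map false [] [] = refl
    absorb-map true (x ∷ u) (y ∷ v) = cong ((true , y) ∷_) (absorb-map true u v)
    absorb-map false (x ∷ u) (y ∷ v) = cong ((false , x) ∷_) (absorb-map false u v)

    if-enc : ∀ m c x → (if m then enc c else enc x) ≡ enc (if m then c else x)
    if-enc true c x = refl
    if-enc false c x = refl

  -- All bits of a symbol share its mask, so the bitwise choice between carry and cell never splits
  -- a symbol.
  emit-queue : ∀ {n} (m : Vec Bool n) c r → zipWith emit (queue m c) (encRow r) ≡ encRow (sel m c r)
  emit-queue [] [] [] = refl
  emit-queue (m ∷ ms) (c ∷ cs) (x ∷ r) = trans (++-zipWith emit (Vec.map (m ,_) (enc c)) _ (enc x) _)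
    (cong₂ Vec._++_ (trans (emit-map m (enc c) (enc x)) (if-enc m c x)) (emit-queue ms cs r))

  absorb-queue : ∀ {n} (m : Vec Bool n) c r → zipWith absorb (queue m c) (encRow r) ≡ queue m (sel m r c)
  absorb-queue [] [] [] = refl
  absorb-queue (m ∷ ms) (c ∷ cs) (x ∷ r) = trans (++-zipWith absorb (Vec.map (m ,_) (enc c)) _ (enc x) _)
    (cong₂ Vec._++_ (trans (absorb-map m (enc c) (enc x)) (cong (Vec.map (m ,_)) (if-enc m x c))) (absorb-queue ms cs r))

  carried : ∀ {n} → Vec Entry (n * width) → Row n
  carried q = decRow _ (Vec.map proj₂ q)

  carried-queue : ∀ {n} (m : Vec Bool n) c → carried (queue m c) ≡ c
  carried-queue {n} m c = trans (cong (decRow n) (go m c)) (decRow-encRow c)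
    where
    snd-map : ∀ m {k} (u : Vec Bool k) → Vec.map proj₂ (Vec.map (m ,_) u) ≡ u
    snd-map m [] = refl
    snd-map m (x ∷ u) = cong (x ∷_) (snd-map m u)
    go : ∀ {n} (m : Vec Bool n) c → Vec.map proj₂ (queue m c) ≡ encRow c
    go [] [] = refl
    go (m ∷ ms) (c ∷ cs) = trans (Vecₚ.map-++ proj₂ (Vec.map (m ,_) (enc c)) (queue ms cs))
      (cong₂ Vec._++_ (snd-map m (enc c)) (go ms cs))

  encRow-blanks : ∀ n → encRow (blanks n) ≡ Vec.replicate (n * width) false
  encRow-blanks zero = refl
  encRow-blanks (suc n) = trans (cong₂ Vec._++_ enc-dflt (encRow-blanks n)) (go width)
    where
    go : ∀ k → Vec.replicate k false Vec.++ Vec.replicate (n * width) false ≡ Vec.replicate (k + n * width) false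
    go zero = refl
    go (suc k) = cong (false ∷_) (go k)

-- The core: a stack machine as a one-tape table

-- A nondeterministic machine whose whole memory is K stacks over a finite alphabet;
-- it sees all tops, chooses the next control state and acts on every stack.
record StackMachine : Set₁ where
  field
    {PC A} : Set
    finPC  : Finite PC
    finA   : Finite A
    dflt   : A
    K      : ℕ
    init   : PC
    next   : PC → Vec A K → PC → Bool
    ops    : PC → Vec A K → PC → Vec (Op A) K
    halts  : PC → Bool

module Core (SM : StackMachine) where
  open StackMachine SM public
  open Rows dflt public
  open Coding finA dflt public

  W : ℕ
  W = K * width

  -- The index in `right` counts the cells still missing from the row that is appended at the far
  -- end: blanks met before it is 0 belong to that row. The mask says which columns are popped on
  -- the way back.
  data CS : Set where
    right : Fin (suc W) → PC → Row K → Vec Bool K → Vec Entry W → CS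
    left  : PC → Row K → Vec Bool K → Vec Entry W → CS
    loop  : CS

  abstract
    finCS : Finite CS
    finCS = finRetract f g gf
        ((finFin (suc W) fin× finPC fin× finVec finA K fin× finVec finBool K fin× finVec (finBool fin× finBool) W)
         fin⊎ (finPC fin× finVec finA K fin× finVec finBool K fin× finVec (finBool fin× finBool) W) fin⊎ fin⊤)
      where
      L R : Set
      L = PC × Row K × Vec Bool K × Vec Entry W
      R = Fin (suc W) × L
      f : CS → R ⊎ L ⊎ ⊤
      f (right κ p t m q) = inj₁ (κ , p , t , m , q)
      f (left p t m q) = inj₂ (inj₁ (p , t , m , q))
      f loop = inj₂ (inj₂ tt)
      g : R ⊎ L ⊎ ⊤ → CS
      g (inj₁ (κ , p , t , m , q)) = right κ p t m q
      g (inj₂ (inj₁ (p , t , m , q))) = left p t m q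
      g (inj₂ (inj₂ _)) = loop
      gf : ∀ S → g (f S) ≡ S
      gf (right κ p t m q) = refl
      gf (left p t m q) = refl
      gf loop = refl

  -- The nondeterministic choice of a step is read off its target state.
  pcOf : CS → PC
  pcOf (right _ p _ _ _) = p
  pcOf (left p _ _ _) = p
  pcOf loop = init

  load : PC → Row K → PC → CS
  load p t p′ = right (Fin.fromℕ W) p′ (newTops os t) (popMask os) (queue (pushMask os) (carries os t))
    where os = ops p t p′

  -- On the way left the bits of a row arrive in reverse order, hence the reversed queue; where the
  -- mask pops, its carry is the new top.
  resolve : Row K → Vec Bool K → Vec Entry W → Row K
  resolve t m q = sel m (carried (Vec.reverse q)) t

  upQueue : Vec Bool K → Vec Entry W
  upQueue m = Vec.reverse (queue m (blanks K))

  -- With idle mask and queue a leftward walk copies what it reads, so the core may be entered at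
  -- the right end of its data; it arrives home with blank tops.
  entry : CS
  entry = left init (blanks K) (Vec.replicate K false) (idle W)

  -- nothing stands for a blank cell; the last argument is the chosen control state.
  cstep : CS → Maybe Bool → PC → CS × Maybe Bool × Bool
  cstep (right κ p t m q) (just x) _ = right κ p t m (rotate q x) , just (emit (front q) x) , true
  cstep (right 0F p t m q) nothing _ = left p t m (upQueue m) , nothing , false
  cstep (right (Fin.suc κ) p t m q) nothing _ =
    right (Fin.inject₁ κ) p t m (rotate q false) , just (emit (front q) false) , true
  cstep (left p t m q) (just x) _ = left p t m (rotate q x) , just (emit (front q) x) , false
  cstep (left p t m q) nothing p′ =
    (if halts p then loop else load p (resolve t m q) p′) , nothing , true
  cstep loop _ _ = loop , nothing , true

  -- A choice is made only on the blank to the left of the rows; all other steps are forced.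
  allowed : CS → Maybe Bool → PC → Bool
  allowed (left p t m q) nothing p′ = if halts p then true else next p (resolve t m q) p′
  allowed _ _ _ = true

  choice-allowed : ∀ {p t m q x p′ r} → x ≡ nothing → halts p ≡ false → resolve t m q ≡ r →
                   allowed (left p t m q) x p′ ≡ next p r p′
  choice-allowed refl nh refl rewrite nh = refl

  choice-step : ∀ {p t m q x p′ r} → x ≡ nothing → halts p ≡ false → resolve t m q ≡ r →
                cstep (left p t m q) x p′ ≡ (load p r p′ , nothing , true)
  choice-step refl nh refl rewrite nh = refl

  halt-allowed : ∀ {p t m q x p′} → x ≡ nothing → halts p ≡ true → allowed (left p t m q) x p′ ≡ true
  halt-allowed refl hp rewrite hp = refl

  halt-step : ∀ {p t m q x p′} → x ≡ nothing → halts p ≡ true → cstep (left p t m q) x p′ ≡ (loop , nothing , true)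
  halt-step refl hp rewrite hp = refl

module _ (a b : ℕ) where
  bitSymbol : Bool → Γsym a b
  bitSymbol x = inΓ b (if x then 1F else 0F)

  symbol : Maybe Bool → Γsym a b
  symbol nothing = blank a b
  symbol (just x) = bitSymbol x

  cellOf : Γsym a b → Maybe Bool
  cellOf y = if does (y Fin.≟ blank a b) then nothing else just (does (y Fin.≟ bitSymbol true))

  cellOf-blank : cellOf (blank a b) ≡ nothing
  cellOf-blank = cong (λ e → if e then nothing else just (does (blank a b Fin.≟ bitSymbol true)))
    (dec-true (blank a b Fin.≟ blank a b) refl)

  cellOf-bit : ∀ x → cellOf (bitSymbol x) ≡ just x
  cellOf-bit true = refl
  cellOf-bit false = refl

-- The machine may also reject at any time.
record Embedding (SM : StackMachine) {a b : ℕ} (M : NTM1 a b) : Set where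
  open Core SM
  field
    emb      : CS → Fin (NTM1.q M)
    emb≢acc  : ∀ S → emb S ≢ NTM1.acc M
    emb≢rej  : ∀ S → emb S ≢ NTM1.rej M
    core-fwd : ∀ S x S′ y e → allowed S (cellOf a b x) (pcOf S′) ≡ true →
      cstep S (cellOf a b x) (pcOf S′) ≡ (S′ , y , e) → NTM1.δ M (emb S) x (emb S′) (symbol a b y) e ≡ true
    core-bwd : ∀ S x p y e → NTM1.δ M (emb S) x p y e ≡ true → p ≡ NTM1.rej M ⊎
      (∃₂ λ S′ y′ → allowed S (cellOf a b x) (pcOf S′) ≡ true ×
         cstep S (cellOf a b x) (pcOf S′) ≡ (S′ , y′ , e) × p ≡ emb S′ × y ≡ symbol a b y′)

-- The round trip of the head

module Sim (SM : StackMachine) {a b : ℕ} (M : NTM1 a b) (E : Embedding SM M) where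
  open Embedding E
  open Core SM
  open Zip M
  private
    ⊔ = blank a b
    bit = bitSymbol a b
    cell-hd : ∀ J → hd J ≡ ⊔ → cellOf a b (hd J) ≡ nothing
    cell-hd J jh = trans (cong (cellOf a b) jh) (cellOf-blank a b)

  core-det : ∀ S {S′ y e d B F} → (∀ p → allowed S (cellOf a b (hd F)) p ≡ true) →
             (∀ p → cstep S (cellOf a b (hd F)) p ≡ (S′ , y , e)) →
             Det 1 (emb S , d , B , F) (emb S′ , go d e (symbol a b y) B F)
  core-det S {S′} {y} {e} {d} {B} {F} al st =
    det-step (symbol a b y) e (emb≢acc S) (emb≢rej S) (core-fwd S (hd F) S′ y e (al _) (st _)) uniq
    where
    uniq : ∀ p″ y′ e′ → NTM1.δ M (emb S) (hd F) p″ y′ e′ ≡ true →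
           p″ ≡ NTM1.rej M ⊎ (p″ ≡ emb S′ × y′ ≡ symbol a b y × e′ ≡ e)
    uniq p″ y′ e′ t with core-bwd S (hd F) p″ y′ e′ t
    ... | inj₁ r = inj₁ r
    ... | inj₂ (S″ , y″ , _ , c , refl , refl) with trans (sym c) (st (pcOf S″))
    ... | refl = inj₂ (refl , refl , refl)

  cells : List Bool → List Sym
  cells = map bit

  rowCells : Row K → List Sym
  rowCells r = cells (toList (encRow r))

  rowsCells : List (Row K) → List Sym
  rowsCells [] = []
  rowsCells (r ∷ rs) = rowCells r ++ rowsCells rs

  stackUp : List (Row K) → List Sym → List Sym
  stackUp [] B = B
  stackUp (r ∷ rs) B = stackUp rs (rowCells r ʳ++ B)

  private
    Inv : Set₁
    Inv = List Bool → Vec Entry W → List Sym → ZConf → Set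

    walk : (I : Inv) →
      (∀ {x xs q B c} → I (x ∷ xs) q B c →
         ∃ λ c′ → Det 1 c c′ × I xs (rotate q x) (bit (emit (front q) x) ∷ B) c′) →
      ∀ xs {q B c} → I xs q B c →
      ∃ λ c′ → Det (length xs) c c′ × I [] (rotates q xs) (cells (emits q xs) ʳ++ B) c′
    walk I st [] i = _ , det-refl , i
    walk I st (x ∷ xs) i with st i
    ... | c₁ , D₁ , i₁ with walk I st xs i₁
    ... | c₂ , D₂ , i₂ = c₂ , det-trans D₁ D₂ , i₂

    right-bits : ∀ κ p t m xs {q B F} →
      Det (length xs) (emb (right κ p t m q) , true , B , cells xs ++ F)
          (emb (right κ p t m (rotates q xs)) , true , cells (emits q xs) ʳ++ B , F)
    right-bits κ p t m xs {q} {B} {F} with walk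
        (λ xs q B c → c ≡ (emb (right κ p t m q) , true , B , cells xs ++ F))
        (λ { {x} refl → _ , core-det (right κ p t m _) (λ _ → refl) (λ _ → st x) , refl }) xs {q} {B} refl
      where
      st : ∀ x {q p′} → cstep (right κ p t m q) (cellOf a b (bit x)) p′ ≡
                  (right κ p t m (rotate q x) , just (emit (front q) x) , true)
      st x rewrite cellOf-bit a b x = refl
    ... | c′ , D , refl = D

    left-bits : ∀ p t m xs {q B F} →
      Det (length xs) (emb (left p t m q) , false , B , cells xs ++ F)
          (emb (left p t m (rotates q xs)) , false , cells (emits q xs) ʳ++ B , F)
    left-bits p t m xs {q} {B} {F} with walk
        (λ xs q B c → c ≡ (emb (left p t m q) , false , B , cells xs ++ F))
        (λ { {x} refl → _ , core-det (left p t m _) (λ _ → al x) (λ _ → st x) , refl }) xs {q} {B} refl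
      where
      al : ∀ x {q p′} → allowed (left p t m q) (cellOf a b (bit x)) p′ ≡ true
      al x rewrite cellOf-bit a b x = refl
      st : ∀ x {q p′} → cstep (left p t m q) (cellOf a b (bit x)) p′ ≡
                  (left p t m (rotate q x) , just (emit (front q) x) , false)
      st x rewrite cellOf-bit a b x = refl
    ... | c′ , D , refl = D

    -- Blank cells beyond the rows are read as 0, which codes the default symbol, so the new row is
    -- formed by the same queue as the old ones.
    extend-bits : ∀ p t m k {κ q B F} → toℕ κ ≡ k → Blank F →
      ∃ λ F′ → Blank F′ ×
      Det k (emb (right κ p t m q) , true , B , F)
            (emb (right 0F p t m (rotates q (replicate k false))) , true ,
             cells (emits q (replicate k false)) ʳ++ B , F′)
    extend-bits p t m zero {0F} {F = F} _ bl = F , bl , det-refl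
    extend-bits p t m (suc k) {Fin.suc κ} {q} {B} {F} eq bl
      with extend-bits p t m k {Fin.inject₁ κ} {rotate q false} {bit (emit (front q) false) ∷ B} {tl F}
             (trans (Finₚ.toℕ-inject₁ κ) (suc-injective eq)) (blank-tl {F} bl)
    ... | F′ , bl′ , D = F′ , bl′ , det-trans (core-det (right (Fin.suc κ) p t m q) (λ _ → refl)
            (λ p′ → trans (cong (λ x → cstep (right (Fin.suc κ) p t m q) x p′)
                      (cell-hd F (blank-hd {F} bl))) refl)) D

    length-row : ∀ {n} (u : Vec Bool n) → length (toList u) ≡ n
    length-row = Vecₚ.length-toList

    right-row : ∀ κ p t m mask c r {B F} →
      Det W (emb (right κ p t m (queue mask c)) , true , B , rowCells r ++ F)
            (emb (right κ p t m (queue mask (sel mask r c))) , true , rowCells (sel mask c r) ʳ++ B , F)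
    right-row κ p t m mask c r
      with right-bits κ p t m (toList (encRow r)) {queue mask c}
    ... | D rewrite rotates-row (queue mask c) (encRow r) | emits-row (queue mask c) (encRow r)
              | absorb-queue mask c r | emit-queue mask c r = det-cast (length-row (encRow r)) D

    right-rows : ∀ κ p t m mask c rs {B F} →
      Det (length rs * W) (emb (right κ p t m (queue mask c)) , true , B , rowsCells rs ++ F)
        (emb (right κ p t m (queue mask (lastCarry mask c rs))) , true , stackUp (shiftDown mask c rs) B , F)
    right-rows κ p t m mask c [] = det-refl
    right-rows κ p t m mask c (r ∷ rs) {B} {F}
      rewrite Listₚ.++-assoc (rowCells r) (rowsCells rs) F =
      det-trans (right-row κ p t m mask c r) (right-rows κ p t m mask (sel mask r c) rs)

    toList-falses : ∀ n → toList (Vec.replicate n false) ≡ replicate n false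
    toList-falses zero = refl
    toList-falses (suc n) = cong (false ∷_) (toList-falses n)

    extend-row : ∀ p t m mask c {B F} → Blank F →
      ∃ λ F′ → Blank F′ ×
      Det W (emb (right (Fin.fromℕ W) p t m (queue mask c)) , true , B , F)
            (emb (right 0F p t m (queue mask (sel mask (blanks K) c))) , true ,
             rowCells (sel mask c (blanks K)) ʳ++ B , F′)
    extend-row p t m mask c {B} {F} bl
      with extend-bits p t m W {Fin.fromℕ W} {queue mask c} {B} {F} (Finₚ.toℕ-fromℕ W) bl
    ... | F′ , bl′ , D = F′ , bl′ , det-to (cong₂ (λ q o → emb (right 0F p t m q) , true , cells o ʳ++ B , F′) eq₁ eq₂) D
      where
      e₀ : replicate W false ≡ toList (encRow (blanks K))
      e₀ = trans (sym (toList-falses W)) (cong toList (sym (encRow-blanks K)))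
      eq₁ : rotates (queue mask c) (replicate W false) ≡ queue mask (sel mask (blanks K) c)
      eq₁ = trans (cong (rotates (queue mask c)) e₀) (trans (rotates-row _ _) (absorb-queue mask c _))
      eq₂ : emits (queue mask c) (replicate W false) ≡ toList (encRow (sel mask c (blanks K)))
      eq₂ = trans (cong (emits (queue mask c)) e₀) (trans (emits-row _ _) (cong toList (emit-queue mask c _)))

    reverse-cells : ∀ {n} (u : Vec Bool n) F → cells (toList (Vec.reverse u)) ++ F ≡ cells (toList u) ʳ++ F
    reverse-cells u F = trans (cong (_++ F) (trans (cong cells (Vecₚ.toList-reverse u)) (Listₚ.reverse-map bit (toList u))))
      (sym (Listₚ.ʳ++-defn (cells (toList u))))

    cells-reverse : ∀ {n} (u : Vec Bool n) B → cells (toList (Vec.reverse u)) ʳ++ B ≡ cells (toList u) ++ B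
    cells-reverse u B = trans (sym (reverse-cells (Vec.reverse u) B)) (cong (λ v → cells (toList v) ++ B) (Vecₚ.reverse-involutive u))

    -- A leftward head meets a row reversed. Queue and row are reversed together, and `zipWith`
    -- commutes with reversal.
    left-row : ∀ p t m c r {B F} →
      Det W (emb (left p t m (Vec.reverse (queue m c))) , false , B , rowCells r ʳ++ F)
            (emb (left p t m (Vec.reverse (queue m (sel m r c)))) , false , rowCells (sel m c r) ++ B , F)
    left-row p t m c r {B} {F}
      with left-bits p t m (toList (Vec.reverse (encRow r))) {Vec.reverse (queue m c)} {B} {F}
    ... | D rewrite rotates-row (Vec.reverse (queue m c)) (Vec.reverse (encRow r))
                  | emits-row (Vec.reverse (queue m c)) (Vec.reverse (encRow r))
                  | zipWith-reverse absorb (queue m c) (encRow r) | zipWith-reverse emit (queue m c) (encRow r)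
                  | absorb-queue m c r | emit-queue m c r
                  | reverse-cells (encRow r) F | cells-reverse (encRow (sel m c r)) B
                  = det-cast (length-row (Vec.reverse (encRow r))) D

    left-rows : ∀ p t m rs {B F} →
      Det (length rs * W) (emb (left p t m (upQueue m)) , false , B , stackUp rs F)
        (emb (left p t m (Vec.reverse (queue m (proj₁ (up m rs))))) , false , rowsCells (proj₂ (up m rs)) ++ B , F)
    left-rows p t m [] = det-refl
    left-rows p t m (r ∷ rs) {B} {F} = det-cast (+-comm (length rs * W) W)
      (det-to (cong (λ B′ → _ , false , B′ , F) (sym (Listₚ.++-assoc (rowCells (sel m (proj₁ (up m rs)) r)) (rowsCells (proj₂ (up m rs))) B)))
        (det-trans (left-rows p t m rs) (left-row p t m (proj₁ (up m rs)) r)))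

    stackUp-++ : ∀ rs rs′ B → stackUp (rs ++ rs′) B ≡ stackUp rs′ (stackUp rs B)
    stackUp-++ [] rs′ B = refl
    stackUp-++ (r ∷ rs) rs′ B = stackUp-++ rs rs′ (rowCells r ʳ++ B)

  -- The head is on the blank just left of h rows of the stacks st.
  record Home (h : ℕ) (p : PC) (st : Vec (List A) K) (c : ZConf) : Set where
    constructor at-home
    field
      {t} : Row K
      {m} : Vec Bool K
      {q} : Vec Entry W
      {rs} : List (Row K)
      {F J} : List Sym
      shape : c ≡ (emb (left p t m q) , false , rowsCells rs ++ F , J)
      J-hd : hd J ≡ ⊔
      F-blank : Blank F
      stores : Stores (resolve t m q) rs st
      height : length rs ≡ h

  tops : Vec (List A) K → Row K
  tops = Vec.map (HalfTape.hd dflt)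

  -- Right over h rows, W cells of the new row, one step to turn, left over h + 1 rows. The step off
  -- the home blank, where the choice is made, is counted apart.
  tripTail : ℕ → ℕ
  tripTail h = (h * W + (W + 1)) + suc h * W

  private
    tail-trip : ∀ {h} p {t rs st J F} (os : Vec (Op A) K) → Stores t rs st → length rs ≡ h → Blank F →
      ∃ λ c′ → Det (tripTail h)
        (emb (right (Fin.fromℕ W) p (newTops os t) (popMask os) (queue (pushMask os) (carries os t))) , true , ⊔ ∷ J , rowsCells rs ++ F) c′ ×
        Home (suc h) p (applies os st) c′
    tail-trip {h} p {t} {rs} {st} {J} {F} os S refl bl
      with extend-row p (newTops os t) (popMask os) (pushMask os) (lastCarry (pushMask os) (carries os t) rs)
             {stackUp (shiftDown (pushMask os) (carries os t) rs) (⊔ ∷ J)} {F} bl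
    ... | F′ , bl′ , D₂ = _ , det-trans (det-trans D₁ (det-trans D₂ D₃)) (det-cast (cong (_* W) len) D₄) , home
      where
      pm = pushMask os
      om = popMask os
      nt = newTops os t
      ct = carries os t
      D₁ = right-rows (Fin.fromℕ W) p nt om pm ct rs {⊔ ∷ J} {F}
      rows = down pm ct rs
      len = length-down pm ct rs
      D₃ : Det 1 _ (emb (left p nt om (upQueue om)) , false , ⊔ ∷ tl F′ , stackUp rows (⊔ ∷ J))
      D₃ = det-to (cong (λ B → emb (left p nt om (upQueue om)) , false , ⊔ ∷ tl F′ , B)
             (sym (stackUp-++ (shiftDown pm ct rs) _ (⊔ ∷ J))))
             (core-det (right 0F p nt om _) {d = true} {F = F′} (λ _ → refl)
               (λ p′ → cong (λ x → cstep (right 0F p nt om _) x p′) (cell-hd F′ (blank-hd {F′} bl′))))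
      D₄ = left-rows p nt om rows {⊔ ∷ tl F′} {⊔ ∷ J}
      home : Home (suc h) p (applies os st) _
      home = record
        { shape = refl ; J-hd = refl ; F-blank = blank-∷ (blank-tl {F′} bl′)
        ; stores = subst (λ t′ → Stores t′ (proj₂ (up om rows)) (applies os st))
            (sym (cong (λ c → sel om c nt) (trans (cong carried (Vecₚ.reverse-involutive (queue om (proj₁ (up om rows)))))
               (carried-queue om (proj₁ (up om rows))))))
            (roundTrip-stores os {t} {rs} {st} S)
        ; height = trans (length-up om rows) len }

    stores-tops : ∀ {t rs st} → Stores t rs st → t ≡ tops st
    stores-tops {t} {rs} {st} S = lookup-ext λ j →
      trans (S j 0) (trans (HalfTape.at-0 dflt (lookup st j)) (sym (Vecₚ.lookup-map j (HalfTape.hd dflt) st)))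

  home-fwd : ∀ {h p st c p′} → Home h p st c → halts p ≡ false → next p (tops st) p′ ≡ true →
             ∃ λ c′ → ZSteps (suc (tripTail h)) c c′ × Home (suc h) p′ (applies (ops p (tops st) p′) st) c′
  home-fwd {h} {p} {st} {c} {p′} (at-home {t} {m} {q} {rs} {F} {J} refl jh bl S he) nh nx with resolve t m q in eq
  ... | r with stores-tops {r} {rs} {st} S
  ... | refl with tail-trip p′ {tops st} {rs} {st} {tl J} {F} (ops p (tops st) p′) S he bl
  ... | c′ , D , H′ = c′ , zstep ⊔ true (emb≢acc _) (emb≢rej _)
          (core-fwd (left p t m q) (hd J) (load p (tops st) p′) nothing true
            (trans (choice-allowed {p} {t} {m} {q} (cell-hd J jh) nh eq) nx)
            (choice-step {p} {t} {m} {q} (cell-hd J jh) nh eq)) ∷ run D , H′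

  -- A computation that outlasts the trip has not rejected, so its first step reveals a choice
  -- allowed by `next`, and the rest of the trip is forced.
  home-bwd : ∀ {h p st c j c″} → Home h p st c → halts p ≡ false → ZSteps (suc (tripTail h) + suc j) c c″ →
             ∃₂ λ p′ c′ → next p (tops st) p′ ≡ true × Home (suc h) p′ (applies (ops p (tops st) p′) st) c′ × ZSteps (suc j) c′ c″
  home-bwd {h} {p} {st} {c} {j} {c″} (at-home {t} {m} {q} {rs} {F} {J} refl jh bl S he) nh (zstep {p′ = pm} y e _ _ t₀ ∷ ss)
    with resolve t m q in eq
  ... | r with stores-tops {r} {rs} {st} S
  ... | refl with core-bwd (left p t m q) (hd J) pm y e t₀
  ... | inj₁ rj = ⊥-elim (stuck-+ (tripTail h) rj ss)
  ... | inj₂ (S′ , y′ , al , cs , refl , refl) with trans (sym cs) (choice-step {p} {t} {m} {q} (cell-hd J jh) nh eq)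
  ... | e₁ with tail-trip (pcOf S′) {tops st} {rs} {st} {tl J} {F} (ops p (tops st) (pcOf S′)) S he bl
  ... | c′ , D , H′ = pcOf S′ , c′ , trans (sym (choice-allowed {p} {t} {m} {q} (cell-hd J jh) nh eq)) al , H′ ,
          follow D (start-from (cong proj₁ e₁) (cong (proj₁ ∘ proj₂) e₁) (cong (proj₂ ∘ proj₂) e₁) ss)
    where
    start-from : ∀ {k c S S₁ y e B F} → S ≡ S₁ → y ≡ nothing → e ≡ true →
      ZSteps k (emb S , go false e (symbol a b y) B F) c → ZSteps k (emb S₁ , go false true ⊔ B F) c
    start-from refl refl refl ss = ss

  loops : ∀ k {z} → ∃ (ZSteps k (emb loop , z))
  loops zero = _ , []
  loops (suc k) {d , B , F} with loops k {go d true ⊔ B F}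
  ... | _ , ss = _ , zstep ⊔ true (emb≢acc _) (emb≢rej _) (core-fwd loop (hd F) loop nothing true refl refl) ∷ ss

  -- Acceptance by the simulated machine has to break every time bound of the simulating one;
  -- halting states therefore lead into `loop`.
  home-halt : ∀ {h p st c} k → Home h p st c → halts p ≡ true → ∃ (ZSteps k c)
  home-halt zero H hp = _ , []
  home-halt (suc k) (at-home {t} {m} {q} {rs} {F} {J} refl jh bl S he) hp with loops k {go false true ⊔ (rowsCells rs ++ F) J}
  ... | _ , ss = _ , zstep ⊔ true (emb≢acc _) (emb≢rej _)
          (core-fwd (left _ t m q) (hd J) loop nothing true
            (halt-allowed {t = t} {m} {q} (cell-hd J jh) hp) (halt-step {t = t} {m} {q} (cell-hd J jh) hp)) ∷ ss

  entry-walk : ∀ xs {B F} → Det (length xs) (emb entry , false , B , cells xs ++ F) (emb entry , false , cells xs ʳ++ B , F)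
  entry-walk xs {B} {F} = subst₂ (λ q o → Det (length xs) (emb entry , false , B , cells xs ++ F)
      (emb (left init (blanks K) (Vec.replicate K false) q) , false , cells o ʳ++ B , F)) (eq₁ xs) (eq₂ xs)
      (left-bits init (blanks K) (Vec.replicate K false) xs)
    where
    eq₁ : ∀ xs → rotates (idle W) xs ≡ idle W
    eq₁ [] = refl
    eq₁ (x ∷ xs) rewrite rotate-idle W x = eq₁ xs
    eq₂ : ∀ xs → emits (idle W) xs ≡ xs
    eq₂ [] = refl
    eq₂ (x ∷ xs) rewrite rotate-idle W x = cong₂ _∷_ (emit-idle W x) (eq₂ xs)

  resolve-entry : ∀ q → resolve (blanks K) (Vec.replicate K false) q ≡ blanks K
  resolve-entry q = copies K _
    where
    copies : ∀ n (c : Row n) → sel (Vec.replicate n false) c (blanks n) ≡ blanks n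
    copies zero [] = refl
    copies (suc n) (x ∷ c) = cong (dflt ∷_) (copies n c)

-- The printing program

Item : Set
Item = Vec Bool 5

-- Four flags through which transitions depend on an item number, and one bit of the table of the
-- core.
isCoreItem streamBit isFirst isLast isEntry : Item → Bool
isCoreItem (x ∷ _) = x
streamBit (_ ∷ x ∷ _) = x
isFirst (_ ∷ _ ∷ x ∷ _) = x
isLast (_ ∷ _ ∷ _ ∷ x ∷ _) = x
isEntry (_ ∷ _ ∷ _ ∷ _ ∷ x ∷ _) = x

-- `stream` prints the next bit of the table of the core, which the script cannot contain because
-- the core is built from the script.
data Tok : Set where
  lit    : Bool → Tok
  stream : Tok

finTok : Finite Tok
finTok = finRetract f g gf (finBool fin⊎ fin⊤)
  where
  f : Tok → Bool ⊎ ⊤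
  f (lit b) = inj₁ b
  f stream = inj₂ tt
  g : Bool ⊎ ⊤ → Tok
  g (inj₁ b) = lit b
  g (inj₂ _) = stream
  gf : ∀ t → g (f t) ≡ t
  gf (lit b) = refl
  gf stream = refl

module Alphabet (N : MNTM) where
  open MNTM N using (k; m)

  TapeSym : Set
  TapeSym = Fin (3 + m)

  blankN : TapeSym
  blankN = 2F

  A : Set
  A = Item ⊎ TapeSym

  abstract
    finA : Finite A
    finA = finVec finBool 5 fin⊎ finFin (3 + m)

  dflt : A
  dflt = inj₂ blankN

  -- The stacks: outer loop, inner loop (rest, done), marker (rest, done), stream,
  -- and then the two halves of every tape of N.
  K : ℕ
  K = 8 + k * 2

-- A word is described by a loop over a list of items, a loop over kinds and again a loop over
-- the items; the tokens of a round may depend on both items, on whether they coincide, and on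
-- whether the outer item is the predecessor of the inner one.
record Script : Set₁ where
  field
    {Kind}  : Set
    finKind : Finite Kind
    kind₀   : Kind
    kinds   : List Kind
    toks    : Kind → Item → Item → Bool → Bool → List Tok
    maxToks : ℕ
    toks-≤  : ∀ k oi ii eq sc → length (toks k oi ii eq sc) ≤ maxToks

module Program (N : MNTM) (script : Script) where
  open Script script
  open Alphabet N public
  open MNTM N using (k; r; m) renaming (start to startN; acc to accN; rej to rejN; δ to δN)
  open HalfTape dflt public

  data PC : Set where
    begin   : PC
    outer   : PC
    inner   : BList Kind (length kinds) → Kind → Item → Bool → PC
    print   : BList Tok maxToks → BList Kind (length kinds) → Kind → Item → Bool → PC
    restore : BList Kind (length kinds) → Item → PC
    rewind  : PC
    -- The written symbols and the moves are kept in the state, so that the transition chosen by `N`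
    -- is visible in the target state.
    run     : Fin r → Vec TapeSym (suc k) → Vec (Fin 3) (suc k) → PC

  codePC : Finite PC
  codePC = finRetract f g gf (finFin 3 fin⊎ (Ks fin× finKind fin× fI fin× finBool) fin⊎
            (finBList finTok maxToks fin× Ks fin× finKind fin× fI fin× finBool) fin⊎
            (Ks fin× fI) fin⊎ (finFin r fin× finVec (finFin (3 + m)) (suc k) fin× finVec (finFin 3) (suc k)))
    where
    Ks = finBList finKind (length kinds)
    fI = finVec finBool 5
    KL : Set
    KL = BList Kind (length kinds)
    Sum : Set
    Sum = Fin 3 ⊎ (KL × Kind × Item × Bool) ⊎ (BList Tok maxToks × KL × Kind × Item × Bool) ⊎
          (KL × Item) ⊎ (Fin r × Vec TapeSym (suc k) × Vec (Fin 3) (suc k))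
    f : PC → Sum
    f begin = inj₁ 0F
    f outer = inj₁ 1F
    f rewind = inj₁ 2F
    f (inner ks x i s) = inj₂ (inj₁ (ks , x , i , s))
    f (print ts ks x i s) = inj₂ (inj₂ (inj₁ (ts , ks , x , i , s)))
    f (restore ks i) = inj₂ (inj₂ (inj₂ (inj₁ (ks , i))))
    f (run p ys ds) = inj₂ (inj₂ (inj₂ (inj₂ (p , ys , ds))))
    g : Sum → PC
    g (inj₁ 0F) = begin
    g (inj₁ 1F) = outer
    g (inj₁ 2F) = rewind
    g (inj₂ (inj₁ (ks , x , i , s))) = inner ks x i s
    g (inj₂ (inj₂ (inj₁ (ts , ks , x , i , s)))) = print ts ks x i s
    g (inj₂ (inj₂ (inj₂ (inj₁ (ks , i))))) = restore ks i
    g (inj₂ (inj₂ (inj₂ (inj₂ (p , ys , ds))))) = run p ys ds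
    gf : ∀ x → g (f x) ≡ x
    gf begin = refl
    gf outer = refl
    gf rewind = refl
    gf (inner ks x i s) = refl
    gf (print ts ks x i s) = refl
    gf (restore ks i) = refl
    gf (run p ys ds) = refl

  abstract
    finPC : Finite PC
    finPC = codePC

  bitA : Bool → A
  bitA x = inj₂ (bitSym N x)

  zeroItem : A
  zeroItem = inj₁ (Vec.replicate 5 false)

  marked bitOf : A → Bool
  marked (inj₁ i) = isFirst i
  marked (inj₂ _) = false
  bitOf (inj₁ i) = streamBit i
  bitOf (inj₂ _) = false

  Ops₈ : Set
  Ops₈ = Vec (Op A) 8

  -- The marker stack starts as the item list, whose first entry alone is marked. One zero pushed
  -- per outer round keeps the mark opposite the current outer item, so comparing two item numbers
  -- amounts to reading a flag.
  still advanceOps : Ops₈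
  still = Vec.replicate 8 keep
  advanceOps = keep ∷ keep ∷ keep ∷ pushes zeroItem ∷ Vec.replicate 4 keep

  -- Stacks 6 and 7 are already the halves of the first tape of `N`: output is pushed to the left of
  -- its head, and `rewind` brings it to the right.
  emitOps : Bool → Ops₈
  emitOps x = keep ∷ keep ∷ keep ∷ keep ∷ keep ∷ keep ∷ pushes (bitA x) ∷ keep ∷ []

  feedOps rewindOps : A → Ops₈
  feedOps s = keep ∷ keep ∷ keep ∷ keep ∷ keep ∷ pops ∷ pushes (bitA (bitOf s)) ∷ keep ∷ []
  rewindOps l = keep ∷ keep ∷ keep ∷ keep ∷ keep ∷ keep ∷ pops ∷ pushes l ∷ []

  firstPC : Item → PC
  firstPC oi = inner (bound (length kinds) kinds) kind₀ oi false

  runPC : PC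
  runPC = run startN (Vec.replicate (suc k) 0F) (Vec.replicate (suc k) 0F)

  gstep : PC → Vec A 8 → Maybe (PC × Ops₈)
  gstep begin _ = just (outer , Vec.replicate 8 pops)
  gstep outer (inj₁ oi ∷ _) = just (firstPC oi , pops ∷ Vec.replicate 7 keep)
  gstep outer (inj₂ _ ∷ _) = just (rewind , still)
  gstep (inner ks κ oi sc) (_ ∷ inj₁ ii ∷ _ ∷ x ∷ _) =
    -- The mark is remembered for the next inner item, where it says that the outer item is the
    -- predecessor.
    just (print (bound maxToks (toks κ oi ii (marked x) sc)) ks κ oi (marked x) ,
          keep ∷ pops ∷ pushes (inj₁ ii) ∷ pops ∷ pushes x ∷ Vec.replicate 3 keep)
  gstep (inner ks κ oi sc) (_ ∷ inj₂ _ ∷ _) = just (restore ks oi , still)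
  gstep (print ts ks κ oi eq) (_ ∷ _ ∷ _ ∷ _ ∷ _ ∷ s ∷ _) with pop ts
  ... | nothing = just (inner ks κ oi eq , still)
  ... | just (lit x , ts′) = just (print ts′ ks κ oi eq ,
          emitOps x)
  ... | just (stream , ts′) = just (print ts′ ks κ oi eq ,
          feedOps s)
  gstep (restore ks oi) (_ ∷ _ ∷ inj₁ i ∷ _ ∷ y ∷ _) =
    just (restore ks oi , keep ∷ pushes (inj₁ i) ∷ pops ∷ pushes y ∷ pops ∷ Vec.replicate 3 keep)
  gstep (restore ks oi) (_ ∷ _ ∷ inj₂ _ ∷ _) with pop ks
  ... | nothing = just (outer , advanceOps)
  ... | just (κ , ks′) = just (inner ks′ κ oi false , still)
  gstep rewind (_ ∷ _ ∷ _ ∷ _ ∷ _ ∷ _ ∷ l ∷ _) with Finite._≟ᶠ_ finA l dflt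
  -- The output consists of bits, so a blank on top means that all of it has been moved.
  ... | yes _ = just (runPC , still)
  ... | no _ = just (rewind , rewindOps l)
  gstep (run _ _ _) _ = nothing

  Stacks₈ : Set
  Stacks₈ = Vec (List A) 8

  hds : ∀ {n} → Vec (List A) n → Vec A n
  hds = Vec.map hd

  data DSteps : ℕ → PC → Stacks₈ → PC → Stacks₈ → Set where
    []  : ∀ {p v} → DSteps 0 p v p v
    _∷_ : ∀ {n p v p′ os p″ v″} → gstep p (hds v) ≡ just (p′ , os) →
          DSteps n p′ (zipWith apply os v) p″ v″ → DSteps (suc n) p v p″ v″

  _+D+_ : ∀ {i j p v p′ v′ p″ v″} → DSteps i p v p′ v′ → DSteps j p′ v′ p″ v″ → DSteps (i + j) p v p″ v″
  [] +D+ E = E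
  (e ∷ D) +D+ E = e ∷ (D +D+ E)

  DWithin : ℕ → PC → Stacks₈ → PC → Stacks₈ → Set
  DWithin t p v p′ v′ = ∃ λ n → n ≤ t × DSteps n p v p′ v′

  within-trans : ∀ {i j p v p′ v′ p″ v″} → DWithin i p v p′ v′ → DWithin j p′ v′ p″ v″ → DWithin (i + j) p v p″ v″
  within-trans (m , m≤ , D) (n , n≤ , E) = m + n , +-mono-≤ m≤ n≤ , D +D+ E

  within-cast : ∀ {i j p v p′ v′} → i ≡ j → DWithin i p v p′ v′ → DWithin j p v p′ v′
  within-cast refl D = D

  one : ∀ {p v p′ os} → gstep p (hds v) ≡ just (p′ , os) → DWithin 1 p v p′ (zipWith apply os v)
  one e = 1 , ≤-refl , e ∷ []

  data Fits : List Tok → List A → List Bool → List A → Set where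
    []     : ∀ {S} → Fits [] S [] S
    lit    : ∀ {ts S bs S′} b → Fits ts S bs S′ → Fits (lit b ∷ ts) S (b ∷ bs) S′
    stream : ∀ {ts S bs S′} s → Fits ts S bs S′ → Fits (stream ∷ ts) (s ∷ S) (bitOf s ∷ bs) S′

  fits-++ : ∀ {ts us S bs S′ cs S″} → Fits ts S bs S′ → Fits us S′ cs S″ → Fits (ts ++ us) S (bs ++ cs) S″
  fits-++ [] G = G
  fits-++ (lit b F) G = lit b (fits-++ F G)
  fits-++ (stream s F) G = stream s (fits-++ F G)

  fits-split : ∀ ts {us S bs S″} → Fits (ts ++ us) S bs S″ →
               ∃₂ λ bs₁ bs₂ → ∃ λ S′ → bs ≡ bs₁ ++ bs₂ × Fits ts S bs₁ S′ × Fits us S′ bs₂ S″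
  fits-split [] F = [] , _ , _ , refl , [] , F
  fits-split (.(lit b) ∷ ts) (lit b F) with fits-split ts F
  ... | _ , _ , _ , refl , F₁ , F₂ = _ , _ , _ , refl , lit b F₁ , F₂
  fits-split (.stream ∷ ts) (stream s F) with fits-split ts F
  ... | _ , _ , _ , refl , F₁ , F₂ = _ , _ , _ , refl , stream s F₁ , F₂

  fits-length : ∀ {ts S bs S′} → Fits ts S bs S′ → length bs ≡ length ts
  fits-length [] = refl
  fits-length (lit b F) = cong suc (fits-length F)
  fits-length (stream s F) = cong suc (fits-length F)

  out : List Bool → List A → List A
  out bs l = map bitA bs ʳ++ l

  items : List Item → List A
  items = map inj₁

  innerToks : Kind → Item → Bool → List Item → List A → List Tok
  innerToks κ oi sc (ii ∷ is) (x ∷ xs) = toks κ oi ii (marked x) sc ++ innerToks κ oi (marked x) is xs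
  innerToks _ _ _ _ _ = []

  kindToks : List Kind → Item → List Item → List A → List Tok
  kindToks [] oi is xs = []
  kindToks (κ ∷ κs) oi is xs = innerToks κ oi false is xs ++ kindToks κs oi is xs

  outerToks : List Item → List Item → List A → List Tok
  outerToks [] is X = []
  outerToks (oi ∷ os) is X =
    -- The marker outgrows the item list; only its first `length is` cells are paired with items.
    kindToks (kind₀ ∷ kinds) oi is (List.take (length is) X) ++ outerToks os is (zeroItem ∷ X)

  print-loop : ∀ {O I J X Y S S′ L R tl bs} ts ks κ oi eq → unbound ts ≡ tl → Fits tl S bs S′ →
    DWithin (suc (length tl)) (print ts ks κ oi eq) (O ∷ I ∷ J ∷ X ∷ Y ∷ S ∷ L ∷ R ∷ [])
            (inner ks κ oi eq) (O ∷ I ∷ J ∷ X ∷ Y ∷ S′ ∷ out bs L ∷ R ∷ [])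
  print-loop {O} {I} {J} {X} {Y} {S} {_} {L} {R} ts ks κ oi eq u [] =
    one {os = still} (fires (pop-[] ts u))
    where
    fires : pop ts ≡ nothing → gstep (print ts ks κ oi eq) (hds (O ∷ I ∷ J ∷ X ∷ Y ∷ S ∷ L ∷ R ∷ [])) ≡ just (inner ks κ oi eq , still)
    fires e rewrite e = refl
  print-loop {O} {I} {J} {X} {Y} {S} {_} {L} {R} ts ks κ oi eq u (lit b F) with pop-∷ ts u
  ... | ts′ , e , u′ = within-trans (one {os = emitOps b} fires) (print-loop ts′ ks κ oi eq u′ F)
    where
    fires : gstep (print ts ks κ oi eq) (hds (O ∷ I ∷ J ∷ X ∷ Y ∷ S ∷ L ∷ R ∷ [])) ≡
           just (print ts′ ks κ oi eq , emitOps b)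
    fires rewrite e = refl
  print-loop {O} {I} {J} {X} {Y} {s ∷ S} {_} {L} {R} ts ks κ oi eq u (stream s F) with pop-∷ ts u
  ... | ts′ , e , u′ = within-trans (one {os = feedOps s} fires) (print-loop ts′ ks κ oi eq u′ F)
    where
    fires : gstep (print ts ks κ oi eq) (hds (O ∷ I ∷ J ∷ X ∷ Y ∷ (s ∷ S) ∷ L ∷ R ∷ [])) ≡
           just (print ts′ ks κ oi eq , feedOps s)
    fires rewrite e = refl

  out-++ : ∀ bs cs l → out (bs ++ cs) l ≡ out cs (out bs l)
  out-++ bs cs l = trans (cong (_ʳ++ l) (Listₚ.map-++ bitA bs cs)) (Listₚ.++-ʳ++ (map bitA bs))

  -- One step to fetch an inner item, at most `maxToks` to print, one to leave the printing state.
  unit : ℕ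
  unit = suc (suc maxToks)

  inner-loop : ∀ {O J X Y S S′ L R bs} ks κ oi sc is xs → length xs ≡ length is →
    Fits (innerToks κ oi sc is xs) S bs S′ →
    DWithin (length is * unit + 1) (inner ks κ oi sc) (O ∷ items is ∷ J ∷ (xs ++ X) ∷ Y ∷ S ∷ L ∷ R ∷ [])
            (restore ks oi) (O ∷ [] ∷ (items is ʳ++ J) ∷ X ∷ (xs ʳ++ Y) ∷ S′ ∷ out bs L ∷ R ∷ [])
  inner-loop ks κ oi sc [] [] _ [] = one {os = still} refl
  inner-loop {O} {J} {X} {Y} {S} {_} {L} {R} ks κ oi sc (ii ∷ is) (x ∷ xs) len F
    with fits-split (toks κ oi ii (marked x) sc) F
  ... | bs₁ , bs₂ , S₁ , refl , F₁ , F₂ rewrite out-++ bs₁ bs₂ L =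
    within-cast (sym (+-assoc unit (length is * unit) 1))
      (within-trans {i = unit}
        (within-weak (s≤s (s≤s (toks-≤ κ oi ii (marked x) sc)))
          (within-trans (one {v = O ∷ items (ii ∷ is) ∷ J ∷ (x ∷ xs ++ X) ∷ Y ∷ S ∷ L ∷ R ∷ []} refl)
            (print-loop (bound maxToks (toks κ oi ii (marked x) sc)) ks κ oi (marked x)
              (unbound-bound maxToks _ (toks-≤ κ oi ii (marked x) sc)) F₁)))
        (inner-loop ks κ oi (marked x) is xs (suc-injective len) F₂))
    where
    within-weak : ∀ {i j p v p′ v′} → i ≤ j → DWithin i p v p′ v′ → DWithin j p v p′ v′
    within-weak le (n , n≤ , D) = n , ≤-trans n≤ le , D

  restore-loop : ∀ {O I X S L R} ks oi is ys → length ys ≡ length is →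
    DWithin (length is) (restore ks oi) (O ∷ I ∷ items is ∷ X ∷ ys ∷ S ∷ L ∷ R ∷ [])
            (restore ks oi) (O ∷ (items is ʳ++ I) ∷ [] ∷ (ys ʳ++ X) ∷ [] ∷ S ∷ L ∷ R ∷ [])
  restore-loop ks oi [] [] _ = 0 , z≤n , []
  restore-loop {O} {I} {X} {S} {L} {R} ks oi (i ∷ is) (y ∷ ys) len =
    within-trans (one {v = O ∷ I ∷ items (i ∷ is) ∷ X ∷ (y ∷ ys) ∷ S ∷ L ∷ R ∷ []} refl)
      (restore-loop ks oi is ys (suc-injective len))

  round : ℕ → ℕ
  round n = (n * unit + 1) + n

  double-ʳ++ : ∀ (xs ys : List A) → (xs ʳ++ []) ʳ++ ys ≡ xs ++ ys
  double-ʳ++ xs ys = trans (Listₚ.ʳ++-ʳ++ xs) (cong (λ z → xs ++ z) refl)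

  item-round : ∀ {O X S S′ L R bs} ks κ oi is xs → length xs ≡ length is →
    Fits (innerToks κ oi false is xs) S bs S′ →
    DWithin (round (length is)) (inner ks κ oi false) (O ∷ items is ∷ [] ∷ (xs ++ X) ∷ [] ∷ S ∷ L ∷ R ∷ [])
            (restore ks oi) (O ∷ items is ∷ [] ∷ (xs ++ X) ∷ [] ∷ S′ ∷ out bs L ∷ R ∷ [])
  item-round {O} {X} {S} {S′} {L} {R} {bs} ks κ oi is xs len F =
    within-trans (inner-loop ks κ oi false is xs len F) second
    where
    rs : List Item
    rs = is ʳ++ []
    rs-eq : items rs ≡ items is ʳ++ []
    rs-eq = Listₚ.map-ʳ++ inj₁ is
    lenᵣ : ∀ {Z : Set} (zs : List Z) → length (zs ʳ++ []) ≡ length zs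
    lenᵣ zs = trans (cong length (Listₚ.ʳ++-defn zs {[]})) (trans (cong length (Listₚ.++-identityʳ (List.reverse zs))) (Listₚ.length-reverse zs))
    second : DWithin (length is) (restore ks oi) (O ∷ [] ∷ (items is ʳ++ []) ∷ X ∷ (xs ʳ++ []) ∷ S′ ∷ out bs L ∷ R ∷ [])
               (restore ks oi) (O ∷ items is ∷ [] ∷ (xs ++ X) ∷ [] ∷ S′ ∷ out bs L ∷ R ∷ [])
    second with restore-loop {O} {[]} {X} {S′} {out bs L} {R} ks oi rs (xs ʳ++ []) (trans (lenᵣ xs) (trans len (sym (lenᵣ is))))
    ... | D rewrite rs-eq | lenᵣ is | double-ʳ++ (items is) [] | double-ʳ++ xs X | Listₚ.++-identityʳ (items is) = D

  kind-loop : ∀ {O X S S′ L R bs} ks kl κ oi is xs → unbound ks ≡ kl → length xs ≡ length is →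
    Fits (kindToks (κ ∷ kl) oi is xs) S bs S′ →
    DWithin (suc (length kl) * suc (round (length is))) (inner ks κ oi false) (O ∷ items is ∷ [] ∷ (xs ++ X) ∷ [] ∷ S ∷ L ∷ R ∷ [])
            outer (O ∷ items is ∷ [] ∷ (zeroItem ∷ xs ++ X) ∷ [] ∷ S′ ∷ out bs L ∷ R ∷ [])
  kind-loop {O} {X} {S} {S′} {L} {R} ks kl κ oi is xs u len F with fits-split (innerToks κ oi false is xs) F
  kind-loop {O} {X} {S} {S′} {L} {R} ks [] κ oi is xs u len F | bs₁ , .[] , S₁ , refl , F₁ , [] rewrite Listₚ.++-identityʳ bs₁ =
    within-cast (trans (+-comm (round (length is)) 1) (sym (+-identityʳ _)))
      (within-trans (item-round ks κ oi is xs len F₁)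
        (one {os = advanceOps} fires))
    where
    fires : gstep (restore ks oi) (hds (O ∷ items is ∷ [] ∷ (xs ++ X) ∷ [] ∷ S′ ∷ out bs₁ L ∷ R ∷ [])) ≡
           just (outer , advanceOps)
    fires rewrite pop-[] ks u = refl
  kind-loop {O} {X} {S} {S′} {L} {R} ks (κ′ ∷ kl) κ oi is xs u len F | bs₁ , bs₂ , S₁ , refl , F₁ , F₂
    with pop-∷ ks u
  ... | ks′ , e , u′ rewrite out-++ bs₁ bs₂ L =
    within-cast (cong (_+ suc (length kl) * suc (round (length is))) (+-comm (round (length is)) 1))
      (within-trans (within-trans (item-round ks κ oi is xs len F₁) (one {os = still} fires))
        (kind-loop ks′ kl κ′ oi is xs u′ len F₂))
    where
    fires : gstep (restore ks oi) (hds (O ∷ items is ∷ [] ∷ (xs ++ X) ∷ [] ∷ S₁ ∷ out bs₁ L ∷ R ∷ [])) ≡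
           just (inner ks′ κ′ oi false , still)
    fires rewrite e = refl

  body : ℕ → ℕ
  body n = suc (suc (length kinds) * suc (round n))

  outer-loop : ∀ {X S S′ L R bs} os is → length is ≤ length X → Fits (outerToks os is X) S bs S′ →
    ∃₂ λ X′ I′ → DWithin (length os * body (length is) + 1) outer (items os ∷ items is ∷ [] ∷ X ∷ [] ∷ S ∷ L ∷ R ∷ [])
            rewind ([] ∷ I′ ∷ [] ∷ X′ ∷ [] ∷ S′ ∷ out bs L ∷ R ∷ [])
  outer-loop [] is le [] = _ , _ , one {os = still} refl
  outer-loop {X} {S} {S′} {L} {R} (oi ∷ os) is le F
    with fits-split (kindToks (kind₀ ∷ kinds) oi is (List.take (length is) X)) F
  ... | bs₁ , bs₂ , S₁ , refl , F₁ , F₂ with outer-loop {zeroItem ∷ X} {S₁} {S′} {out bs₁ L} {R} os is (m≤n⇒m≤1+n le) F₂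
  ... | X′ , I′ , D rewrite out-++ bs₁ bs₂ L = X′ , I′ , within-cast (sym (+-assoc (body (length is)) (length os * body (length is)) 1))
    (within-trans {i = body (length is)}
      (within-trans (one {v = items (oi ∷ os) ∷ items is ∷ [] ∷ X ∷ [] ∷ S ∷ L ∷ R ∷ []} refl) kinds-done) D)
    where
    kinds-done : DWithin (suc (length kinds) * suc (round (length is))) (firstPC oi)
                   (items os ∷ items is ∷ [] ∷ X ∷ [] ∷ S ∷ L ∷ R ∷ [])
                   outer (items os ∷ items is ∷ [] ∷ (zeroItem ∷ X) ∷ [] ∷ S₁ ∷ out bs₁ L ∷ R ∷ [])
    kinds-done with kind-loop {items os} {List.drop (length is) X} {S} {S₁} {L} {R} (bound (length kinds) kinds) kinds kind₀ oi is
                      (List.take (length is) X) (unbound-bound (length kinds) kinds ≤-refl)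
                      (trans (Listₚ.length-take (length is) X) (m≤n⇒m⊓n≡m le)) F₁
    ... | E rewrite Listₚ.take++drop≡id (length is) X = E

  rewind-loop : ∀ {O I J X Y S R} bs →
    DWithin (length bs + 1) rewind (O ∷ I ∷ J ∷ X ∷ Y ∷ S ∷ map bitA bs ∷ R ∷ [])
            runPC (O ∷ I ∷ J ∷ X ∷ Y ∷ S ∷ [] ∷ (map bitA bs ʳ++ R) ∷ [])
  rewind-loop {O} {I} {J} {X} {Y} {S} {R} [] = one {os = still} fires
    where
    fires : gstep rewind (hds (O ∷ I ∷ J ∷ X ∷ Y ∷ S ∷ [] ∷ R ∷ [])) ≡ just (runPC , still)
    fires with Finite._≟ᶠ_ finA dflt dflt
    ... | yes _ = refl
    ... | no ne = contradiction refl ne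
  rewind-loop {O} {I} {J} {X} {Y} {S} {R} (b ∷ bs) =
    within-trans (one {os = rewindOps (bitA b)} fires) (rewind-loop bs)
    where
    ne : ∀ b → bitA b ≢ dflt
    ne true ()
    ne false ()
    fires : gstep rewind (hds (O ∷ I ∷ J ∷ X ∷ Y ∷ S ∷ (bitA b ∷ map bitA bs) ∷ R ∷ [])) ≡
           just (rewind , rewindOps (bitA b))
    fires with Finite._≟ᶠ_ finA (bitA b) dflt
    ... | yes e = contradiction e (ne b)
    ... | no _ = refl

  printTime : ℕ → ℕ → ℕ
  printTime n w = 1 + (n * body n + 1) + (w + 1)

  -- The machine starts with blank tops, which the first step pops.
  initial : List Item → Stacks₈
  initial is = st ∷ st ∷ e ∷ st ∷ e ∷ st ∷ e ∷ e ∷ []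
    where
    e st : List A
    e = dflt ∷ []
    st = dflt ∷ items is

  printed : ∀ is {bs S′} → Fits (outerToks is is (items is)) (items is) bs S′ →
    ∃₂ λ X I → ∃₂ λ S J → ∃₂ λ O Y → DWithin (printTime (length is) (length bs)) begin (initial is)
      runPC (O ∷ I ∷ J ∷ X ∷ Y ∷ S ∷ [] ∷ map bitA bs ∷ [])
  printed is {bs} {S′} F with outer-loop {items is} {items is} {S′} {[]} {[]} is is (≤-reflexive (sym (Listₚ.length-map inj₁ is))) F
  ... | X , I , D = X , I , S′ , [] , [] , [] ,
    within-trans (within-trans (one {os = Vec.replicate 8 pops} refl) D) rew
    where
    rew : DWithin (length bs + 1) rewind ([] ∷ I ∷ [] ∷ X ∷ [] ∷ S′ ∷ out bs [] ∷ [] ∷ [])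
            runPC ([] ∷ I ∷ [] ∷ X ∷ [] ∷ S′ ∷ [] ∷ map bitA bs ∷ [])
    rew with rewind-loop {[]} {I} {[]} {X} {[]} {S′} {[]} (bs ʳ++ [])
    ... | E rewrite Listₚ.map-ʳ++ bitA bs {[]} | double-ʳ++ (map bitA bs) [] | Listₚ.++-identityʳ (map bitA bs)
                | trans (cong length (Listₚ.ʳ++-defn bs {[]})) (trans (cong length (Listₚ.++-identityʳ (List.reverse bs))) (Listₚ.length-reverse bs)) = E

-- The decider as a stack machine

module Runner (N : MNTM) (script : Script) where
  open Program N script public
  open MNTM N using (k; r; m) renaming (start to startN; acc to accN; rej to rejN; δ to δN)
  private module HN = HalfTape blankN

  first₈ : ∀ {X : Set} {n} → Vec X (8 + n) → Vec X 8
  first₈ (a ∷ b ∷ c ∷ d ∷ e ∷ f ∷ g ∷ h ∷ _) = a ∷ b ∷ c ∷ d ∷ e ∷ f ∷ g ∷ h ∷ []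

  drop₆ : ∀ {X : Set} {n} → Vec X (6 + n) → Vec X n
  drop₆ (_ ∷ _ ∷ _ ∷ _ ∷ _ ∷ _ ∷ t) = t

  symOf : A → TapeSym
  symOf (inj₁ _) = blankN
  symOf (inj₂ v) = v

  tapeReads : ∀ n → Vec A (n * 2) → Vec TapeSym n
  tapeReads zero _ = []
  tapeReads (suc n) (_ ∷ x ∷ t) = symOf x ∷ tapeReads n t

  tapeOps : ∀ n → Vec A (n * 2) → Vec TapeSym n → Vec (Fin 3) n → Vec (Op A) (n * 2)
  tapeOps zero _ _ _ = []
  tapeOps (suc n) (l ∷ _ ∷ t) (y ∷ ys) (0F ∷ ds) = pops ∷ pushes₂ l (inj₂ y) ∷ tapeOps n t ys ds
  tapeOps (suc n) (l ∷ _ ∷ t) (y ∷ ys) (1F ∷ ds) = keep ∷ puts (inj₂ y) ∷ tapeOps n t ys ds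
  tapeOps (suc n) (l ∷ _ ∷ t) (y ∷ ys) (2F ∷ ds) = pushes (inj₂ y) ∷ pops ∷ tapeOps n t ys ds

  runNext : PC → Vec A K → PC → Bool
  -- `δN` is unrestricted at halting states, so rejection must be blocked here; acceptance is caught
  -- by `haltsPC`.
  runNext (run p _ _) t (run p′ ys ds) = not (does (p Fin.≟ rejN)) ∧ δN p (tapeReads (suc k) (drop₆ t)) p′ ys ds
  runNext _ _ _ = false

  runOps : Vec A K → PC → Vec (Op A) K
  runOps t (run _ ys ds) = Vec.replicate 6 keep Vec.++ tapeOps (suc k) (drop₆ t) ys ds
  runOps _ _ = Vec.replicate K keep

  nextOf : Maybe (PC × Ops₈) → PC → Vec A K → PC → Bool
  nextOf (just (f , _)) _ _ p′ = does (Finite._≟ᶠ_ finPC p′ f)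
  nextOf nothing p t p′ = runNext p t p′

  opsOf : Maybe (PC × Ops₈) → Vec A K → PC → Vec (Op A) K
  opsOf (just (_ , os)) _ _ = os Vec.++ Vec.replicate (k * 2) keep
  opsOf nothing t p′ = runOps t p′

  haltsPC : PC → Bool
  haltsPC (run p _ _) = does (p Fin.≟ accN)
  haltsPC _ = false

  SM : StackMachine
  SM = record
    { finPC = finPC ; finA = finA ; dflt = dflt ; K = K ; init = begin
    ; next = λ p t p′ → nextOf (gstep p (first₈ t)) p t p′
    ; ops = λ p t p′ → opsOf (gstep p (first₈ t)) t p′
    ; halts = haltsPC }

  flat : ∀ {n} → Vec HN.Tape n → Vec (List A) (n * 2)
  flat [] = []
  flat ((L , R) ∷ zs) = map inj₂ L ∷ map inj₂ R ∷ flat zs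

  shifts : ∀ {n} → Vec (Fin 3) n → Vec TapeSym n → Vec HN.Tape n → Vec HN.Tape n
  shifts ds ys zs = zipWith (λ f z → f z) (zipWith HN.shift ds ys) zs

  private
    hd-map : ∀ L → hd (map inj₂ L) ≡ inj₂ (HN.hd L)
    hd-map [] = refl
    hd-map (x ∷ L) = refl

    tl-map : ∀ (L : List TapeSym) → tl {A} (map inj₂ L) ≡ map inj₂ (tl L)
    tl-map [] = refl
    tl-map (x ∷ L) = refl

  flat-ops : ∀ {n} (zs : Vec HN.Tape n) ys ds →
             zipWith apply (tapeOps n (hds (flat zs)) ys ds) (flat zs) ≡ flat (shifts ds ys zs)
  flat-ops [] [] [] = refl
  flat-ops ((L , R) ∷ zs) (y ∷ ys) (0F ∷ ds) =
    cong₂ _∷_ (tl-map L) (cong₂ _∷_ (cong₂ _∷_ (hd-map L) (cong (inj₂ y ∷_) (tl-map R))) (flat-ops zs ys ds))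
  flat-ops ((L , R) ∷ zs) (y ∷ ys) (1F ∷ ds) =
    cong₂ _∷_ refl (cong₂ _∷_ (cong (inj₂ y ∷_) (tl-map R)) (flat-ops zs ys ds))
  flat-ops ((L , R) ∷ zs) (y ∷ ys) (2F ∷ ds) =
    cong₂ _∷_ refl (cong₂ _∷_ (tl-map R) (flat-ops zs ys ds))

  scanned : ∀ {n} → Vec HN.Tape n → Vec TapeSym n
  scanned = Vec.map (HN.hd ∘ proj₂)

  flat-reads : ∀ {n} (zs : Vec HN.Tape n) → tapeReads n (hds (flat zs)) ≡ scanned zs
  flat-reads [] = refl
  flat-reads ((L , R) ∷ zs) = cong₂ _∷_ (cong symOf (hd-map R)) (flat-reads zs)

  NRep : Vec HN.Tape (suc k) → ConfigM N → Set
  NRep zs (_ , hs , τs) = ∀ t → HN.Rep (lookup zs t) (lookup hs t) (lookup τs t)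

  nrep-reads : ∀ {zs p hs τs} → NRep zs (p , hs , τs) → Vec.zipWith (λ τ h → τ h) τs hs ≡ scanned zs
  nrep-reads {zs} {_} {hs} {τs} R = lookup-ext λ t →
    trans (Vecₚ.lookup-zipWith (λ τ h → τ h) t τs hs)
      (trans (HN.rep-read (R t)) (sym (Vecₚ.lookup-map t (HN.hd ∘ proj₂) zs)))

  nrep-step : ∀ {zs p p′ hs τs} ys ds → NRep zs (p , hs , τs) →
    NRep (shifts ds ys zs) (p′ , Vec.zipWith (λ h d → h ℤ.+ move d) hs ds , Vec.zipWith (λ f y → f y) (Vec.zipWith update τs hs) ys)
  nrep-step {zs} {hs = hs} {τs} ys ds R t
    rewrite Vecₚ.lookup-zipWith (λ f z → f z) t (zipWith HN.shift ds ys) zs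
          | Vecₚ.lookup-zipWith HN.shift t ds ys
          | Vecₚ.lookup-zipWith (λ h d → h ℤ.+ move d) t hs ds
          | Vecₚ.lookup-zipWith (λ f y → f y) t (Vec.zipWith update τs hs) ys
          | Vecₚ.lookup-zipWith update t τs hs = HN.rep-shift (lookup ds t) (lookup ys t) (R t)

  blankTape : HN.Tape
  blankTape = [] , []

  startTapes : List Bool → Vec HN.Tape (suc k)
  startTapes w = ([] , map (bitSym N) w) ∷ Vec.replicate k blankTape

  nrep-init : ∀ w → NRep (startTapes w) (initM N w)
  nrep-init w 0F = HN.rep input
    where
    at-nth : ∀ w i → nth N w i ≡ HN.at (map (bitSym N) w) i
    at-nth [] i = refl
    at-nth (x ∷ w) zero = refl
    at-nth (x ∷ w) (suc i) = at-nth w i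
    input : ∀ i → inTape N w (pos 0 ℤ.+ i) ≡ HN.cellAt ([] , map (bitSym N) w) i
    input (pos i) = at-nth w i
    input -[1+ i ] = refl
  nrep-init w (Fin.suc t)
    rewrite Vecₚ.lookup-replicate t blankTape | Vecₚ.lookup-replicate t (pos 0) =
    HN.rep λ { (pos i) → blankCell (pos i) ; -[1+ i ] → blankCell -[1+ i ] }
    where
    blankCell : ∀ z → lookup (Vec.replicate k (λ (_ : ℤ) → blankN)) t z ≡ blankN
    blankCell z = cong (λ f → f z) (Vecₚ.lookup-replicate t (λ (_ : ℤ) → blankN))

  restStacks : Vec (List A) (k * 2)
  restStacks = flat (Vec.replicate k blankTape)

-- Long runs of the core and acceptance by the decider

module Exec (N : MNTM) (script : Script) {a b : ℕ} (M : NTM1 a b) (E : Embedding (Runner.SM N script) M) where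
  open Runner N script
  open MNTM N using (k; r; m) renaming (start to startN; acc to accN; rej to rejN; δ to δN)
  open Core SM using (W)
  open Zip M using (ZConf; ZSteps; ZStep; _+++_; ztruncate; []; _∷_)
  open Sim SM M E

  trips : ℕ → ℕ → ℕ
  trips zero h = 0
  trips (suc n) h = suc (tripTail h) + trips n (suc h)

  trips-+ : ∀ m n h → trips (m + n) h ≡ trips m h + trips n (m + h)
  trips-+ zero n h = refl
  trips-+ (suc m) n h = trans (cong (suc (tripTail h) +_) (trans (trips-+ m n (suc h)) (cong (λ z → trips m (suc h) + trips n z) (+-suc m h))))
    (sym (+-assoc (suc (tripTail h)) (trips m (suc h)) _))

  trips-mono : ∀ {m n} h → m ≤ n → trips m h ≤ trips n h
  trips-mono h z≤n = z≤n
  trips-mono h (s≤s le) = +-monoʳ-≤ (suc (tripTail h)) (trips-mono (suc h) le)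

  private
    tripTail-mono : ∀ {h h′} → h ≤ h′ → tripTail h ≤ tripTail h′
    tripTail-mono le = +-mono-≤ (+-monoˡ-≤ (W + 1) (*-monoˡ-≤ W le)) (*-monoˡ-≤ W (s≤s le))

  -- Rows only get added, so no trip is longer than one at the final height h + n; this is the
  -- source of the quadratic slowdown.
  trips-≤ : ∀ n h → trips n h ≤ n * suc (tripTail (h + n))
  trips-≤ zero h = z≤n
  trips-≤ (suc n) h = +-mono-≤ (s≤s (tripTail-mono (m≤m+n h (suc n))))
    (≤-trans (trips-≤ n (suc h)) (≤-reflexive (cong (λ z → n * suc (tripTail z)) (sym (+-suc h n)))))

  private
    keeps : ∀ {n} (st : Vec (List A) n) → zipWith apply (Vec.replicate n keep) st ≡ st
    keeps [] = refl
    keeps (l ∷ st) = cong (l ∷_) (keeps st)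

    first-tops : ∀ (v : Stacks₈) (rest : Vec (List A) (k * 2)) → first₈ (tops (v Vec.++ rest)) ≡ hds v
    first-tops (_ ∷ _ ∷ _ ∷ _ ∷ _ ∷ _ ∷ _ ∷ _ ∷ []) rest = refl

    apply-++ : ∀ {m n} (os : Vec (Op A) m) (os′ : Vec (Op A) n) v rest →
               zipWith apply (os Vec.++ os′) (v Vec.++ rest) ≡ zipWith apply os v Vec.++ zipWith apply os′ rest
    apply-++ [] os′ [] rest = refl
    apply-++ (o ∷ os) os′ (l ∷ v) rest = cong (apply o l ∷_) (apply-++ os os′ v rest)

    gstep-halts : ∀ p {t x} → gstep p t ≡ just x → haltsPC p ≡ false
    gstep-halts begin e = refl
    gstep-halts outer e = refl
    gstep-halts (inner _ _ _ _) e = refl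
    gstep-halts (print _ _ _ _ _) e = refl
    gstep-halts (restore _ _) e = refl
    gstep-halts rewind e = refl

    module _ {p v p′ os} (rest : Vec (List A) (k * 2)) (e : gstep p (hds v) ≡ just (p′ , os)) where
      private
        e′ : gstep p (first₈ (tops (v Vec.++ rest))) ≡ just (p′ , os)
        e′ = trans (cong (gstep p) (first-tops v rest)) e

      gstep-next : ∀ p″ → StackMachine.next SM p (tops (v Vec.++ rest)) p″ ≡ does (Finite._≟ᶠ_ finPC p″ p′)
      gstep-next p″ = cong (λ g → nextOf g p (tops (v Vec.++ rest)) p″) e′

      gstep-apply : ∀ p″ → zipWith apply (StackMachine.ops SM p (tops (v Vec.++ rest)) p″) (v Vec.++ rest) ≡ zipWith apply os v Vec.++ rest
      gstep-apply p″ = trans (cong (λ g → zipWith apply (opsOf g (tops (v Vec.++ rest)) p″) (v Vec.++ rest)) e′)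
        (trans (apply-++ os (Vec.replicate (k * 2) keep) v rest) (cong (zipWith apply os v Vec.++_) (keeps rest)))

    home-cong : ∀ {h p p′ st st′ c} → p ≡ p′ → st ≡ st′ → Home h p st c → Home h p′ st′ c
    home-cong refl refl H = H

  height-cong : ∀ {h h′ p st c} → h ≡ h′ → Home h p st c → Home h′ p st c
  height-cong refl H = H

  dsteps-fwd : ∀ {n p v p′ v′ h c} rest → DSteps n p v p′ v′ → Home h p (v Vec.++ rest) c →
               ∃ λ c′ → ZSteps (trips n h) c c′ × Home (n + h) p′ (v′ Vec.++ rest) c′
  dsteps-fwd rest [] H = _ , [] , H
  dsteps-fwd {suc n} {p} {h = h} rest (_∷_ {v = v} {p′} {os} e D) H
    with home-fwd {p′ = p′} H (gstep-halts p e) (trans (gstep-next {p} {v} {p′} {os} rest e p′) (dec-true (Finite._≟ᶠ_ finPC p′ p′) refl))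
  ... | c₁ , ss , H₁ with dsteps-fwd rest D (home-cong refl (gstep-apply {p} {v} {p′} {os} rest e p′) H₁)
  ... | c₂ , ss′ , H₂ = c₂ , ss +++ ss′ , height-cong (+-suc n h) H₂

  dsteps-bwd : ∀ {n p v p′ v′ h c j c″} rest → DSteps n p v p′ v′ → Home h p (v Vec.++ rest) c → ZSteps (trips n h + suc j) c c″ →
               ∃ λ c′ → Home (n + h) p′ (v′ Vec.++ rest) c′ × ZSteps (suc j) c′ c″
  dsteps-bwd rest [] H ss = _ , H , ss
  dsteps-bwd {suc n} {p} {h = h} {c} {j} {c″} rest (_∷_ {v = v} {p′} {os} e D) H ss
    with home-bwd H (gstep-halts p e) (subst (λ l → ZSteps l c c″)
           (trans (+-assoc (suc (tripTail h)) (trips n (suc h)) (suc j)) (cong (suc (tripTail h) +_) (+-suc (trips n (suc h)) j))) ss)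
  ... | p₁ , c₁ , nx , H₁ , ss₁ with does⇒ (Finite._≟ᶠ_ finPC p₁ p′) (trans (sym (gstep-next {p} {v} {p′} {os} rest e p₁)) nx)
  ... | refl with dsteps-bwd rest D (home-cong refl (gstep-apply {p} {v} {p′} {os} rest e p₁) H₁)
                    (subst (λ l → ZSteps l c₁ c″) (sym (+-suc (trips n (suc h)) j)) ss₁)
  ... | c₂ , H₂ , ss₂ = c₂ , height-cong (+-suc n h) H₂ , ss₂

  record RunHome (h : ℕ) (cN : ConfigM N) (c : ZConf) : Set where
    constructor run-home
    field
      {garbage} : Vec (List A) 6
      {zs}      : Vec _ (suc k)
      {ys}      : Vec TapeSym (suc k)
      {ds}      : Vec (Fin 3) (suc k)
      tapes     : NRep zs cN
      home      : Home h (run (proj₁ cN) ys ds) (garbage Vec.++ flat zs) c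

  private
    drop-tops : ∀ (g : Vec (List A) 6) {n} (st : Vec (List A) n) → drop₆ (Vec.map hd (g Vec.++ st)) ≡ hds st
    drop-tops (_ ∷ _ ∷ _ ∷ _ ∷ _ ∷ _ ∷ []) st = refl

    module _ (g : Vec (List A) 6) (zs : Vec (HalfTape.Tape blankN) (suc k)) where
      run-reads : tapeReads (suc k) (drop₆ (tops (g Vec.++ flat zs))) ≡ scanned zs
      run-reads = trans (cong (tapeReads (suc k)) (drop-tops g (flat zs))) (flat-reads zs)

      run-apply : ∀ ys ds → zipWith apply (Vec.replicate 6 keep Vec.++ tapeOps (suc k) (drop₆ (tops (g Vec.++ flat zs))) ys ds) (g Vec.++ flat zs)
                            ≡ g Vec.++ flat (shifts ds ys zs)
      run-apply ys ds = trans (apply-++ (Vec.replicate 6 keep) _ g (flat zs))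
        (cong₂ Vec._++_ (keeps g) (trans (cong (λ t → zipWith apply (tapeOps (suc k) t ys ds) (flat zs)) (drop-tops g (flat zs))) (flat-ops zs ys ds)))

    run-fwd : ∀ {h cN cN′ c} → StepM N cN cN′ → RunHome h cN c →
              ∃ λ c′ → ZSteps (suc (tripTail h)) c c′ × RunHome (suc h) cN′ c′
    run-fwd {h} {p , hs , τs} (StepM.step {p' = p′} {ys = ys} {ds = ds} na nr t) (run-home {g} {zs} {ys₀} {ds₀} R H)
      with home-fwd {p′ = run p′ ys ds} H (dec-false (p Fin.≟ accN) na) nx
      where
      nx : not (does (p Fin.≟ rejN)) ∧ δN p (tapeReads (suc k) (drop₆ (tops (g Vec.++ flat zs)))) p′ ys ds ≡ true
      nx rewrite dec-false (p Fin.≟ rejN) nr | run-reads g zs | sym (nrep-reads {zs} {p} {hs} {τs} R) = t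
    ... | c′ , ss , H′ = c′ , ss , run-home {garbage = g} {zs = shifts ds ys zs} (nrep-step {zs} {p} {p′} {hs} {τs} ys ds R) (home-cong refl (run-apply g zs ys ds) H′)

    run-bwd : ∀ {h cN c j c″} → proj₁ cN ≢ accN → RunHome h cN c → ZSteps (suc (tripTail h) + suc j) c c″ →
              ∃₂ λ cN′ c′ → StepM N cN cN′ × RunHome (suc h) cN′ c′ × ZSteps (suc j) c′ c″
    run-bwd {h} {p , hs , τs} na (run-home {g} {zs} {ys₀} {ds₀} R H) ss with home-bwd H (dec-false (p Fin.≟ accN) na) ss
    ... | run p′ ys ds , c′ , nx , H′ , ss′ = _ , c′ , StepM.step na nr t , run-home {garbage = g} {zs = shifts ds ys zs} (nrep-step {zs} {p} {p′} {hs} {τs} ys ds R) (home-cong refl (run-apply g zs ys ds) H′) , ss′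
      where
      nr : p ≢ rejN
      nr eq with trans (sym nx) (cong (λ d → not d ∧ δN p (tapeReads (suc k) (drop₆ (tops (g Vec.++ flat zs)))) p′ ys ds) (dec-true (p Fin.≟ rejN) eq))
      ... | ()
      t : δN p (Vec.zipWith (λ τ h → τ h) τs hs) p′ ys ds ≡ true
      t rewrite nrep-reads {zs} {p} {hs} {τs} R | sym (run-reads g zs) =
        trans (cong (λ d → not d ∧ δN p (tapeReads (suc k) (drop₆ (tops (g Vec.++ flat zs)))) p′ ys ds) (sym (dec-false (p Fin.≟ rejN) nr))) nx
    ... | begin , _ , () , _
    ... | outer , _ , () , _
    ... | inner _ _ _ _ , _ , () , _
    ... | print _ _ _ _ _ , _ , () , _
    ... | restore _ _ , _ , () , _
    ... | rewind , _ , () , _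

  zcut : ∀ {m n c c″} → m ≤ n → ZSteps n c c″ → ∃ (ZSteps m c)
  zcut {m} {n} {c} {c″} le ss = ztruncate m (subst (λ l → ZSteps l c c″) (sym (m+[n∸m]≡n le)) ss)

  run-complete : ∀ {h j cN cN′ c} → StepsM N j cN cN′ → proj₁ cN′ ≡ accN → RunHome h cN c → ∀ n → ∃ (ZSteps n c)
  run-complete {cN = p , _} done eq (run-home R H) n = home-halt n H (dec-true (p Fin.≟ accN) eq)
  run-complete {h} (more s ss) eq RH n with run-fwd s RH
  ... | c′ , zs , RH′ with run-complete ss eq RH′ n
  ... | c″ , zs′ = zcut (m≤n+m n (suc (tripTail h))) (zs +++ zs′)

  -- As long as no accepting configuration is met, every completed trip is a step of `N`, and there
  -- are at most t of those.
  run-sound : ∀ t {h cN c c″} → (∀ cN′ → ¬ StepsM N (suc t) cN cN′) → RunHome h cN c → ZSteps (trips (suc t) h + 1) c c″ →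
              ∃₂ λ j cN′ → StepsM N j cN cN′ × proj₁ cN′ ≡ accN
  run-sound t {h} {cN} {c} {c″} tb RH ss with proj₁ cN Fin.≟ accN
  ... | yes eq = 0 , cN , done , eq
  ... | no na with t
  ... | zero with run-bwd na RH (subst (λ l → ZSteps l c c″) (cong (_+ 1) (+-identityʳ (suc (tripTail h)))) ss)
  ...   | cN′ , _ , s , _ = ⊥-elim (tb cN′ (more s done))
  run-sound t {h} {cN} {c} {c″} tb RH ss | no na | suc t′
    with run-bwd na RH (subst (λ l → ZSteps l c c″) (+-assoc (suc (tripTail h)) (trips (suc t′) (suc h)) 1) ss)
  ... | cN₁ , c₁ , s , RH₁ , ss₁ with run-sound t′ (λ cN′ ts → tb cN′ (more s ts)) RH₁ ss₁
  ... | j , cN′ , ts , eq = suc j , cN′ , more s ts , eq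

  module _ {is : List Item} {bs : List Bool} {S′ : List A} {h : ℕ} {c : ZConf}
    (F : Fits (outerToks is is (items is)) (items is) bs S′) (H : Home h begin (initial is Vec.++ restStacks) c) where
    private
      reach : ∀ {X I S J O Y h′ c′} → Home h′ runPC ((O ∷ I ∷ J ∷ X ∷ Y ∷ S ∷ [] ∷ map bitA bs ∷ []) Vec.++ restStacks) c′ →
              RunHome h′ (initM N bs) c′
      reach {X} {I} {S} {J} {O} {Y} H′ = run-home {garbage = O ∷ I ∷ J ∷ X ∷ Y ∷ S ∷ []} {zs = startTapes bs} (nrep-init bs)
        (home-cong refl (cong (λ w → (O ∷ I ∷ J ∷ X ∷ Y ∷ S ∷ [] ∷ w ∷ []) Vec.++ restStacks) (Listₚ.map-∘ bs)) H′)

    accepted⇒loops : Accepts N bs → ∀ n → ∃ (ZSteps n c)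
    accepted⇒loops (j , cN , ss , eq) n with printed is F
    ... | X , I , S , J , O , Y , T , _ , D with dsteps-fwd restStacks D H
    ... | c′ , zs , H′ with run-complete ss eq (reach H′) n
    ... | c″ , zs′ = zcut (m≤n+m n (trips T h)) (zs +++ zs′)

    -- Printing is forced, so a computation that outlasts the printing and t + 1 further trips must
    -- have met an accepting configuration.
    long⇒accepted : ∀ {t c″} → TimeBound N bs t →
                    ZSteps (trips (printTime (length is) (length bs) + suc t) h + 1) c c″ → Accepts N bs
    long⇒accepted {t} tb ss with printed is F
    ... | X , I , S , J , O , Y , T , T≤ , D
      with zcut {trips (T + suc t) h + 1} (+-monoˡ-≤ 1 (trips-mono h (+-monoˡ-≤ (suc t) T≤))) ss
    ... | c‴ , ss′ with dsteps-bwd {j = trips (suc t) (T + h)} restStacks D H (subst (λ l → ZSteps l c c‴)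
              (trans (cong (_+ 1) (trips-+ T (suc t) h)) (trans (+-assoc (trips T h) _ 1) (cong (trips T h +_) (+-comm _ 1)))) ss′)
    ... | c₁ , H′ , ss₁ = run-sound t tb (reach H′) (subst (λ l → ZSteps l c₁ c‴) (+-comm 1 _) ss₁)

∧-true : ∀ {x y} → x ∧ y ≡ true → x ≡ true × y ≡ true
∧-true {true} eq = refl , eq

∧-intro : ∀ {x y} → x ≡ true → y ≡ true → x ∧ y ≡ true
∧-intro refl refl = refl

∨-true : ∀ {x y} → x ∨ y ≡ true → x ≡ true ⊎ y ≡ true
∨-true {true} eq = inj₁ refl
∨-true {false} eq = inj₂ eq

does-≡ : ∀ {n} (i : Fin n) → does (i Fin.≟ i) ≡ true
does-≡ i = dec-true (i Fin.≟ i) refl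

even : ℕ → Bool
even zero = true
even (suc n) = not (even n)

iff : Bool → Bool → Bool
iff true y = y
iff false y = not y

-- Modes, goals and the script

-- Control states are pairs of an item number and a mode.  In mode core the machine is the
-- stack machine, in the modes cnt it counts marks modulo the number of items, in the modes
-- dat it writes the items.  The modes cnt and dat are numbered downwards.
module Layout (a b s₀ w₀ : ℕ) (rowBits : Item → Vec Bool (suc w₀)) where

  G : ℕ
  G = 2 + a + suc b

  Γ : Set
  Γ = Γsym a b

  modes : ℕ
  modes = 3 + (suc s₀ + suc w₀)

  data Mode : Set where
    core rejecting accepting : Mode
    cnt : Fin (suc s₀) → Mode
    dat : Fin (suc w₀) → Mode

  coreI rejI accI : Fin modes
  coreI = 0F
  rejI = 1F
  accI = 2F

  cntI : Fin (suc s₀) → Fin modes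
  cntI i = 3 ↑ʳ (i ↑ˡ suc w₀)

  datI : Fin (suc w₀) → Fin modes
  datI φ = 3 ↑ʳ (suc s₀ ↑ʳ φ)

  mode : Fin modes → Mode
  mode 0F = core
  mode 1F = rejecting
  mode 2F = accepting
  mode (Fin.suc (Fin.suc (Fin.suc i))) = [ cnt , dat ]′ (splitAt (suc s₀) i)

  mode-cnt : ∀ i → mode (cntI i) ≡ cnt i
  mode-cnt i = cong [ cnt , dat ]′ (Finₚ.splitAt-↑ˡ (suc s₀) i (suc w₀))

  mode-dat : ∀ φ → mode (datI φ) ≡ dat φ
  mode-dat φ = cong [ cnt , dat ]′ (Finₚ.splitAt-↑ʳ (suc s₀) (suc w₀) φ)

  -- The only ways to name a target item: conditions that the printer can test without knowing item
  -- numbers.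
  data Sel : Set where
    first same succ entry : Sel

  firstPass : Fin (suc s₀)
  firstPass = Fin.fromℕ s₀

  topBit : Fin (suc w₀)
  topBit = Fin.fromℕ w₀

  -- Passes alternate in direction, and the first one, of number `s₀`, goes right.
  dirOf : Fin (suc s₀) → Bool
  dirOf i = iff (even (toℕ i)) (even s₀)

  marks : Fin (suc s₀) → Γ → Bool
  marks i x = does (i Fin.≟ firstPass) ∨ does (x Fin.≟ bitSymbol a b true)

  wr : Fin (suc s₀) → Bool → Γ
  wr 0F _ = blank a b
  wr (Fin.suc _) x = bitSymbol a b x

  Goal : Set
  Goal = Sel × Fin modes × Γ × Bool

  finish : Fin (suc s₀) → Goal
  finish 0F = first , datI topBit , blank a b , true
  finish (Fin.suc i) = first , cntI (Fin.inject₁ i) , blank a b , not (dirOf (Fin.suc i))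

  -- `φ` counts down while the row is written from left to right, hence the reversal.
  itemBit : Item → Fin (suc w₀) → Γ
  itemBit oi φ = bitSymbol a b (lookup (Vec.reverse (rowBits oi)) φ)

  -- The blank at the end acts as one more mark: it must be met with the counter at P - 1. If there
  -- are u - 1 marks and u = Pu′, then exactly u′ - 1 marks survive, so each pass divides u by P,
  -- beginning with u = n + 1.
  cntGoal : Fin (suc s₀) → Bool → Bool → Bool → Maybe Goal
  cntGoal i isBlank isMark last =
    if isBlank then (if last then just (finish i) else nothing)
    else if isMark then (if last then just (first , cntI i , wr i true , dirOf i)
                         else just (succ , cntI i , wr i false , dirOf i))
    else just (same , cntI i , wr i false , dirOf i)

  goal : Mode → Γ → Item → Maybe Goal
  goal (cnt i) x oi = cntGoal i (does (x Fin.≟ blank a b)) (marks i x) (isLast oi)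
  goal (dat (Fin.suc φ)) x oi = just (same , datI (Fin.inject₁ φ) , itemBit oi (Fin.suc φ) , true)
  goal (dat 0F) x oi =
    if isLast oi then just (entry , coreI , itemBit oi 0F , false)
    else just (succ , datI topBit , itemBit oi 0F , true)
  goal _ _ _ = nothing

  selects : Sel → Item → Bool → Bool → Bool
  selects first ii _ _ = isFirst ii
  selects same _ eq _ = eq
  selects succ _ _ sc = sc
  selects entry ii _ _ = isEntry ii

  hits : Maybe Goal → Item → Bool → Bool → Fin modes → Γ → Bool → Bool
  hits nothing _ _ _ _ _ _ = false
  hits (just (σ , i₀ , y₀ , e₀)) ii eq sc i′ y e =
    selects σ ii eq sc ∧ (does (i′ Fin.≟ i₀) ∧ (does (y Fin.≟ y₀) ∧ does (e Boolₚ.≟ e₀)))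

  isCoreMode : Mode → Bool
  isCoreMode core = true
  isCoreMode _ = false

  -- Between core states the entry comes from the stream. Every other entry is uniform in the item
  -- numbers and can be computed from the flags: either it rejects into block 0 or it fulfils the
  -- goal of the mode.
  tokAt : Fin modes → Γ → Item → Item → Bool → Bool → Fin modes → Γ → Bool → Tok
  tokAt i x oi ii eq sc i′ y e =
    if (isCoreMode (mode i) ∧ isCoreItem oi) ∧ (isCoreItem ii ∧ does (i′ Fin.≟ coreI)) then stream
    else lit ((isFirst ii ∧ does (i′ Fin.≟ rejI)) ∨ hits (goal (mode i) x oi) ii eq sc i′ y e)

  data Kind : Set where
    hdr  : Kind
    char : Bool → Kind
    row  : Fin modes → Γ → Kind

  finKind : Finite Kind
  finKind = finRetract f g gf (fin⊤ fin⊎ finBool fin⊎ (finFin modes fin× finFin _))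
    where
    f : Kind → ⊤ ⊎ Bool ⊎ (Fin modes × Γ)
    f hdr = inj₁ tt
    f (char x) = inj₂ (inj₁ x)
    f (row i x) = inj₂ (inj₂ (i , x))
    g : ⊤ ⊎ Bool ⊎ (Fin modes × Γ) → Kind
    g (inj₁ _) = hdr
    g (inj₂ (inj₁ x)) = char x
    g (inj₂ (inj₂ (i , x))) = row i x
    gf : ∀ x → g (f x) ≡ x
    gf hdr = refl
    gf (char x) = refl
    gf (row i x) = refl

  -- The part of the code between the ones for the number of states and the table. The three
  -- distinguished states lie in block 0, so their numbers do not depend on P.
  header : List Bool
  header = false ∷ (unary (3 + s₀) ++ unary 2 ++ unary 1)

  -- State (j, i) has number j · `modes` + i. The code therefore runs through j, then (i, x), then
  -- j′, then (i′, y, e): outer item, kind, inner item and columns, as the script does.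
  rowKinds : List Kind
  rowKinds = concatMap (λ i → map (row i) (allFin _)) (allFin modes)

  opaque
    kinds : List Kind
    kinds = map char header ++ rowKinds

  columns : ∀ {X : Set} → (Fin modes → Γ → Bool → X) → List X
  columns f = concatMap (λ i′ → concatMap (λ y → map (f i′ y) (false ∷ true ∷ [])) (allFin _)) (allFin modes)

  opaque
    toks : Kind → Item → Item → Bool → Bool → List Tok
    -- Over all inner items this makes P · `modes` ones, the number of states in unary.
    toks hdr oi ii _ _ = if isFirst oi then replicate modes (lit true) else []
    toks (char x) oi ii _ _ = if isFirst oi ∧ isFirst ii then lit x ∷ [] else []
    toks (row i x) oi ii eq sc = columns (tokAt i x oi ii eq sc)

    maxToks : ℕ
    maxToks = modes + (1 + length (columns (λ _ _ e → e)))

  private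
    concatMap-length : ∀ {X Y Z : Set} (f : X → List Y) (g : X → List Z) → (∀ x → length (f x) ≡ length (g x)) →
                       ∀ xs → length (concatMap f xs) ≡ length (concatMap g xs)
    concatMap-length f g eq [] = refl
    concatMap-length f g eq (x ∷ xs) = trans (Listₚ.length-++ (f x)) (trans (cong₂ _+_ (eq x) (concatMap-length f g eq xs)) (sym (Listₚ.length-++ (g x))))

  columns-length : ∀ {X Y : Set} (f : Fin modes → Γ → Bool → X) (g : Fin modes → Γ → Bool → Y) →
                   length (columns f) ≡ length (columns g)
  columns-length f g = concatMap-length (block f) (block g) (λ i → concatMap-length (cell f i) (cell g i) (λ y → refl) (allFin _)) (allFin modes)
    where
    cell : ∀ {Z : Set} → (Fin modes → Γ → Bool → Z) → Fin modes → Γ → List Z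
    cell h i′ y = map (h i′ y) (false ∷ true ∷ [])
    block : ∀ {Z : Set} → (Fin modes → Γ → Bool → Z) → Fin modes → List Z
    block h i′ = concatMap (cell h i′) (allFin _)

  opaque
    unfolding toks maxToks
    toks-≤ : ∀ k oi ii eq sc → length (toks k oi ii eq sc) ≤ maxToks
    toks-≤ hdr oi ii eq sc with isFirst oi
    ... | true = ≤-trans (≤-reflexive (Listₚ.length-replicate modes)) (m≤m+n modes _)
    ... | false = z≤n
    toks-≤ (char x) oi ii eq sc with isFirst oi ∧ isFirst ii
    ... | true = ≤-trans (m≤m+n 1 _) (m≤n+m _ modes)
    ... | false = z≤n
    toks-≤ (row i x) oi ii eq sc =
      ≤-trans (≤-reflexive (columns-length (tokAt i x oi ii eq sc) (λ _ _ e → e)))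
        (≤-trans (m≤n+m _ 1) (m≤n+m _ modes))

  script : Script
  script = record { finKind = finKind ; kind₀ = hdr ; kinds = kinds ; toks = toks ; maxToks = maxToks ; toks-≤ = toks-≤ }

tval : Tok → Bool → Bool
tval (lit x) _ = x
tval stream v = v

-- The machine with P items

module Diagonal (a b s₀ w₀ : ℕ) (rowBits : Item → Vec Bool (suc w₀)) (c₀ r : ℕ)
  (coreδ : Fin (suc c₀) → Γsym a b → Fin (suc c₀) → Γsym a b → Bool → Bool)
  (entryJ : Fin (suc c₀)) (cs : List Bool) where
  open Layout a b s₀ w₀ rowBits public

  p₀ : ℕ
  p₀ = c₀ + r

  P : ℕ
  P = suc p₀

  nthBit : List Bool → ℕ → Bool
  nthBit = HalfTape.at false

  fromSum : ∀ {X Y : Set} → X ⊎ Y → Bool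
  fromSum (inj₁ _) = true
  fromSum (inj₂ _) = false

  item : Fin P → Item
  item j = fromSum (splitAt (suc c₀) j) ∷ nthBit cs (toℕ j) ∷ does (j Fin.≟ 0F) ∷
           does (toℕ j ℕ.≟ p₀) ∷ does (j Fin.≟ entryJ ↑ˡ r) ∷ []

  coreBit : Fin (suc c₀) ⊎ Fin r → Γ → Fin (suc c₀) ⊎ Fin r → Γ → Bool → Bool
  coreBit (inj₁ j) x (inj₁ j′) y e = coreδ j x j′ y e
  coreBit _ _ _ _ _ = false

  isSucc : Fin P → Fin P → Bool
  isSucc j j′ = does (toℕ j′ ℕ.≟ suc (toℕ j))

  tokOf : Fin P → Fin modes → Γ → Fin P → Fin modes → Γ → Bool → Tok
  tokOf j i x j′ i′ y e = tokAt i x (item j) (item j′) (does (j′ Fin.≟ j)) (isSucc j j′) i′ y e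

  -- The table is defined by the very tokens that will print it, so that printing it correctly is a
  -- matter of order only.
  δ₂ : Fin P × Fin modes → Γ → Fin P × Fin modes → Γ → Bool → Bool
  δ₂ (j , i) x (j′ , i′) y e = tval (tokOf j i x j′ i′ y e) (coreBit (splitAt (suc c₀) j) x (splitAt (suc c₀) j′) y e)

  st : Fin P → Fin modes → Fin (P * modes)
  st = combine

  opaque
    δM : Fin (P * modes) → Γ → Fin (P * modes) → Γ → Bool → Bool
    δM p x p′ y e = δ₂ (remQuot modes p) x (remQuot modes p′) y e

    δM-st : ∀ j i x j′ i′ y e → δM (st j i) x (st j′ i′) y e ≡ δ₂ (j , i) x (j′ , i′) y e
    δM-st j i x j′ i′ y e = cong₂ (λ u v → δ₂ u x v y e) (Finₚ.remQuot-combine j i) (Finₚ.remQuot-combine j′ i′)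

  st≢ : ∀ j j′ {i i′} → i ≢ i′ → st j i ≢ st j′ i′
  st≢ j j′ {i} {i′} ne eq = ne (Finₚ.combine-injectiveʳ j i j′ i′ eq)

  as-st : ∀ p → ∃₂ λ j i → p ≡ st j i
  as-st p = proj₁ (remQuot {P} modes p) , proj₂ (remQuot {P} modes p) , sym (Finₚ.combine-remQuot {P} modes p)

  rej-tok : ∀ i x oi ii eq sc y e → isFirst ii ≡ true → tokAt i x oi ii eq sc rejI y e ≡ lit true
  rej-tok i x oi ii eq sc y e f
    rewrite f | Boolₚ.∧-zeroʳ (isCoreItem ii) | Boolₚ.∧-zeroʳ (isCoreMode (mode i) ∧ isCoreItem oi) = refl

  rejects : ∀ p x y e → δM p x (st 0F rejI) y e ≡ true
  rejects p x y e with as-st p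
  ... | j , i , refl = trans (δM-st j i x 0F rejI y e)
    (cong (λ t → tval t (coreBit (splitAt (suc c₀) j) x (splitAt (suc c₀) (Fin.zero {n = p₀})) y e)) (rej-tok i x (item j) (item 0F) (does (0F Fin.≟ j)) (isSucc j 0F) y e refl))

  M : NTM1 a b
  M = record
    { q = P * modes
    ; start = st 0F (cntI firstPass)
    ; acc = st 0F accI
    ; rej = st 0F rejI
    ; start≢acc = st≢ 0F 0F λ ()
    ; start≢rej = st≢ 0F 0F λ ()
    ; acc≢rej = st≢ 0F 0F λ ()
    ; δ = δM
    ; δ-nonempty = λ p _ _ x → st 0F rejI , blank a b , true , rejects p x (blank a b) true }

  open Zip M

  target : Sel → Fin P → Fin P → Set
  target first j j′ = j′ ≡ 0F
  target same j j′ = j′ ≡ j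
  target succ j j′ = toℕ j′ ≡ suc (toℕ j)
  target entry j j′ = j′ ≡ entryJ ↑ˡ r

  private
    target? : ∀ σ j j′ → Dec (target σ j j′)
    target? first j j′ = j′ Fin.≟ 0F
    target? same j j′ = j′ Fin.≟ j
    target? succ j j′ = toℕ j′ ℕ.≟ suc (toℕ j)
    target? entry j j′ = j′ Fin.≟ entryJ ↑ˡ r

    selects-target : ∀ σ j j′ → selects σ (item j′) (does (j′ Fin.≟ j)) (isSucc j j′) ≡ does (target? σ j j′)
    selects-target first j j′ = refl
    selects-target same j j′ = refl
    selects-target succ j j′ = refl
    selects-target entry j j′ = refl

    target-unique : ∀ σ {j j₁ j₂} → target σ j j₁ → target σ j j₂ → j₁ ≡ j₂
    target-unique first p q = trans p (sym q)
    target-unique same p q = trans p (sym q)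
    target-unique succ p q = Finₚ.toℕ-injective (trans p (sym q))
    target-unique entry p q = trans p (sym q)

    noncore-tok : ∀ i x oi ii eq sc i′ y e → isCoreMode (mode i) ≡ false →
      tokAt i x oi ii eq sc i′ y e ≡ lit ((isFirst ii ∧ does (i′ Fin.≟ rejI)) ∨ hits (goal (mode i) x oi) ii eq sc i′ y e)
    noncore-tok i x oi ii eq sc i′ y e nc rewrite nc = refl

    δ-noncore : ∀ j i x j′ i′ y e → isCoreMode (mode i) ≡ false → δM (st j i) x (st j′ i′) y e ≡
      ((does (j′ Fin.≟ 0F) ∧ does (i′ Fin.≟ rejI)) ∨ hits (goal (mode i) x (item j)) (item j′) (does (j′ Fin.≟ j)) (isSucc j j′) i′ y e)
    δ-noncore j i x j′ i′ y e nc = trans (δM-st j i x j′ i′ y e)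
      (cong (λ t → tval t (coreBit (splitAt (suc c₀) j) x (splitAt (suc c₀) j′) y e)) (noncore-tok i x (item j) (item j′) (does (j′ Fin.≟ j)) (isSucc j j′) i′ y e nc))

    rej-case : ∀ j′ i′ → does (j′ Fin.≟ 0F) ∧ does (i′ Fin.≟ rejI) ≡ true → st j′ i′ ≡ st 0F rejI
    rej-case j′ i′ t = let (t₁ , t₂) = ∧-true t in cong₂ st (does⇒ (j′ Fin.≟ 0F) t₁) (does⇒ (i′ Fin.≟ rejI) t₂)

  -- Each selection condition determines the target item, so a goal is fulfilled by one transition;
  -- any other enabled transition rejects.
  goal-det : ∀ {j i σ i₀ y₀ e₀ j₀ d B F} → isCoreMode (mode i) ≡ false → i ≢ rejI → i ≢ accI →
    goal (mode i) (hd F) (item j) ≡ just (σ , i₀ , y₀ , e₀) → target σ j j₀ →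
    Det 1 (st j i , d , B , F) (st j₀ i₀ , go d e₀ y₀ B F)
  goal-det {j} {i} {σ} {i₀} {y₀} {e₀} {j₀} {d} {B} {F} nc nr na g t =
    det-step y₀ e₀ (st≢ j 0F na) (st≢ j 0F nr) enabled unique
    where
    hit : Fin P → Fin modes → Γ → Bool → Bool
    hit j′ i′ y e = hits (goal (mode i) (hd F) (item j)) (item j′) (does (j′ Fin.≟ j)) (isSucc j j′) i′ y e
    enabled : δM (st j i) (hd F) (st j₀ i₀) y₀ e₀ ≡ true
    enabled = trans (δ-noncore j i (hd F) j₀ i₀ y₀ e₀ nc) (trans (cong (_ ∨_) hit-true) (Boolₚ.∨-zeroʳ _))
      where
      hit-true : hit j₀ i₀ y₀ e₀ ≡ true
      hit-true rewrite g = ∧-intro (trans (selects-target σ j j₀) (dec-true (target? σ j j₀) t))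
        (∧-intro (does-≡ i₀) (∧-intro (does-≡ y₀) (dec-true (e₀ Boolₚ.≟ e₀) refl)))
    unique : ∀ p″ y′ e′ → δM (st j i) (hd F) p″ y′ e′ ≡ true → p″ ≡ st 0F rejI ⊎ (p″ ≡ st j₀ i₀ × y′ ≡ y₀ × e′ ≡ e₀)
    unique p″ y′ e′ tr with as-st p″
    ... | j′ , i′ , refl with ∨-true (trans (sym (δ-noncore j i (hd F) j′ i′ y′ e′ nc)) tr)
    ... | inj₁ h = inj₁ (rej-case j′ i′ h)
    ... | inj₂ h rewrite g with ∧-true h
    ... | h₁ , h′ with ∧-true h′
    ... | h₂ , h″ with ∧-true h″
    ... | h₃ , h₄ = inj₂ (cong₂ st (target-unique σ (does⇒ (target? σ j j′) (trans (sym (selects-target σ j j′)) h₁)) t) (does⇒ (i′ Fin.≟ i₀) h₂) ,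
                          does⇒ (y′ Fin.≟ y₀) h₃ , does⇒ (e′ Boolₚ.≟ e₀) h₄)

  goal-none : ∀ {j i d B F k c} → isCoreMode (mode i) ≡ false → goal (mode i) (hd F) (item j) ≡ nothing →
    ¬ ZSteps (suc (suc k)) (st j i , d , B , F) c
  goal-none {j} {i} {d} {B} {F} nc g = no-step only
    where
    only : ∀ p″ y e → δM (st j i) (hd F) p″ y e ≡ true → p″ ≡ st 0F rejI
    only p″ y e tr with as-st p″
    ... | j′ , i′ , refl with ∨-true (trans (sym (δ-noncore j i (hd F) j′ i′ y e nc)) tr)
    ... | inj₁ h = rej-case j′ i′ h
    ... | inj₂ h rewrite g with h
    ... | ()

  coreSt : Fin (suc c₀) → Fin (P * modes)
  coreSt j = st (j ↑ˡ r) coreI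

  private
    split-core : ∀ j → splitAt (suc c₀) (j ↑ˡ r) ≡ inj₁ j
    split-core j = Finₚ.splitAt-↑ˡ (suc c₀) j r

  coreSt-fwd : ∀ j x j′ y e → coreδ j x j′ y e ≡ true → δM (coreSt j) x (coreSt j′) y e ≡ true
  coreSt-fwd j x j′ y e t = trans (δM-st (j ↑ˡ r) coreI x (j′ ↑ˡ r) coreI y e) both
    where
    both : δ₂ (j ↑ˡ r , coreI) x (j′ ↑ˡ r , coreI) y e ≡ true
    both rewrite split-core j | split-core j′ = t

  -- The core mode has no goal, so among the literal entries of a core row only the rejecting ones
  -- are true.
  coreSt-bwd : ∀ j x p y e → δM (coreSt j) x p y e ≡ true → p ≡ st 0F rejI ⊎ (∃ λ j′ → p ≡ coreSt j′ × coreδ j x j′ y e ≡ true)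
  coreSt-bwd j x p y e tr with as-st p
  ... | j′ , i′ , refl with trans (sym (δM-st (j ↑ˡ r) coreI x j′ i′ y e)) tr
  ... | t rewrite split-core j with splitAt (suc c₀) j′ in eqs | i′ Fin.≟ coreI
  ... | inj₂ _ | _ = inj₁ (rej-case j′ i′ (fromInj₁ (λ ()) (∨-true t)))
  ... | inj₁ j₁ | no _ = inj₁ (rej-case j′ i′ (fromInj₁ (λ ()) (∨-true t)))
  ... | inj₁ j₁ | yes refl = inj₂ (j₁ , cong (λ z → st z coreI) (sym (Finₚ.splitAt⁻¹-↑ˡ {i = j′} eqs)) , t)

trues : List Bool → ℕ
trues [] = 0
trues (true ∷ bs) = suc (trues bs)
trues (false ∷ bs) = trues bs

trues-ʳ++ : ∀ bs cs → trues (bs ʳ++ cs) ≡ trues bs + trues cs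
trues-ʳ++ [] cs = refl
trues-ʳ++ (true ∷ bs) cs = trans (trues-ʳ++ bs (true ∷ cs)) (+-suc (trues bs) (trues cs))
trues-ʳ++ (false ∷ bs) cs = trues-ʳ++ bs (false ∷ cs)

trues-reverse : ∀ bs → trues (List.reverse bs) ≡ trues bs
trues-reverse bs = trans (trues-ʳ++ bs []) (+-identityʳ (trues bs))

drop-tabulate : ∀ {X : Set} {n} (f : Fin n → X) j →
                List.drop (toℕ j) (List.tabulate f) ≡ f j ∷ List.drop (suc (toℕ j)) (List.tabulate f)
drop-tabulate f 0F = refl
drop-tabulate f (Fin.suc j) = drop-tabulate (f ∘ Fin.suc) j

-- Counting passes and the writing of the items

module Phases (a b s₀ w₀ : ℕ) (rowBits : Item → Vec Bool (suc w₀)) (c₀ r : ℕ)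
  (coreδ : Fin (suc c₀) → Γsym a b → Fin (suc c₀) → Γsym a b → Bool → Bool)
  (entryJ : Fin (suc c₀)) (cs : List Bool) where
  open Diagonal a b s₀ w₀ rowBits c₀ r coreδ entryJ cs public
  open Zip M public

  private
    ⊔ : Γ
    ⊔ = blank a b
    bit : Bool → Γ
    bit = bitSymbol a b

  go-same : ∀ d y B F → go d d y B F ≡ (d , y ∷ B , tl F)
  go-same true y B F = refl
  go-same false y B F = refl

  go-flip : ∀ d y B F → go d (not d) y B F ≡ (not d , y ∷ tl F , B)
  go-flip true y B F = refl
  go-flip false y B F = refl

  marked# : Fin (suc s₀) → List Γ → ℕ
  marked# i w = trues (map (marks i) w)

  NonBlank : List Γ → Set
  NonBlank = All (_≢ ⊔)

  private
    goal-cnt : ∀ i x j {isB isM isL} → does (x Fin.≟ ⊔) ≡ isB → marks i x ≡ isM → isLast (item j) ≡ isL →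
               goal (mode (cntI i)) x (item j) ≡ cntGoal i isB isM isL
    goal-cnt i x j refl refl refl rewrite mode-cnt i = refl

    cnt-mode : ∀ i → isCoreMode (mode (cntI i)) ≡ false
    cnt-mode i = cong isCoreMode (mode-cnt i)

    cnt-det : ∀ i {j x B F σ i₀ y₀ e₀ j₀} → goal (mode (cntI i)) x (item j) ≡ just (σ , i₀ , y₀ , e₀) → target σ j j₀ →
              Det 1 (st j (cntI i) , dirOf i , B , x ∷ F) (st j₀ i₀ , go (dirOf i) e₀ y₀ B (x ∷ F))
    cnt-det i {B = B} {F} = goal-det {d = dirOf i} {B} (cnt-mode i) (λ ()) (λ ())

    next-item : ∀ (j : Fin P) → toℕ j ≢ p₀ → ∃ λ (j′ : Fin P) → toℕ j′ ≡ suc (toℕ j)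
    next-item j ne = fromℕ< j< , Finₚ.toℕ-fromℕ< j<
      where
      j< : suc (toℕ j) < P
      j< = s≤s (≤∧≢⇒< (≤-pred (Finₚ.toℕ<n j)) ne)

  -- Division by counting: the marks written are the quotient and the final item the remainder when
  -- P divides the initial counter plus the number of marks.
  walk-count : ∀ i j w {B F} → NonBlank w → ∃₂ λ j′ bs → length bs ≡ length w ×
    toℕ j + marked# i w ≡ P * trues bs + toℕ j′ ×
    Det (length w) (st j (cntI i) , dirOf i , B , w ++ F) (st j′ (cntI i) , dirOf i , map (wr i) bs ʳ++ B , F)
  walk-count i j [] _ = j , [] , refl , trans (+-identityʳ (toℕ j)) (cong (_+ toℕ j) (sym (*-zeroʳ P))) , det-refl
  walk-count i j (x ∷ w) {B} {F} (nb ∷ nbs) with marks i x in mk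
  ... | false with walk-count i j w {wr i false ∷ B} {F} nbs
  ...   | j′ , bs , len , eq , D = j′ , false ∷ bs , cong suc len , eq ,
          det-trans (det-to (cong (st j (cntI i) ,_) (go-same (dirOf i) _ B _))
            (cnt-det i (goal-cnt i x j (dec-false (x Fin.≟ ⊔) nb) mk refl) refl)) D
  walk-count i j (x ∷ w) {B} {F} (nb ∷ nbs) | true with toℕ j ℕ.≟ p₀
  ... | yes last with walk-count i 0F w {wr i true ∷ B} {F} nbs
  ...   | j′ , bs , len , eq , D = j′ , true ∷ bs , cong suc len , sum ,
          det-trans (det-to (cong (st 0F (cntI i) ,_) (go-same (dirOf i) _ B _))
            (cnt-det i (goal-cnt i x j (dec-false (x Fin.≟ ⊔) nb) mk (dec-true (toℕ j ℕ.≟ p₀) last)) refl)) D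
    where
    sum : toℕ j + suc (marked# i w) ≡ P * suc (trues bs) + toℕ j′
    sum = trans (+-suc (toℕ j) _) (trans (cong (λ z → suc (z + marked# i w)) last)
      (trans (cong (P +_) eq) (trans (sym (+-assoc P (P * trues bs) (toℕ j′))) (cong (_+ toℕ j′) (sym (*-suc P (trues bs)))))))
  walk-count i j (x ∷ w) {B} {F} (nb ∷ nbs) | true | no ne with next-item j ne
  ... | j₁ , e₁ with walk-count i j₁ w {wr i false ∷ B} {F} nbs
  ...   | j′ , bs , len , eq , D = j′ , false ∷ bs , cong suc len ,
          trans (+-suc (toℕ j) _) (trans (cong (_+ marked# i w) (sym e₁)) eq) ,
          det-trans (det-to (cong (st j₁ (cntI i) ,_) (go-same (dirOf i) _ B _))
            (cnt-det i (goal-cnt i x j (dec-false (x Fin.≟ ⊔) nb) mk (dec-false (toℕ j ℕ.≟ p₀) ne)) e₁)) D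

  -- The head enters a word of length n carrying u ∸ 1 marks, in pass i.
  record PassAt (i : Fin (suc s₀)) (n u : ℕ) (c : ZConf) : Set where
    constructor pass-at
    field
      {w B F}  : List Γ
      shape    : c ≡ (st 0F (cntI i) , dirOf i , B , w ++ F)
      size     : length w ≡ n
      nonblank : NonBlank w
      behind   : Blank B
      ahead    : Blank F
      marking  : suc (marked# i w) ≡ u

  record DataAt (c : ZConf) : Set where
    constructor data-at
    field
      {B F} : List Γ
      shape : c ≡ (st 0F (datI topBit) , true , B , F)
      B-hd  : hd B ≡ ⊔
      ahead : Blank F

  After : Fin (suc s₀) → ℕ → ℕ → ZConf → Set
  After 0F n u c = DataAt c
  After (Fin.suc i) n u c = PassAt (Fin.inject₁ i) n u c

  private
    blank-ʳ++ : ∀ (bs : List Bool) {B} → Blank B → Blank (map (wr 0F) bs ʳ++ B)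
    blank-ʳ++ [] bl = bl
    blank-ʳ++ (_ ∷ bs) bl = blank-ʳ++ bs (blank-∷ bl)

    dir-next : ∀ i → dirOf (Fin.inject₁ i) ≡ not (dirOf (Fin.suc i))
    dir-next i rewrite Finₚ.toℕ-inject₁ i with even (toℕ i)
    ... | true = sym (Boolₚ.not-involutive (even s₀))
    ... | false = refl

    later-marks : ∀ (i : Fin s₀) x → marks (Fin.inject₁ i) (bit x) ≡ x
    later-marks i x rewrite dec-false (Fin.inject₁ i Fin.≟ firstPass)
      (λ e → <⇒≢ (Finₚ.toℕ<n i) (trans (sym (Finₚ.toℕ-inject₁ i)) (trans (cong toℕ e) (Finₚ.toℕ-fromℕ s₀)))) with x
    ... | true = refl
    ... | false = refl

    marks-bits : ∀ (i : Fin s₀) bs → map (marks (Fin.inject₁ i)) (map bit bs) ≡ bs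
    marks-bits i [] = refl
    marks-bits i (x ∷ bs) = cong₂ _∷_ (later-marks i x) (marks-bits i bs)

    bits-nonblank : ∀ bs → NonBlank (map bit bs)
    bits-nonblank [] = []
    bits-nonblank (true ∷ bs) = (λ ()) ∷ bits-nonblank bs
    bits-nonblank (false ∷ bs) = (λ ()) ∷ bits-nonblank bs

    -- After the last pass the word itself is blank, so writing to the right may begin at either end
    -- of it. After any other pass the word is entered from its far end.
    after : ∀ i n bs {B F} → length bs ≡ n → Blank B → Blank F →
            After i n (suc (trues bs)) (st 0F (proj₁ (proj₂ (finish i))) ,
              go (dirOf i) (proj₂ (proj₂ (proj₂ (finish i)))) (proj₁ (proj₂ (proj₂ (finish i)))) (map (wr i) bs ʳ++ B) F)
    after 0F n bs {B} {F} len bB bF with dirOf 0F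
    ... | true = data-at refl refl (blank-tl {F} bF)
    ... | false = data-at refl refl (blank-ʳ++ bs bB)
    after (Fin.suc i) n bs {B} {F} len bB bF = pass-at
      (cong (st 0F (cntI (Fin.inject₁ i)) ,_) (trans (go-flip (dirOf (Fin.suc i)) ⊔ _ F)
        (cong₂ (λ d l → d , ⊔ ∷ tl F , l) (sym (dir-next i))
          (trans (Listₚ.ʳ++-defn (map bit bs)) (cong (_++ B) (sym (Listₚ.reverse-map bit bs)))))))
      (trans (Listₚ.length-map bit (List.reverse bs)) (trans (Listₚ.length-reverse bs) len))
      (bits-nonblank (List.reverse bs)) (blank-∷ (blank-tl {F} bF)) bB
      (cong suc (trans (cong trues (marks-bits i (List.reverse bs))) (trues-reverse bs)))

  -- The final counter is P - 1 exactly if P divides u. In any other case only the rejecting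
  -- transition is left at the end blank.
  pass : ∀ {i n u c} → PassAt i n u c →
         (∃₂ λ u′ c′ → u ≡ P * u′ × Det (suc n) c c′ × After i n u′ c′) ⊎
         ((∀ u′ → u ≢ P * u′) × (∀ {k c″} → ¬ ZSteps (suc n + suc k) c c″))
  pass {i} {n} {u} (pass-at {w} {B} {F} refl refl nb bB bF refl) with walk-count i 0F w {B} {F} nb
  ... | j , bs , len , eq , D with toℕ j ℕ.≟ p₀
  ... | yes last = inj₁ (suc (trues bs) , _ , divides-u ,
          det-cast (+-comm (length w) 1) (det-trans D
            (goal-det {d = dirOf i} {F = F} (cnt-mode i) (λ ()) (λ ()) final (finish-first i))) , after i (length w) bs len bB bF)
    where
    divides-u : suc (marked# i w) ≡ P * suc (trues bs)
    divides-u = trans (cong suc (trans eq (cong (P * trues bs +_) last)))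
      (trans (sym (+-suc (P * trues bs) p₀)) (trans (+-comm (P * trues bs) P) (sym (*-suc P (trues bs)))))
    finish-first : ∀ i → target (proj₁ (finish i)) j 0F
    finish-first 0F = refl
    finish-first (Fin.suc i) = refl
    final : goal (mode (cntI i)) (hd F) (item j) ≡ just (finish i)
    final = goal-cnt i (hd F) j (dec-true (hd F Fin.≟ ⊔) (blank-hd {F} bF)) refl (dec-true (toℕ j ℕ.≟ p₀) last)
  ... | no ne = inj₂ (indivisible , stops)
    where
    j<p₀ : toℕ j < p₀
    j<p₀ = ≤∧≢⇒< (≤-pred (Finₚ.toℕ<n j)) ne
    indivisible : ∀ u′ → suc (marked# i w) ≢ P * u′
    -- P · u′ would lie strictly between two consecutive multiples of P.
    indivisible u′ e = <⇒≱ (*-cancelˡ-< P (trues bs) u′ lower) (≤-pred (*-cancelˡ-< P u′ (suc (trues bs)) upper))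
      where
      e′ : P * u′ ≡ suc (P * trues bs + toℕ j)
      e′ = trans (sym e) (cong suc eq)
      lower : P * trues bs < P * u′
      lower = subst (P * trues bs <_) (sym e′) (s≤s (m≤m+n (P * trues bs) (toℕ j)))
      upper : P * u′ < P * suc (trues bs)
      upper = subst₂ _<_ (sym e′) (trans (+-comm (P * trues bs) P) (sym (*-suc P (trues bs))))
        (subst (suc (P * trues bs + toℕ j) <_) (sym (+-suc (P * trues bs) p₀)) (s≤s (+-monoʳ-< (P * trues bs) j<p₀)))
    stops : ∀ {k c″} → ¬ ZSteps (suc (length w) + suc k) _ c″
    stops {k} {c″} ss = goal-none {j} {cntI i} {d = dirOf i} {F = F} (cnt-mode i)
      (goal-cnt i (hd F) j (dec-true (hd F Fin.≟ ⊔) (blank-hd {F} bF)) refl (dec-false (toℕ j ℕ.≟ p₀) ne))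
      (follow D {suc k} (subst (λ l → ZSteps l (st 0F (cntI i) , dirOf i , B , w ++ F) c″) (sym (+-suc (length w) (suc k))) ss))

  passes-bwd : ∀ k {i n u c j c″} → toℕ i ≡ k → PassAt i n u c → ZSteps (suc k * suc n + suc j) c c″ →
               ∃₂ λ u′ c′ → u ≡ P ^ suc k * u′ × DataAt c′ × ZSteps (suc j) c′ c″
  passes-bwd zero {0F} {n} {c = c} {j} {c″} _ H ss with subst (λ l → ZSteps (l + suc j) c c″) (+-identityʳ (suc n)) ss | pass H
  ... | ss′ | inj₁ (u′ , c′ , eq , D , A) = u′ , c′ , trans eq (cong (_* u′) (sym (*-identityʳ P))) , A , follow D ss′
  ... | ss′ | inj₂ (_ , stops) = ⊥-elim (stops ss′)
  passes-bwd (suc k) {Fin.suc i} {n} {u} {c} {j} {c″} eqk H ss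
    with subst (λ l → ZSteps l c c″) (trans (+-assoc (suc n) (suc k * suc n) (suc j)) (cong (suc n +_) (+-suc (suc k * suc n) j))) ss | pass H
  ... | ss′ | inj₂ (_ , stops) = ⊥-elim (stops ss′)
  ... | ss′ | inj₁ (u₁ , c₁ , eq , D , A)
    with passes-bwd k (trans (Finₚ.toℕ-inject₁ i) (suc-injective eqk)) A (subst (λ l → ZSteps l c₁ c″) (sym (+-suc (suc k * suc n) j)) (follow D ss′))
  ... | u′ , c′ , eq′ , A′ , ss″ = u′ , c′ , trans eq (trans (cong (P *_) eq′) (sym (*-assoc P (P ^ suc k) u′))) , A′ , ss″

  passes-fwd : ∀ k {i n c} → toℕ i ≡ k → PassAt i n (P ^ suc k) c → ∃ λ c′ → ZSteps (suc k * suc n) c c′ × DataAt c′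
  passes-fwd zero {0F} {n} {c} _ H with pass H
  ... | inj₁ (_ , c′ , _ , D , A) = c′ , subst (λ l → ZSteps l c c′) (sym (+-identityʳ (suc n))) (run D) , A
  ... | inj₂ (no-div , _) = ⊥-elim (no-div 1 refl)
  passes-fwd (suc k) {Fin.suc i} {n} {c} eqk H with pass H
  ... | inj₂ (no-div , _) = ⊥-elim (no-div (P ^ suc k) refl)
  ... | inj₁ (u₁ , c₁ , eq , D , A) with *-cancelˡ-≡ (P ^ suc k) u₁ P eq
  ... | refl with passes-fwd k (trans (Finₚ.toℕ-inject₁ i) (suc-injective eqk)) A
  ... | c′ , ss , A′ = c′ , run D +++ ss , A′

  start-pass : ∀ {n} (w : Vec (Σsym a) n) → PassAt firstPass n (suc n) (zinit w)
  start-pass {n} w = pass-at (cong₂ (λ d l → st 0F (cntI firstPass) , d , [] , l) (sym start-dir) (sym (Listₚ.++-identityʳ _)))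
    (trans (Listₚ.length-map (inΓ b) (toList w)) (Vecₚ.length-toList w)) (letters (toList w)) blank-[] blank-[]
    (cong suc (trans (all-marked (map (inΓ b) (toList w))) (trans (Listₚ.length-map (inΓ b) (toList w)) (Vecₚ.length-toList w))))
    where
    iff-refl : ∀ x → iff x x ≡ true
    iff-refl true = refl
    iff-refl false = refl
    start-dir : dirOf firstPass ≡ true
    start-dir = trans (cong (λ k → iff (even k) (even s₀)) (Finₚ.toℕ-fromℕ s₀)) (iff-refl (even s₀))
    letter : ∀ x → inΓ {a} b x ≢ ⊔
    letter x e with trans (sym (Finₚ.splitAt-↑ˡ (2 + a) x (suc b))) (trans (cong (splitAt (2 + a)) e) (Finₚ.splitAt-↑ʳ (2 + a) (suc b) 0F))
    ... | ()
    letters : ∀ xs → NonBlank (map (inΓ b) xs)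
    letters [] = []
    letters (x ∷ xs) = letter x ∷ letters xs
    all-marked : ∀ xs → marked# firstPass xs ≡ length xs
    all-marked [] = refl
    all-marked (x ∷ xs) = trans (cong (λ m → trues ((m ∨ does (x Fin.≟ bit true)) ∷ map (marks firstPass) xs)) (does-≡ firstPass))
      (cong suc (all-marked xs))

  private
    rbits : Fin P → List Bool
    rbits j = toList (Vec.reverse (rowBits (item j)))

    dat-mode : ∀ φ → isCoreMode (mode (datI φ)) ≡ false
    dat-mode φ = cong isCoreMode (mode-dat φ)

    dat-det : ∀ φ {j B F g σ i₀ y₀ e₀ j₀} → goal (dat φ) (hd F) (item j) ≡ g → g ≡ just (σ , i₀ , y₀ , e₀) → target σ j j₀ →
              Det 1 (st j (datI φ) , true , B , F) (st j₀ i₀ , go true e₀ y₀ B F)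
    dat-det φ {j} {B} {F} refl eq = goal-det {d = true} {B} {F} (dat-mode φ) (λ ()) (λ ())
      (trans (cong (λ m → goal m (hd F) (item j)) (mode-dat φ)) eq)

    take-suc : ∀ {X : Set} {n} (u : Vec X n) φ → List.take (suc (toℕ φ)) (toList u) ≡ List.take (toℕ φ) (toList u) ++ lookup u φ ∷ []
    take-suc (x ∷ u) 0F = refl
    take-suc (x ∷ u) (Fin.suc φ) = cong (x ∷_) (take-suc u φ)

  -- The last bit of a block is left to the caller: the step that writes it goes on to the next item
  -- or, after the last one, turns left into the core.
  write-block : ∀ k j φ {B F} → toℕ φ ≡ k → Blank F → ∃₂ λ B₁ F₁ → Blank F₁ ×
    itemBit (item j) 0F ∷ B₁ ≡ map bit (List.take (suc k) (rbits j)) ++ B ×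
    Det k (st j (datI φ) , true , B , F) (st j (datI 0F) , true , B₁ , F₁)
  write-block zero j 0F {B} {F} _ bl = B , F , bl , cong (λ l → map bit l ++ B) (sym (take-suc (Vec.reverse (rowBits (item j))) 0F)) , det-refl
  write-block (suc k) j (Fin.suc φ) {B} {F} eq bl
    with write-block k j (Fin.inject₁ φ) {itemBit (item j) (Fin.suc φ) ∷ B} {tl F} (trans (Finₚ.toℕ-inject₁ φ) (suc-injective eq)) (blank-tl {F} bl)
  ... | B₁ , F₁ , bl₁ , e₁ , D = B₁ , F₁ , bl₁ , trans e₁ step-cells ,
        det-trans (dat-det (Fin.suc φ) {j} {B} {F} refl refl refl) D
    where
    step-cells : map bit (List.take (suc k) (rbits j)) ++ itemBit (item j) (Fin.suc φ) ∷ B ≡ map bit (List.take (suc (suc k)) (rbits j)) ++ B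
    step-cells = sym (trans (cong (λ l → map bit l ++ B) (subst (λ z → List.take (suc z) (rbits j) ≡ List.take z (rbits j) ++ lookup (Vec.reverse (rowBits (item j))) (Fin.suc φ) ∷ []) eq
                   (take-suc (Vec.reverse (rowBits (item j))) (Fin.suc φ))))
      (trans (cong (_++ B) (Listₚ.map-++ bit (List.take (suc k) (rbits j)) _)) (Listₚ.++-assoc (map bit (List.take (suc k) (rbits j))) _ B)))

  allItems : List Item
  allItems = List.tabulate item

  blockBits : List Item → List Bool
  blockBits = concatMap (toList ∘ rowBits)

  private
    whole-block : ∀ j {B F} → Blank F → ∃₂ λ B₁ F₁ → Blank F₁ ×
      itemBit (item j) 0F ∷ B₁ ≡ map bit (toList (rowBits (item j))) ʳ++ B ×
      Det w₀ (st j (datI topBit) , true , B , F) (st j (datI 0F) , true , B₁ , F₁)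
    whole-block j {B} {F} bl with write-block w₀ j topBit {B} {F} (Finₚ.toℕ-fromℕ w₀) bl
    ... | B₁ , F₁ , bl₁ , e , D = B₁ , F₁ , bl₁ , trans e cells-eq , D
      where
      u = rowBits (item j)
      cells-eq : map bit (List.take (suc w₀) (rbits j)) ++ B ≡ map bit (toList u) ʳ++ B
      cells-eq = trans (cong (λ l → map bit l ++ B) (trans (cong (λ z → List.take z (rbits j)) (sym (Vecₚ.length-toList (Vec.reverse u))))
                   (trans (Listₚ.take-all (length (rbits j)) (rbits j) ≤-refl) (Vecₚ.toList-reverse u))))
        (trans (cong (_++ B) (Listₚ.reverse-map bit (toList u))) (sym (Listₚ.ʳ++-defn (map bit (toList u)))))

  write-items : ∀ n j {B F} → toℕ j + n ≡ p₀ → Blank F → ∃ λ y → ∃₂ λ B₁ F₁ → Blank F₁ ×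
    y ∷ B₁ ≡ map bit (blockBits (List.drop (toℕ j) allItems)) ʳ++ B ×
    Det (suc n * suc w₀) (st j (datI topBit) , true , B , F) (coreSt entryJ , false , y ∷ F₁ , B₁)
  write-items n j {B} {F} eq bl with whole-block j {B} {F} bl
  write-items zero j {B} {F} eq bl | B₁ , F₁ , bl₁ , e , D =
    itemBit (item j) 0F , B₁ , tl F₁ , blank-tl {F₁} bl₁ , trans e (cong (λ l → map bit l ʳ++ B) last-bits) ,
    det-cast (trans (+-comm w₀ 1) (sym (+-identityʳ (suc w₀))))
      (det-trans D (dat-det 0F {j} {B₁} {F₁} refl
        (cong (λ l → if l then just (entry , coreI , itemBit (item j) 0F , false) else just (succ , datI topBit , itemBit (item j) 0F , true))
          (dec-true (toℕ j ℕ.≟ p₀) j≡)) refl))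
    where
    j≡ : toℕ j ≡ p₀
    j≡ = trans (sym (+-identityʳ (toℕ j))) eq
    last-bits : toList (rowBits (item j)) ≡ blockBits (List.drop (toℕ j) allItems)
    last-bits = sym (trans (cong blockBits (trans (drop-tabulate item j) (cong (item j ∷_)
      (Listₚ.drop-all (suc (toℕ j)) allItems (≤-reflexive (trans (Listₚ.length-tabulate item) (cong suc (sym j≡))))))))
      (Listₚ.++-identityʳ _))
  write-items (suc n) j {B} {F} eq bl | B₁ , F₁ , bl₁ , e , D with next-item j (<⇒≢ (subst (toℕ j <_) eq (m<m+n (toℕ j) (s≤s z≤n))))
  ... | j₁ , j₁≡ with write-items n j₁ {itemBit (item j) 0F ∷ B₁} {tl F₁} (trans (cong (_+ n) j₁≡) (trans (sym (+-suc (toℕ j) n)) eq)) (blank-tl {F₁} bl₁)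
  ... | y , B₂ , F₂ , bl₂ , e₂ , D₂ = y , B₂ , F₂ , bl₂ , trans e₂ join-bits ,
        det-trans (det-cast (+-comm w₀ 1) (det-trans D (dat-det 0F {j} {B₁} {F₁} refl
        (cong (λ l → if l then just (entry , coreI , itemBit (item j) 0F , false) else just (succ , datI topBit , itemBit (item j) 0F , true))
          (dec-false (toℕ j ℕ.≟ p₀) (<⇒≢ (subst (toℕ j <_) eq (m<m+n (toℕ j) (s≤s z≤n)))))) j₁≡))) D₂
    where
    rest = List.drop (toℕ j₁) allItems
    u = toList (rowBits (item j))
    join-bits : map bit (blockBits rest) ʳ++ (itemBit (item j) 0F ∷ B₁) ≡ map bit (blockBits (List.drop (toℕ j) allItems)) ʳ++ B
    join-bits = trans (cong (map bit (blockBits rest) ʳ++_) e) (trans (sym (Listₚ.++-ʳ++ (map bit u)))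
      (cong (_ʳ++ B) (trans (sym (Listₚ.map-++ bit u (blockBits rest))) (cong (map bit ∘ blockBits)
        (sym (trans (drop-tabulate item j) (cong (λ k → item j ∷ List.drop k allItems) (sym j₁≡))))))))

-- The printed word is the code

overFin : ∀ {X : Set} n → (Fin n → List X) → List X
overFin zero f = []
overFin (suc n) f = f 0F ++ overFin n (f ∘ Fin.suc)

module _ {X : Set} where

  overFin-cong : ∀ n {f g : Fin n → List X} → (∀ i → f i ≡ g i) → overFin n f ≡ overFin n g
  overFin-cong zero eq = refl
  overFin-cong (suc n) eq = cong₂ _++_ (eq 0F) (overFin-cong n (eq ∘ Fin.suc))

  overFin-[] : ∀ n {f : Fin n → List X} → (∀ i → f i ≡ []) → overFin n f ≡ []
  overFin-[] zero eq = refl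
  overFin-[] (suc n) eq = cong₂ _++_ (eq 0F) (overFin-[] n (eq ∘ Fin.suc))

  overFin-+ : ∀ m n (f : Fin (m + n) → List X) → overFin (m + n) f ≡ overFin m (λ i → f (i ↑ˡ n)) ++ overFin n (λ i → f (m ↑ʳ i))
  overFin-+ zero n f = refl
  overFin-+ (suc m) n f = trans (cong (f 0F ++_) (overFin-+ m n (f ∘ Fin.suc))) (sym (Listₚ.++-assoc (f 0F) _ _))

  -- Turns a loop over all states into one over items and one over modes.
  overFin-* : ∀ m n (f : Fin (m * n) → List X) → overFin (m * n) f ≡ overFin m (λ i → overFin n (λ j → f (combine i j)))
  overFin-* zero n f = refl
  overFin-* (suc m) n f = trans (overFin-+ n (m * n) f) (cong (overFin n (λ j → f (j ↑ˡ (m * n))) ++_) (overFin-* m n (λ k → f (n ↑ʳ k))))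

  concatMap-tabulate : ∀ {Y : Set} n (h : Y → List X) (f : Fin n → Y) → concatMap h (List.tabulate f) ≡ overFin n (h ∘ f)
  concatMap-tabulate zero h f = refl
  concatMap-tabulate (suc n) h f = cong (h (f 0F) ++_) (concatMap-tabulate n h (f ∘ Fin.suc))

  concatMap-allFin : ∀ n (h : Fin n → List X) → concatMap h (allFin n) ≡ overFin n h
  concatMap-allFin n h = concatMap-tabulate n h id

  overFin-const : ∀ n (x : X) k → overFin n (λ _ → replicate k x) ≡ replicate (n * k) x
  overFin-const zero x k = refl
  overFin-const (suc n) x k = trans (cong (replicate k x ++_) (overFin-const n x k)) (replicate-++ k (n * k))
    where
    replicate-++ : ∀ m n → replicate m x ++ replicate n x ≡ replicate (m + n) x
    replicate-++ zero n = refl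
    replicate-++ (suc m) n = cong (x ∷_) (replicate-++ m n)

  concatMap-cong′ : ∀ {Y : Set} {f g : Y → List X} → (∀ y → f y ≡ g y) → ∀ ys → concatMap f ys ≡ concatMap g ys
  concatMap-cong′ eq [] = refl
  concatMap-cong′ eq (y ∷ ys) = cong₂ _++_ (eq y) (concatMap-cong′ eq ys)

  concatMap-++ : ∀ {Y : Set} (f : Y → List X) ys zs → concatMap f (ys ++ zs) ≡ concatMap f ys ++ concatMap f zs
  concatMap-++ f [] zs = refl
  concatMap-++ f (y ∷ ys) zs = trans (cong (f y ++_) (concatMap-++ f ys zs)) (sym (Listₚ.++-assoc (f y) _ _))

-- Tokens, the bits they print, and the bits they consume from the stream.
data Match : List Tok → List Bool → List Bool → Set where
  []     : Match [] [] []
  lit    : ∀ {ts bs ss} b → Match ts bs ss → Match (lit b ∷ ts) (b ∷ bs) ss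
  stream : ∀ {ts bs ss} b → Match ts bs ss → Match (stream ∷ ts) (b ∷ bs) (b ∷ ss)

match-++ : ∀ {ts bs ss ts′ bs′ ss′} → Match ts bs ss → Match ts′ bs′ ss′ → Match (ts ++ ts′) (bs ++ bs′) (ss ++ ss′)
match-++ [] m′ = m′
match-++ (lit b m) m′ = lit b (match-++ m m′)
match-++ (stream b m) m′ = stream b (match-++ m m′)

match-over : ∀ n {f : Fin n → List Tok} {g h : Fin n → List Bool} → (∀ i → Match (f i) (g i) (h i)) → Match (overFin n f) (overFin n g) (overFin n h)
match-over zero m = []
match-over (suc n) m = match-++ (m 0F) (match-over n (m ∘ Fin.suc))

match-lits : ∀ bs → Match (map lit bs) bs []
match-lits [] = []
match-lits (b ∷ bs) = lit b (match-lits bs)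

consumed : Tok → Bool → List Bool
consumed (lit _) _ = []
consumed stream v = v ∷ []

match-one : ∀ t v → Match (t ∷ []) (tval t v ∷ []) (consumed t v)
match-one (lit b) v = lit b []
match-one stream v = stream v []

match-cong : ∀ {ts ts′ bs bs′ ss ss′} → ts ≡ ts′ → bs ≡ bs′ → ss ≡ ss′ → Match ts bs ss → Match ts′ bs′ ss′
match-cong refl refl refl m = m

does-toℕ : ∀ {n} (i j : Fin n) → does (i Fin.≟ j) ≡ does (toℕ i ℕ.≟ toℕ j)
does-toℕ 0F 0F = refl
does-toℕ 0F (Fin.suc j) = refl
does-toℕ (Fin.suc i) 0F = refl
does-toℕ (Fin.suc i) (Fin.suc j) = does-toℕ i j

module CoreStream (a b s₀ w₀ : ℕ) (rowBits : Item → Vec Bool (suc w₀)) (c₀ : ℕ)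
  (coreδ : Fin (suc c₀) → Γsym a b → Fin (suc c₀) → Γsym a b → Bool → Bool) where
  open Layout a b s₀ w₀ rowBits

  -- What a table entry consumes from the stream. Listed in printing order, these bits are the table
  -- of the core as the printer asks for it.
  fed : ∀ {r} → Fin (suc c₀) ⊎ Fin r → Fin modes → Γ → Fin (suc c₀) ⊎ Fin r → Fin modes → Γ → Bool → List Bool
  fed (inj₁ j) i x (inj₁ j′) i′ y e = if isCoreMode (mode i) ∧ does (i′ Fin.≟ coreI) then coreδ j x j′ y e ∷ [] else []
  fed _ _ _ _ _ _ _ = []

  fedRow : ∀ {r} → Fin (suc c₀) ⊎ Fin r → Fin modes → Γ → Fin (suc c₀) ⊎ Fin r → List Bool
  fedRow u i x v = overFin modes λ i′ → overFin G λ y → fed u i x v i′ y false ++ fed u i x v i′ y true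

  opaque
    coreStream : List Bool
    coreStream = overFin (suc c₀) λ j → overFin modes λ i → overFin G λ x → overFin (suc c₀) λ j′ → fedRow {0} (inj₁ j) i x (inj₁ j′)

  total : ℕ → List Bool
  total r = overFin (suc c₀ + r) λ j → overFin modes λ i → overFin G λ x → overFin (suc c₀ + r) λ j′ → fedRow (splitAt (suc c₀) j) i x (splitAt (suc c₀) {r} j′)

  private
    fedRow-[]ʳ : ∀ {r} u i x (k : Fin r) → fedRow u i x (inj₂ k) ≡ []
    fedRow-[]ʳ (inj₁ _) i x k = overFin-[] modes λ i′ → overFin-[] G λ y → refl
    fedRow-[]ʳ (inj₂ _) i x k = overFin-[] modes λ i′ → overFin-[] G λ y → refl

    fedRow-[]ˡ : ∀ {r} (k : Fin r) i x v → fedRow (inj₂ k) i x v ≡ []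
    fedRow-[]ˡ k i x (inj₁ _) = overFin-[] modes λ i′ → overFin-[] G λ y → refl
    fedRow-[]ˡ k i x (inj₂ _) = overFin-[] modes λ i′ → overFin-[] G λ y → refl

    split-over : ∀ r (h : Fin (suc c₀) ⊎ Fin r → List Bool) → (∀ k → h (inj₂ k) ≡ []) →
                 overFin (suc c₀ + r) (h ∘ splitAt (suc c₀)) ≡ overFin (suc c₀) (h ∘ inj₁)
    split-over r h e = trans (overFin-+ (suc c₀) r (h ∘ splitAt (suc c₀)))
      (trans (cong₂ _++_ (overFin-cong (suc c₀) λ i → cong h (Finₚ.splitAt-↑ˡ (suc c₀) i r))
                         (overFin-[] r λ k → trans (cong h (Finₚ.splitAt-↑ʳ (suc c₀) r k)) (e k)))
             (Listₚ.++-identityʳ _))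

  opaque
    unfolding coreStream
    -- Padding items are not core items and consume nothing. The stream is thus the same for every
    -- `r`, which allows `r` to be chosen after it.
    total-core : ∀ r → total r ≡ coreStream
    total-core r = trans
      (split-over r (λ u → overFin modes λ i → overFin G λ x → overFin (suc c₀ + r) λ j′ → fedRow u i x (splitAt (suc c₀) j′))
        (λ k → overFin-[] modes λ i → overFin-[] G λ x → overFin-[] (suc c₀ + r) λ j′ → fedRow-[]ˡ k i x (splitAt (suc c₀) j′)))
      (overFin-cong (suc c₀) λ j → overFin-cong modes λ i → overFin-cong G λ x →
        split-over r (λ v → fedRow (inj₁ j) i x v) (fedRow-[]ʳ (inj₁ j) i x))

opaque
  codeOf : ∀ {a b} → NTM1 a b → List Bool
  codeOf = code

  codeOf≡ : ∀ {a b} (M : NTM1 a b) → codeOf M ≡ code M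
  codeOf≡ M = refl

module Printing (N : MNTM) (a b s₀ w₀ : ℕ) (rowBits : Item → Vec Bool (suc w₀)) (c₀ r : ℕ)
  (coreδ : Fin (suc c₀) → Γsym a b → Fin (suc c₀) → Γsym a b → Bool → Bool)
  (entryJ : Fin (suc c₀)) (cs : List Bool) where
  open CoreStream a b s₀ w₀ rowBits c₀ coreδ
  open Phases a b s₀ w₀ rowBits c₀ r coreδ entryJ cs hiding (hd; at; at-0; at-tl)
  open Program N script

  codeBits : List Bool
  codeBits = codeOf M

  private
    zeros : ℕ → List A → List A
    zeros zero X = X
    zeros (suc k) X = zeroItem ∷ zeros k X

    zeros-shift : ∀ k X → zeros k (zeroItem ∷ X) ≡ zeroItem ∷ zeros k X
    zeros-shift zero X = refl
    zeros-shift (suc k) X = cong (zeroItem ∷_) (zeros-shift k X)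

    prev : ∀ {n} → Bool → (ℕ → Bool) → Fin n → Bool
    prev sc m 0F = sc
    prev sc m (Fin.suc i) = m (toℕ i)

    inner-over : ∀ κ oi sc {n} (f : Fin n → Item) xs → n ≤ length xs →
      innerToks κ oi sc (List.tabulate f) xs ≡ overFin n (λ i → toks κ oi (f i) (marked (at xs (toℕ i))) (prev sc (λ k → marked (at xs k)) i))
    inner-over κ oi sc {zero} f [] le = refl
    inner-over κ oi sc {zero} f (x ∷ xs) le = refl
    inner-over κ oi sc {suc n} f (x ∷ xs) (s≤s le) = cong (toks κ oi (f 0F) (marked x) sc ++_)
      (trans (inner-over κ oi (marked x) (f ∘ Fin.suc) xs le) (overFin-cong n λ { 0F → refl ; (Fin.suc i) → refl }))

    kind-over : ∀ κs oi is xs → kindToks κs oi is xs ≡ concatMap (λ κ → innerToks κ oi false is xs) κs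
    kind-over [] oi is xs = refl
    kind-over (κ ∷ κs) oi is xs = cong (innerToks κ oi false is xs ++_) (kind-over κs oi is xs)

    outer-over : ∀ {n} (f : Fin n → Item) is X →
      outerToks (List.tabulate f) is X ≡ overFin n (λ j → kindToks (hdr ∷ kinds) (f j) is (List.take (length is) (zeros (toℕ j) X)))
    outer-over {zero} f is X = refl
    outer-over {suc n} f is X = cong (kindToks (hdr ∷ kinds) (f 0F) is (List.take (length is) X) ++_) (trans (outer-over (f ∘ Fin.suc) is (zeroItem ∷ X))
      (overFin-cong n λ j → cong (λ l → kindToks (hdr ∷ kinds) (f (Fin.suc j)) is (List.take (length is) l)) (zeros-shift (toℕ j) X)))

    at-take : ∀ n (X : List A) i → i < n → at (List.take n X) i ≡ at X i
    at-take (suc n) [] i _ = refl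
    at-take (suc n) (x ∷ X) zero _ = refl
    at-take (suc n) (x ∷ X) (suc i) (s≤s le) = at-take n X i le

    at-items : ∀ {n} (f : Fin n → Item) i → at (items (List.tabulate f)) (toℕ i) ≡ inj₁ (f i)
    at-items f 0F = refl
    at-items f (Fin.suc i) = at-items (f ∘ Fin.suc) i

    -- k zeros in front of the item list, whose first item alone is marked, put the mark opposite
    -- item k.
    zeros-marks : ∀ k (i : ℕ) → i < P → marked (at (zeros k (items allItems)) i) ≡ does (i ℕ.≟ k)
    zeros-marks zero i lt = trans (cong (λ z → marked (at (items allItems) z)) (sym (Finₚ.toℕ-fromℕ< lt)))
      (trans (cong marked (at-items item (fromℕ< lt))) (trans (does-toℕ (fromℕ< lt) 0F) (cong (λ z → does (z ℕ.≟ 0)) (Finₚ.toℕ-fromℕ< lt))))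
    zeros-marks (suc k) zero lt = refl
    zeros-marks (suc k) (suc i) lt = zeros-marks k i (<-trans (n<1+n i) lt)

    length-zeros : ∀ k X → length X ≤ length (zeros k X)
    length-zeros zero X = ≤-refl
    length-zeros (suc k) X = m≤n⇒m≤1+n (length-zeros k X)

    length-all : length allItems ≡ P
    length-all = Listₚ.length-tabulate item

    toksAt : Fin P → Kind → Fin P → List Tok
    toksAt j κ j′ = toks κ (item j) (item j′) (does (j′ Fin.≟ j)) (isSucc j j′)

    allToks : outerToks allItems allItems (items allItems) ≡
              overFin P (λ j → concatMap (λ κ → overFin P (toksAt j κ)) (hdr ∷ kinds))
    allToks = trans (outer-over item allItems (items allItems)) (overFin-cong P λ j →
      trans (kind-over (hdr ∷ kinds) (item j) allItems (List.take (length allItems) (zeros (toℕ j) (items allItems)))) (concatMap-cong′ (λ κ → looped κ j) (hdr ∷ kinds)))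
      where
      looped : ∀ κ j → innerToks κ (item j) false allItems (List.take (length allItems) (zeros (toℕ j) (items allItems))) ≡ overFin P (toksAt j κ)
      looped κ j = trans (inner-over κ (item j) false item xs long) (overFin-cong P λ j′ →
        cong₂ (toks κ (item j) (item j′)) (trans (mark-at (toℕ j′) (Finₚ.toℕ<n j′)) (sym (does-toℕ j′ j))) (pv j′))
        where
        X = zeros (toℕ j) (items allItems)
        xs = List.take (length allItems) X
        mark-at : ∀ i → i < P → marked (at xs i) ≡ does (i ℕ.≟ toℕ j)
        mark-at i lt = trans (cong marked (at-take (length allItems) X i (subst (i <_) (sym length-all) lt))) (zeros-marks (toℕ j) i lt)
        pv : ∀ j′ → prev false (λ k → marked (at xs k)) j′ ≡ isSucc j j′
        pv 0F = refl
        pv (Fin.suc i) = mark-at (toℕ i) (<-trans (Finₚ.toℕ<n i) (n<1+n p₀))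
        long : P ≤ length xs
        long = ≤-reflexive (sym (trans (Listₚ.length-take (length allItems) X) (trans (m≤n⇒m⊓n≡m
          (≤-trans (≤-reflexive (sym (Listₚ.length-map inj₁ allItems))) (length-zeros (toℕ j) (items allItems)))) length-all)))

    columnsOver : ∀ {X : Set} (f : Fin modes → Γ → Bool → X) →
      columns f ≡ overFin modes λ i′ → overFin G λ y → f i′ y false ∷ f i′ y true ∷ []
    columnsOver f = trans (concatMap-allFin modes (λ i′ → concatMap (pair i′) (allFin G))) (overFin-cong modes λ i′ → concatMap-allFin G (pair i′))
      where
      pair : Fin modes → Γ → List _
      pair i′ y = map (f i′ y) (false ∷ true ∷ [])

    bitsRow : Fin P → Fin modes → Γ → Fin P → List Bool
    bitsRow j i x j′ = overFin modes λ i′ → overFin G λ y → map (δM (st j i) x (st j′ i′) y) (false ∷ true ∷ [])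

    consumed-fed : ∀ j i x j′ i′ y e → consumed (tokOf j i x j′ i′ y e) (coreBit (splitAt (suc c₀) j) x (splitAt (suc c₀) j′) y e) ≡
                   fed (splitAt (suc c₀) j) i x (splitAt (suc c₀) j′) i′ y e
    consumed-fed j i x j′ i′ y e = byCases (splitAt (suc c₀) j) (splitAt (suc c₀) j′) ((isFirst (item j′) ∧ does (i′ Fin.≟ rejI)) ∨ hits (goal (mode i) x (item j)) (item j′) (does (j′ Fin.≟ j)) (isSucc j j′) i′ y e)
      where
      byCases : ∀ u v L → consumed (if (isCoreMode (mode i) ∧ fromSum u) ∧ (fromSum v ∧ does (i′ Fin.≟ coreI)) then stream else lit L)
                                   (coreBit u x v y e) ≡ fed u i x v i′ y e
      byCases (inj₁ _) (inj₁ _) L with isCoreMode (mode i) | does (i′ Fin.≟ coreI)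
      ... | true | true = refl
      ... | true | false = refl
      ... | false | _ = refl
      byCases (inj₁ _) (inj₂ _) L with isCoreMode (mode i)
      ... | true = refl
      ... | false = refl
      byCases (inj₂ _) v L with isCoreMode (mode i)
      ... | true = refl
      ... | false = refl

    opaque
      unfolding toks
      match-row : ∀ j i x j′ → Match (toksAt j (row i x) j′) (bitsRow j i x j′) (fedRow (splitAt (suc c₀) j) i x (splitAt (suc c₀) j′))
      match-row j i x j′ = match-cong (sym (columnsOver (tokOf j i x j′))) refl refl
        (match-over modes λ i′ → match-over G λ y → match-++ (single i′ y false) (single i′ y true))
        where
        single : ∀ i′ y e → Match (tokOf j i x j′ i′ y e ∷ []) (δM (st j i) x (st j′ i′) y e ∷ []) (fed (splitAt (suc c₀) j) i x (splitAt (suc c₀) j′) i′ y e)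
        single i′ y e = match-cong refl (cong (_∷ []) (sym (δM-st j i x j′ i′ y e))) (consumed-fed j i x j′ i′ y e) (match-one (tokOf j i x j′ i′ y e) (coreBit (splitAt (suc c₀) j) x (splitAt (suc c₀) j′) y e))

    bitsRows : Fin P → List Bool
    bitsRows j = overFin modes λ i → overFin G λ x → overFin P (bitsRow j i x)

    fedRows : Fin P → List Bool
    fedRows j = overFin modes λ i → overFin G λ x → overFin P λ j′ → fedRow (splitAt (suc c₀) j) i x (splitAt (suc c₀) j′)

    match-rows : ∀ j → Match (concatMap (λ κ → overFin P (toksAt j κ)) rowKinds) (bitsRows j) (fedRows j)
    match-rows j = match-cong (sym (rows-over (λ κ → overFin P (toksAt j κ)))) refl refl
      (match-over modes λ i → match-over G λ x → match-over P λ j′ → match-row j i x j′)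
      where
      concatMap-concatMap : ∀ {Y Z : Set} (h : Z → List Tok) (f : Y → List Z) ys → concatMap h (concatMap f ys) ≡ concatMap (λ y → concatMap h (f y)) ys
      concatMap-concatMap h f [] = refl
      concatMap-concatMap h f (y ∷ ys) = trans (concatMap-++ h (f y) (concatMap f ys)) (cong (concatMap h (f y) ++_) (concatMap-concatMap h f ys))
      rows-over : (h : Kind → List Tok) → concatMap h rowKinds ≡ overFin modes λ i → overFin G λ x → h (row i x)
      rows-over h = trans (concatMap-concatMap h (λ i → map (row i) (allFin G)) (allFin modes))
        (trans (concatMap-allFin modes (λ i → concatMap h (map (row i) (allFin G))))
          (overFin-cong modes λ i → trans (cong (concatMap h) (Listₚ.map-tabulate id (row i))) (concatMap-tabulate G h (row i))))

    headBits : Fin P → List Bool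
    headBits 0F = replicate (P * modes) true ++ header
    headBits (Fin.suc _) = []

    opaque
      unfolding toks
      match-head : ∀ j → Match (overFin P (toksAt j hdr) ++ concatMap (λ κ → overFin P (toksAt j κ)) (map char header)) (headBits j) []
      match-head 0F = match-++ ones (chars header)
        where
        ones : Match (overFin P (toksAt 0F hdr)) (replicate (P * modes) true) []
        ones = match-cong (trans (Listₚ.map-replicate lit (P * modes) true) (sym (overFin-const P (lit true) modes))) refl refl (match-lits (replicate (P * modes) true))
        one-char : ∀ x → overFin P (toksAt 0F (char x)) ≡ lit x ∷ []
        one-char x = cong (lit x ∷_) (overFin-[] p₀ λ i → refl)
        chars : ∀ xs → Match (concatMap (λ κ → overFin P (toksAt 0F κ)) (map char xs)) xs []
        chars [] = []
        chars (x ∷ xs) = match-cong (cong (_++ concatMap (λ κ → overFin P (toksAt 0F κ)) (map char xs)) (sym (one-char x))) refl refl (lit x (chars xs))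
      match-head (Fin.suc j) = match-cong (sym (cong₂ _++_ (overFin-[] P λ i → refl) (chars header))) refl refl []
        where
        chars : ∀ xs → concatMap (λ κ → overFin P (toksAt (Fin.suc j) κ)) (map char xs) ≡ []
        chars [] = refl
        chars (x ∷ xs) = cong₂ _++_ (overFin-[] P λ i → refl) (chars xs)

    opaque
      unfolding kinds
      match-item : ∀ j → Match (concatMap (λ κ → overFin P (toksAt j κ)) (hdr ∷ kinds)) (headBits j ++ bitsRows j) (fedRows j)
      match-item j = match-cong (trans (Listₚ.++-assoc (overFin P (toksAt j hdr)) (concatMap (λ κ → overFin P (toksAt j κ)) (map char header)) (concatMap (λ κ → overFin P (toksAt j κ)) rowKinds))
          (cong (overFin P (toksAt j hdr) ++_) (sym (concatMap-++ (λ κ → overFin P (toksAt j κ)) (map char header) rowKinds)))) refl refl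
        (match-++ (match-head j) (match-rows j))

    -- The header is printed in the outer round of item 0, before its rows; all later rounds print
    -- rows only, in the order of the code.
    code-eq : overFin P (λ j → headBits j ++ bitsRows j) ≡ code M
    code-eq = trans (cong ((headBits 0F ++ bitsRows 0F) ++_) refl)
      (trans (Listₚ.++-assoc (headBits 0F) (bitsRows 0F) (overFin p₀ (bitsRows ∘ Fin.suc)))
        (trans (cong (headBits 0F ++_) (sym table)) heads))
      where
      Δ : List Bool
      Δ = concatMap (λ p → concatMap (λ x → concatMap (λ p′ → concatMap (λ y → map (δM p x p′ y) (false ∷ true ∷ []))
            (allFin _)) (allFin (P * modes))) (allFin _)) (allFin (P * modes))
      over-states : ∀ (h : Fin (P * modes) → List Bool) → concatMap h (allFin (P * modes)) ≡ overFin P λ j → overFin modes λ i → h (st j i)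
      over-states h = trans (concatMap-allFin (P * modes) h) (overFin-* P modes h)
      entry₀ : Fin (P * modes) → Γ → Fin (P * modes) → Γ → List Bool
      entry₀ p x p′ y = map (δM p x p′ y) (false ∷ true ∷ [])
      entry₁ : Fin (P * modes) → Γ → Fin (P * modes) → List Bool
      entry₁ p x p′ = concatMap (entry₀ p x p′) (allFin G)
      entry₂ : Fin (P * modes) → Γ → List Bool
      entry₂ p x = concatMap (entry₁ p x) (allFin (P * modes))
      entry₃ : Fin (P * modes) → List Bool
      entry₃ p = concatMap (entry₂ p) (allFin G)
      table : Δ ≡ overFin P bitsRows
      table = trans (over-states entry₃) (overFin-cong P λ j → overFin-cong modes λ i →
        trans (concatMap-allFin G (entry₂ (st j i))) (overFin-cong G λ x →
        trans (over-states (entry₁ (st j i) x)) (overFin-cong P λ j′ → overFin-cong modes λ i′ →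
        concatMap-allFin G (entry₀ (st j i) x (st j′ i′)))))
      toℕ-st : ∀ i → toℕ (st 0F i) ≡ toℕ i
      toℕ-st i = Finₚ.toℕ-↑ˡ i (p₀ * modes)
      heads : headBits 0F ++ Δ ≡ code M
      heads = trans (prefix (P * modes) Δ) (cong (λ z → unary (P * modes) ++ unary z ++ unary 2 ++ unary 1 ++ Δ) start≡)
        where
        start≡ : 3 + s₀ ≡ toℕ (st 0F (cntI firstPass))
        start≡ = sym (trans (toℕ-st (cntI firstPass)) (cong (3 +_) (trans (Finₚ.toℕ-↑ˡ firstPass (suc w₀)) (Finₚ.toℕ-fromℕ s₀))))
        prefix : ∀ n D → (replicate n true ++ header) ++ D ≡ unary n ++ unary (3 + s₀) ++ unary 2 ++ unary 1 ++ D
        prefix n D = trans (Listₚ.++-assoc (replicate n true) header D)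
          (trans (cong (replicate n true ++_) (cong (false ∷_) (trans (Listₚ.++-assoc (unary (3 + s₀)) (unary 2 ++ unary 1) D)
                   (cong (unary (3 + s₀) ++_) (Listₚ.++-assoc (unary 2) (unary 1) D)))))
            (sym (Listₚ.++-assoc (replicate n true) (false ∷ []) (unary (3 + s₀) ++ unary 2 ++ unary 1 ++ D))))

    match-all : Match (outerToks allItems allItems (items allItems)) codeBits coreStream
    match-all = match-cong (sym allToks) (trans code-eq (sym (codeOf≡ M))) (total-core r) (match-over P match-item)

    match-fits : ∀ {ts bs ss} → Match ts bs ss → ∀ S {rest} → map bitOf S ≡ ss ++ rest → ∃ (Fits ts S bs)
    match-fits [] S eq = S , []
    match-fits (lit b m) S eq with match-fits m S eq
    ... | S′ , F = S′ , lit b F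
    match-fits (stream b m) (s ∷ S) eq with match-fits m S (Listₚ.∷-injectiveʳ eq)
    ... | S′ , F = S′ , subst (λ z → Fits _ _ (z ∷ _) S′) (Listₚ.∷-injectiveˡ eq) (stream s F)

    tabulate-prefix : ∀ n bs → length bs ≤ n → ∃ λ rest → List.tabulate {n = n} (λ i → nthBit bs (toℕ i)) ≡ bs ++ rest
    tabulate-prefix n [] le = _ , refl
    tabulate-prefix (suc n) (x ∷ bs) (s≤s le) with tabulate-prefix n bs le
    ... | rest , eq = rest , cong (x ∷_) eq

  -- The bits on the items are the stream followed by padding, so the printer never runs out of
  -- them.
  fits-code : cs ≡ coreStream → length cs ≤ P → ∃ (Fits (outerToks allItems allItems (items allItems)) (items allItems) codeBits)
  fits-code eq le with tabulate-prefix P cs le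
  ... | rest , e = match-fits match-all (items allItems) (trans (sym (Listₚ.map-∘ allItems))
    (trans (Listₚ.map-tabulate item (bitOf ∘ inj₁)) (trans e (cong (_++ rest) eq))))

-- Makes the number of core items a successor, so that there is an item 0 for every `r`.
finPad : ∀ {X : Set} → X → Finite X → Finite X
finPad {X} x₀ F = record { card = suc (Finite.card F) ; to = Fin.suc ∘ Finite.to F ; from = f ; from-to = Finite.from-to F }
  where
  f : Fin (suc (Finite.card F)) → X
  f 0F = x₀
  f (Fin.suc i) = Finite.from F i

-- Assembling the machine

module CoreTable (SM : StackMachine) (a b : ℕ) where
  open Core SM using (CS; loop; entry; finCS; cstep; allowed; pcOf)

  finCore : Finite CS
  finCore = finPad loop finCS

  private module FC = Finite finCore

  c₀ : ℕ
  c₀ = Finite.card finCS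

  matches : CS × Maybe Bool × Bool → Fin (suc c₀) → Γsym a b → Bool → Bool
  matches (S , y₀ , e₀) j y e = does (j Fin.≟ FC.to S) ∧ (does (y Fin.≟ symbol a b y₀) ∧ does (e Boolₚ.≟ e₀))

  enabled : CS → Maybe Bool → CS → Fin (suc c₀) → Γsym a b → Bool → Bool
  enabled S x S′ j′ y e = allowed S x (pcOf S′) ∧ matches (cstep S x (pcOf S′)) j′ y e

  coreδ : Fin (suc c₀) → Γsym a b → Fin (suc c₀) → Γsym a b → Bool → Bool
  coreδ j x j′ y e = enabled (FC.from j) (cellOf a b x) (FC.from j′) j′ y e

  coreδ-fwd : ∀ S x S′ y e → allowed S (cellOf a b x) (pcOf S′) ≡ true →
    cstep S (cellOf a b x) (pcOf S′) ≡ (S′ , y , e) → coreδ (FC.to S) x (FC.to S′) (symbol a b y) e ≡ true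
  coreδ-fwd S x S′ y e al cs = trans (cong₂ (λ U V → enabled U (cellOf a b x) V (FC.to S′) (symbol a b y) e) (FC.from-to S) (FC.from-to S′))
    (∧-intro al (trans (cong (λ z → matches z (FC.to S′) (symbol a b y) e) cs)
      (∧-intro (does-≡ (FC.to S′)) (∧-intro (does-≡ (symbol a b y)) (dec-true (e Boolₚ.≟ e) refl)))))

  matches-inv : ∀ z j y e → matches z j y e ≡ true → j ≡ FC.to (proj₁ z) × y ≡ symbol a b (proj₁ (proj₂ z)) × e ≡ proj₂ (proj₂ z)
  matches-inv (S , y₀ , e₀) j y e t with ∧-true t
  ... | t₁ , t′ with ∧-true t′
  ... | t₂ , t₃ = does⇒ (j Fin.≟ FC.to S) t₁ , does⇒ (y Fin.≟ symbol a b y₀) t₂ , does⇒ (e Boolₚ.≟ e₀) t₃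

  coreδ-bwd : ∀ S x j′ y e → coreδ (FC.to S) x j′ y e ≡ true →
    ∃₂ λ S′ y′ → allowed S (cellOf a b x) (pcOf S′) ≡ true ×
      cstep S (cellOf a b x) (pcOf S′) ≡ (S′ , y′ , e) × j′ ≡ FC.to S′ × y ≡ symbol a b y′
  coreδ-bwd S x j′ y e t
    with ∧-true (trans (cong (λ U → enabled U (cellOf a b x) (FC.from j′) j′ y e) (sym (FC.from-to S))) t)
  ... | al , t′ with matches-inv (cstep S (cellOf a b x) (pcOf (FC.from j′))) j′ y e t′
  ... | j≡ , y≡ , e≡ = FC.from j′ , proj₁ (proj₂ next) , al , cong₂ _,_ (sym S≡) (cong (proj₁ (proj₂ next) ,_) (sym e≡)) , trans j≡ (cong FC.to (sym S≡)) , y≡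
    where
    next : CS × Maybe Bool × Bool
    next = cstep S (cellOf a b x) (pcOf (FC.from j′))
    S≡ : FC.from j′ ≡ proj₁ next
    S≡ = trans (cong FC.from j≡) (FC.from-to (proj₁ next))

module Assembly (N : MNTM) (a b s₀ : ℕ) where
  open Alphabet N
  open MNTM N using (k; m)
  open Coding finA dflt using (width; encRow)

  private
    suc-form : ∀ n → Fin n → ∃ λ n′ → n ≡ suc n′
    suc-form (suc n) _ = n , refl

    W-suc : ∃ λ w → K * width ≡ suc w
    W-suc = suc-form (K * width) (combine {K} 0F (Finite.to finA dflt))

  abstract
    w₀ : ℕ
    w₀ = proj₁ W-suc

    W≡ : K * width ≡ suc w₀
    W≡ = proj₂ W-suc

  -- Outer loop, inner loop, marker and stream all start as the list of items, so one row per item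
  -- lays out all of them at once.
  rowOf : Item → Vec A K
  rowOf it = inj₁ it ∷ inj₁ it ∷ dflt ∷ inj₁ it ∷ dflt ∷ inj₁ it ∷ Vec.replicate (2 + k * 2) dflt

  private
    toList-subst : ∀ {X : Set} {m n} (eq : m ≡ n) (u : Vec X m) → toList (subst (Vec X) eq u) ≡ toList u
    toList-subst refl u = refl

  opaque
    rowBits : Item → Vec Bool (suc w₀)
    rowBits it = subst (Vec Bool) W≡ (encRow (rowOf it))

    rowBits-toList : ∀ it → toList (rowBits it) ≡ toList (encRow (rowOf it))
    rowBits-toList it = toList-subst W≡ (encRow (rowOf it))

  private module Lay = Layout a b s₀ w₀ rowBits
  open Runner N Lay.script using (SM; begin; initial; restStacks; blankTape; flat; printTime)
  open Core SM using (CS; entry; cstep; allowed; pcOf)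
  private module Table = CoreTable SM a b

  opaque
    c₀ : ℕ
    c₀ = Table.c₀

    stateIndex : CS → Fin (suc c₀)
    stateIndex = Finite.to Table.finCore

    entryIndex : Fin (suc c₀)
    entryIndex = stateIndex entry

    entryIndex≡ : entryIndex ≡ stateIndex entry
    entryIndex≡ = refl

    coreδ : Fin (suc c₀) → Γsym a b → Fin (suc c₀) → Γsym a b → Bool → Bool
    coreδ = Table.coreδ

    coreδ-fwd : ∀ S x S′ y e → allowed S (cellOf a b x) (pcOf S′) ≡ true →
      cstep S (cellOf a b x) (pcOf S′) ≡ (S′ , y , e) → coreδ (stateIndex S) x (stateIndex S′) (symbol a b y) e ≡ true
    coreδ-fwd = Table.coreδ-fwd

    coreδ-bwd : ∀ S x j′ y e → coreδ (stateIndex S) x j′ y e ≡ true →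
      ∃₂ λ S′ y′ → allowed S (cellOf a b x) (pcOf S′) ≡ true ×
        cstep S (cellOf a b x) (pcOf S′) ≡ (S′ , y′ , e) × j′ ≡ stateIndex S′ × y ≡ symbol a b y′
    coreδ-bwd = Table.coreδ-bwd

  open CoreStream a b s₀ w₀ rowBits c₀ coreδ using (coreStream) public

  module Sized (r : ℕ) (enough : length coreStream ≤ suc c₀ + r) where
    open Phases a b s₀ w₀ rowBits c₀ r coreδ entryIndex coreStream public hiding (entry)

    private
      emb : CS → Fin (P * modes)
      emb S = coreSt (stateIndex S)

    embedding : Embedding SM M
    embedding = record
      { emb = emb
      ; emb≢acc = λ S → st≢ (stateIndex S ↑ˡ r) 0F λ ()
      ; emb≢rej = λ S → st≢ (stateIndex S ↑ˡ r) 0F λ ()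
      ; core-fwd = λ S x S′ y e al cs → coreSt-fwd (stateIndex S) x (stateIndex S′) (symbol a b y) e (coreδ-fwd S x S′ y e al cs)
      ; core-bwd = λ S x p y e tr → [ inj₁ , (λ (j′ , p≡ , t) → inj₂ (let (S′ , y′ , al , cs , j≡ , y≡) = coreδ-bwd S x j′ y e t in
          S′ , y′ , al , cs , trans p≡ (cong coreSt j≡) , y≡)) ]′ (coreSt-bwd (stateIndex S) x p y e tr) }

    open Exec N Lay.script M embedding using (trips; trips-≤; accepted⇒loops; long⇒accepted)
    open Sim SM M embedding using (Home; at-home; rowsCells; entry-walk; resolve-entry; tripTail)
    open Rows dflt using (Stores; blanks; col)
    open HalfTape dflt using () renaming (at to atA)

    private
      bit : Bool → Γ
      bit = bitSymbol a b

      rows-bits : ∀ is → rowsCells (map rowOf is) ≡ map bit (blockBits is)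
      rows-bits [] = refl
      rows-bits (i ∷ is) = trans (cong₂ _++_ (cong (map bit) (sym (rowBits-toList i))) (rows-bits is)) (sym (Listₚ.map-++ bit (toList (rowBits i)) (blockBits is)))

      bits-length : ∀ is → length (blockBits is) ≡ length is * suc w₀
      bits-length [] = refl
      bits-length (i ∷ is) = trans (Listₚ.length-++ (toList (rowBits i))) (cong₂ _+_ (Vecₚ.length-toList (rowBits i)) (bits-length is))

      const-col : ∀ (is : List Item) (f : Item → A) → (∀ it → f it ≡ dflt) → ∀ i → atA (dflt ∷ map f is) i ≡ dflt
      const-col is f eq zero = refl
      const-col [] f eq (suc i) = refl
      const-col (it ∷ is) f eq (suc zero) = eq it
      const-col (it ∷ is) f eq (suc (suc i)) = const-col is f eq (suc i)

      single-blank : ∀ i → atA (dflt ∷ []) i ≡ dflt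
      single-blank zero = refl
      single-blank (suc i) = refl

      rest-blank : ∀ k (j : Fin (k * 2)) i → atA (lookup (flat (Vec.replicate k blankTape)) j) i ≡ dflt
      rest-blank (suc k) 0F i = refl
      rest-blank (suc k) 1F i = refl
      rest-blank (suc k) (Fin.suc (Fin.suc j)) i = rest-blank k j i

      stores-initial : ∀ is → Stores (blanks K) (map rowOf is) (initial is Vec.++ restStacks)
      stores-initial is = stored
        where
        present : ∀ j → (∀ it → lookup (rowOf it) j ≡ inj₁ it) → ∀ i → atA (dflt ∷ col j (map rowOf is)) i ≡ atA (dflt ∷ map inj₁ is) i
        present j eq i = cong (λ l → atA (dflt ∷ l) i) (trans (sym (Listₚ.map-∘ is)) (Listₚ.map-cong eq is))
        absent : ∀ j → (∀ it → lookup (rowOf it) j ≡ dflt) → ∀ i → atA (dflt ∷ col j (map rowOf is)) i ≡ atA (dflt ∷ []) i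
        absent j eq i = trans (cong (λ l → atA (dflt ∷ l) i) (sym (Listₚ.map-∘ is))) (trans (const-col is _ eq i) (sym (single-blank i)))
        stored : Stores (blanks K) (map rowOf is) (initial is Vec.++ restStacks)
        stored 0F = present 0F λ _ → refl
        stored 1F = present 1F λ _ → refl
        stored 2F = absent 2F λ _ → refl
        stored 3F = present 3F λ _ → refl
        stored 4F = absent 4F λ _ → refl
        stored 5F = present 5F λ _ → refl
        stored 6F = absent 6F λ _ → refl
        stored 7F = absent 7F λ _ → refl
        stored (Fin.suc (Fin.suc (Fin.suc (Fin.suc (Fin.suc (Fin.suc (Fin.suc (Fin.suc j)))))))) i =
          trans (cong₂ (λ d l → atA (d ∷ l) i) (Vecₚ.lookup-replicate j dflt) (sym (Listₚ.map-∘ is)))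
            (trans (const-col is _ (λ _ → Vecₚ.lookup-replicate j dflt) i) (sym (rest-blank k j i)))

      length-all : length allItems ≡ P
      length-all = Listₚ.length-tabulate item

      nonempty : ∀ {X : Set} {n} (l : List X) → length l ≡ suc n → ∃₂ λ z zs → l ≡ z ∷ zs × length zs ≡ n
      nonempty (z ∷ zs) eq = z , zs , refl , suc-injective eq

    opaque
      -- Once over the data to write them, once back to reach the home blank.
      writeTime : ℕ
      writeTime = P * suc w₀ + P * suc w₀

      writeTime≡ : writeTime ≡ P * suc w₀ + P * suc w₀
      writeTime≡ = refl

    AtHome : ZConf → Set
    AtHome c = ∃₂ λ n c′ → n ≤ writeTime × Det n c c′ × Home P begin (initial allItems Vec.++ restStacks) c′

    private
      walk-home : ∀ {y B B₁ F₁ z zs c} → y ∷ B₁ ≡ bit z ∷ (map bit zs ++ B) → List.reverse (blockBits allItems) ≡ z ∷ zs →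
        length zs ≡ w₀ + p₀ * suc w₀ → hd B ≡ blank a b → Blank F₁ →
        Det (P * suc w₀) c (coreSt entryIndex , false , y ∷ F₁ , B₁) → AtHome c
      walk-home {B = B} {F₁ = F₁} {z} {zs} refl rev len B-hd bF₁ D =
        P * suc w₀ + length zs , _ , ≤-trans (+-monoʳ-≤ (P * suc w₀) (≤-trans (≤-reflexive len) (n≤1+n _))) (≤-reflexive (sym writeTime≡)) ,
        det-trans (det-to (cong (λ j → coreSt j , false , bit z ∷ F₁ , map bit zs ++ B) entryIndex≡) D) (entry-walk zs {bit z ∷ F₁} {B}) ,
        at-home {rs = map rowOf allItems} (cong (λ l → emb entry , false , l , B) final) B-hd bF₁
          (subst (λ t → Stores t (map rowOf allItems) (initial allItems Vec.++ restStacks)) (sym (resolve-entry (idle (Core.W SM)))) (stores-initial allItems))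
          (trans (Listₚ.length-map rowOf allItems) length-all)
        where
        final : map bit zs ʳ++ (bit z ∷ F₁) ≡ rowsCells (map rowOf allItems) ++ F₁
        final = trans (cong (λ l → map bit l ʳ++ F₁) (sym rev))
          (trans (cong (_ʳ++ F₁) (Listₚ.reverse-map bit (blockBits allItems)))
            (trans (Listₚ.ʳ++-defn (List.reverse (map bit (blockBits allItems))))
              (cong (_++ F₁) (trans (Listₚ.reverse-involutive (map bit (blockBits allItems))) (sym (rows-bits allItems))))))

    data-home : ∀ {c} → DataAt c → AtHome c
    data-home (data-at {B} {F} refl B-hd bF) =
      let (y , B₁ , F₁ , bF₁ , eq , D) = write-items p₀ 0F {B} {F} refl bF
          (z , zs , rev , len) = nonempty {n = w₀ + p₀ * suc w₀} (List.reverse (blockBits allItems))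
            (trans (Listₚ.length-reverse (blockBits allItems)) (trans (bits-length allItems) (cong (_* suc w₀) length-all)))
      in walk-home (trans eq (trans (Listₚ.ʳ++-defn (map bit (blockBits allItems)))
           (trans (cong (_++ B) (sym (Listₚ.reverse-map bit (blockBits allItems)))) (cong (λ l → map bit l ++ B) rev)))) rev len B-hd bF₁ D

    open Printing N a b s₀ w₀ rowBits c₀ r coreδ entryIndex coreStream using (codeBits) public

    private
      fits = Printing.fits-code N a b s₀ w₀ rowBits c₀ r coreδ entryIndex coreStream refl enough

    accepts⇒endless : Accepts N (codeBits) → ∀ {n} → suc n ≡ P ^ suc s₀ → (w : Vec (Σsym a) n) → ∀ l → ∃ (Steps1 M l (init1 M w))
    accepts⇒endless acc {n} eq w l =
      let (c₁ , ss₁ , A) = passes-fwd s₀ (Finₚ.toℕ-fromℕ s₀) (subst (λ u → PassAt firstPass n u (zinit w)) eq (start-pass w))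
          (n₂ , c₂ , _ , D₂ , H) = data-home A
          (c₃ , ss₃) = accepted⇒loops (proj₂ fits) H acc l
          (_ , ss) = ztruncate l (subst (λ j → ZSteps j (zinit w) c₃) (+-comm (suc s₀ * suc n + n₂) l) ((ss₁ +++ run D₂) +++ ss₃))
      in to-steps (zinit-rep w) ss

    first-pass : ∀ {n} (w : Vec (Σsym a) n) {c} → Steps1 M (suc n + 1) (init1 M w) c → ∃ λ u → suc n ≡ P * u
    first-pass {n} w ss =
      [ (λ (u , _ , eq , _) → u , eq) , (λ (_ , stops) → ⊥-elim (stops (proj₂ (from-steps (zinit-rep w) ss)))) ]′ (pass (start-pass w))

    all-passes : ∀ {n} (w : Vec (Σsym a) n) {c} → Steps1 M (suc s₀ * suc n + 1) (init1 M w) c → ∃ λ u → suc n ≡ P ^ suc s₀ * u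
    all-passes {n} w ss =
      let (c₀ , zs) = from-steps {suc s₀ * suc n + 1} (zinit-rep w) ss
          (u , _ , eq , _) = passes-bwd s₀ {firstPass} {n} {suc n} {j = 0} (Finₚ.toℕ-fromℕ s₀) (start-pass w) zs
      in u , eq

    opaque
      simTime : ℕ → ℕ
      simTime t = trips (printTime P (length codeBits) + suc t) P + 1

      simTime≡ : ∀ t → simTime t ≡ trips (printTime P (length codeBits) + suc t) P + 1
      simTime≡ t = refl

    private
      rearrange : ∀ k m n → k ≤ m → suc (m + n) ≡ (k + suc n) + (m ∸ k)
      rearrange k m n le = trans (sym (+-suc m n)) (trans (cong (_+ suc n) (sym (m+[n∸m]≡n le)))
        (trans (+-assoc k (m ∸ k) (suc n)) (trans (cong (k +_) (+-comm (m ∸ k) (suc n))) (sym (+-assoc k (suc n) (m ∸ k))))))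

      home⇒accepts : ∀ {t c c″} → TimeBound N codeBits t → Home P begin (initial allItems Vec.++ restStacks) c → ∀ s → s ≡ simTime t → ZSteps s c c″ → Accepts N codeBits
      home⇒accepts {t} {c} {c″} tb H s eq ss = long⇒accepted (proj₂ fits) H tb
        (subst (λ l → ZSteps l c c″) (trans eq (trans (simTime≡ t) (cong (λ l → trips (printTime l (length codeBits) + suc t) P + 1) (sym length-all)))) ss)

      data⇒accepts : ∀ {t c c″} → TimeBound N codeBits t → DataAt c → ∀ m s → m ≡ writeTime → s ≡ simTime t →
        ZSteps (suc (m + s)) c c″ → Accepts N codeBits
      data⇒accepts {t} {c} {c″} tb A m s m≡ s≡ ss =
        let (n₂ , c₂ , n₂≤ , D₂ , H) = data-home A
            (c₃ , ss₂) = ztruncate (n₂ + suc s) {m ∸ n₂} (subst (λ j → ZSteps j c c″) (rearrange n₂ m s (≤-trans n₂≤ (≤-reflexive (sym m≡)))) ss)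
            (c₄ , ss₃) = ztruncate s {1} (subst (λ j → ZSteps j c₂ c₃) (+-comm 1 s) (follow D₂ {s} ss₂))
        in home⇒accepts tb H s s≡ ss₃

      start⇒accepts : ∀ {t n} → TimeBound N codeBits t → (w : Vec (Σsym a) n) → ∀ m s → m ≡ writeTime → s ≡ simTime t → ∀ {c} →
        Steps1 M (suc s₀ * suc n + suc (m + s)) (init1 M w) c → (∃ λ u → suc n ≡ P ^ suc s₀ * u) × Accepts N codeBits
      start⇒accepts {t} {n} tb w m s m≡ s≡ ss =
        let (c₀ , zs) = from-steps {suc s₀ * suc n + suc (m + s)} (zinit-rep w) ss
            (u , c₁ , eq , A , zs₁) = passes-bwd s₀ {firstPass} {n} {suc n} {j = m + s} (Finₚ.toℕ-fromℕ s₀) (start-pass w) zs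
        in (u , eq) , data⇒accepts tb A m s m≡ s≡ zs₁

    long⇒accepts : ∀ {t n} → TimeBound N codeBits t → (w : Vec (Σsym a) n) → ∀ {c} →
      Steps1 M (suc s₀ * suc n + suc (writeTime + simTime t)) (init1 M w) c → (∃ λ u → suc n ≡ P ^ suc s₀ * u) × Accepts N codeBits
    long⇒accepts {t} tb w = start⇒accepts tb w writeTime (simTime t) refl refl

    steps# : ℕ → ℕ
    steps# t = printTime P (length codeBits) + suc t

    simTime-≤ : ∀ t → simTime t ≤ steps# t * suc (tripTail (P + steps# t)) + 1
    simTime-≤ t = ≤-trans (≤-reflexive (simTime≡ t)) (+-monoˡ-≤ 1 (trips-≤ (steps# t) P))

-- Time bounds up to constants

private
  concatMap-const : ∀ {X Y : Set} n (f : X → List Y) → (∀ x → length (f x) ≡ n) → ∀ xs → length (concatMap f xs) ≡ length xs * n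
  concatMap-const n f eq [] = refl
  concatMap-const n f eq (x ∷ xs) = trans (Listₚ.length-++ (f x)) (cong₂ _+_ (eq x) (concatMap-const n f eq xs))

  over-all : ∀ {Y : Set} m n (f : Fin m → List Y) → (∀ x → length (f x) ≡ n) → length (concatMap f (allFin m)) ≡ m * n
  over-all m n f eq = trans (concatMap-const n f eq (allFin m)) (cong (_* n) (Listₚ.length-tabulate {n = m} id))

  unary-≤ : ∀ {m n} → m ≤ n → length (unary m) ≤ suc n
  unary-≤ {m} le = ≤-trans (≤-reflexive (trans (Listₚ.length-++ (replicate m true)) (trans (cong (_+ 1) (Listₚ.length-replicate m)) (+-comm m 1)))) (s≤s le)

  append-≤ : ∀ (xs ys : List Bool) {m n} → length xs ≤ m → length ys ≤ n → length (xs ++ ys) ≤ m + n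
  append-≤ xs ys p q = ≤-trans (≤-reflexive (Listₚ.length-++ xs)) (+-mono-≤ p q)

code-length : ∀ {a b} (M : NTM1 a b) → let q = NTM1.q M ; g = 2 + a + suc b in
  length (code M) ≤ suc q + (suc q + (suc q + (suc q + q * (g * (q * (g * 2))))))
code-length {a} {b} M = append-≤ (unary q) _ (unary-≤ ≤-refl) (append-≤ (unary (toℕ start)) _ (below start)
  (append-≤ (unary (toℕ acc)) _ (below acc) (append-≤ (unary (toℕ rej)) _ (below rej) (≤-reflexive table))))
  where
  open NTM1 M
  g : ℕ
  g = 2 + a + suc b
  below : ∀ i → length (unary (toℕ i)) ≤ suc q
  below i = unary-≤ (<⇒≤ (Finₚ.toℕ<n i))
  row₀ : Fin q → Fin g → Fin q → Fin g → List Bool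
  row₀ p x p′ y = map (δ p x p′ y) (false ∷ true ∷ [])
  row₁ : Fin q → Fin g → Fin q → List Bool
  row₁ p x p′ = concatMap (row₀ p x p′) (allFin g)
  row₂ : Fin q → Fin g → List Bool
  row₂ p x = concatMap (row₁ p x) (allFin q)
  row₃ : Fin q → List Bool
  row₃ p = concatMap (row₂ p) (allFin g)
  table : length (concatMap row₃ (allFin q)) ≡ q * (g * (q * (g * 2)))
  table = over-all q (g * (q * (g * 2))) row₃ λ p → over-all g (q * (g * 2)) (row₂ p) λ x →
          over-all q (g * 2) (row₁ p x) λ p′ → over-all g 2 (row₀ p x p′) λ y → refl

codeOf-length : ∀ {a b} (M : NTM1 a b) → let q = NTM1.q M ; g = 2 + a + suc b in
  length (codeOf M) ≤ suc q + (suc q + (suc q + (suc q + q * (g * (q * (g * 2))))))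
codeOf-length M = ≤-trans (≤-reflexive (cong length (codeOf≡ M))) (code-length M)

module _ {I : Set} where
  infix 4 _≼_
  -- Big O with one constant for all indices and no threshold; constants are absorbed where the
  -- comparison function is at least 1.
  _≼_ : (I → ℕ) → (I → ℕ) → Set
  f ≼ g = ∃ λ κ → ∀ i → f i ≤ κ * g i

  ≼-≤ : ∀ {f g} → (∀ i → f i ≤ g i) → f ≼ g
  ≼-≤ le = 1 , λ i → ≤-trans (le i) (≤-reflexive (sym (*-identityˡ _)))

  ≼-refl : ∀ {f} → f ≼ f
  ≼-refl = ≼-≤ λ i → ≤-refl

  ≼-trans : ∀ {f g h} → f ≼ g → g ≼ h → f ≼ h
  ≼-trans {h = h} (κ , p) (μ , q) = κ * μ , λ i → ≤-trans (p i) (≤-trans (*-monoʳ-≤ κ (q i)) (≤-reflexive (sym (*-assoc κ μ (h i)))))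

  ≼-+ : ∀ {f g h} → f ≼ h → g ≼ h → (λ i → f i + g i) ≼ h
  ≼-+ {h = h} (κ , p) (μ , q) = κ + μ , λ i → ≤-trans (+-mono-≤ (p i) (q i)) (≤-reflexive (sym (*-distribʳ-+ (h i) κ μ)))

  ≼-* : ∀ {f g h k} → f ≼ h → g ≼ k → (λ i → f i * g i) ≼ (λ i → h i * k i)
  ≼-* {h = h} {k} (κ , p) (μ , q) = κ * μ , λ i → ≤-trans (*-mono-≤ (p i) (q i)) (≤-reflexive (swap κ (h i) μ (k i)))
    where
    swap : ∀ κ x μ y → (κ * x) * (μ * y) ≡ κ * μ * (x * y)
    swap = solve-∀

  ≼-const : ∀ c {h} → (∀ i → 1 ≤ h i) → (λ _ → c) ≼ h
  ≼-const c h≥1 = c , λ i → ≤-trans (≤-reflexive (sym (*-identityʳ c))) (*-monoʳ-≤ c (h≥1 i))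

  ≼-scale : ∀ c {f h} → f ≼ h → (λ i → c * f i) ≼ h
  ≼-scale c {h = h} (κ , p) = c * κ , λ i → ≤-trans (*-monoʳ-≤ c (p i)) (≤-reflexive (sym (*-assoc c κ (h i))))

  ≼-scaleʳ : ∀ c {f h} → f ≼ h → (λ i → f i * c) ≼ h
  ≼-scaleʳ c {f} fh = let (κ , p) = ≼-scale c fh in κ , λ i → ≤-trans (≤-reflexive (*-comm (f i) c)) (p i)

  ≼-suc : ∀ {f h} → (∀ i → 1 ≤ h i) → f ≼ h → (λ i → suc (f i)) ≼ h
  ≼-suc h≥1 fh = ≼-+ (≼-const 1 h≥1) fh

module Bounds (N : MNTM) (a b s₀ : ℕ) where
  open Assembly N a b s₀ using (c₀; coreStream; w₀; rowBits; module Sized)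

  private
    ℓ : ℕ
    ℓ = length coreStream

  opaque
    extra : ℕ → ℕ
    extra r = ℓ + r

    enough : ∀ r → ℓ ≤ suc c₀ + extra r
    enough r = ≤-trans (m≤m+n ℓ r) (m≤n+m (ℓ + r) (suc c₀))

    extra-≤ : ∀ r → r ≤ extra r
    extra-≤ r = m≤n+m r ℓ

  module At (r : ℕ) = Sized (extra r) (enough r)

  -- The padding and the time bound of the decider are indices, because the constants must be known
  -- before the padding is chosen from them.
  I : Set
  I = ℕ × ℕ

  Pᵢ tᵢ Bᵢ : I → ℕ
  Pᵢ (r , _) = At.P r
  tᵢ (_ , t) = t
  Bᵢ i = Pᵢ i * Pᵢ i + tᵢ i

  private
    qᵢ : I → ℕ
    qᵢ i = Pᵢ i * At.modes (proj₁ i)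

    P≥1 : ∀ i → 1 ≤ Pᵢ i
    P≥1 i = s≤s z≤n

    PP≥1 : ∀ i → 1 ≤ Pᵢ i * Pᵢ i
    PP≥1 i = *-mono-≤ (P≥1 i) (P≥1 i)

    B≥1 : ∀ i → 1 ≤ Bᵢ i
    B≥1 i = ≤-trans (PP≥1 i) (m≤m+n _ _)

    P≼PP : Pᵢ ≼ (λ i → Pᵢ i * Pᵢ i)
    P≼PP = ≼-≤ λ i → m≤m*n (Pᵢ i) (Pᵢ i)

    PP≼B : (λ i → Pᵢ i * Pᵢ i) ≼ Bᵢ
    PP≼B = ≼-≤ λ i → m≤m+n _ _

    P≼B : Pᵢ ≼ Bᵢ
    P≼B = ≼-trans {g = λ i → Pᵢ i * Pᵢ i} P≼PP PP≼B

    q≼P : qᵢ ≼ Pᵢ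
    -- The number of modes is the same for every padding.
    q≼P = ≼-scaleʳ (At.modes 0) {Pᵢ} {Pᵢ} (≼-refl {f = Pᵢ})

    codeᵢ : I → ℕ
    codeᵢ (r , _) = length (At.codeBits r)

    code≼PP : codeᵢ ≼ (λ i → Pᵢ i * Pᵢ i)
    code≼PP = ≼-trans {g = λ i → suc (qᵢ i) + (suc (qᵢ i) + (suc (qᵢ i) + (suc (qᵢ i) + qᵢ i * (g * (qᵢ i * (g * 2))))))}
      (≼-≤ λ (r , _) → codeOf-length (At.M r))
      (≼-+ {f = λ i → suc (qᵢ i)} sq (≼-+ {f = λ i → suc (qᵢ i)} sq (≼-+ {f = λ i → suc (qᵢ i)} sq (≼-+ {f = λ i → suc (qᵢ i)} sq
        (≼-* {f = qᵢ} {g = λ i → g * (qᵢ i * (g * 2))} {h = Pᵢ} {k = Pᵢ} q≼P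
          (≼-scale g {λ i → qᵢ i * (g * 2)} {Pᵢ} (≼-scaleʳ (g * 2) {qᵢ} {Pᵢ} q≼P)))))))
      where
      g : ℕ
      g = 2 + a + suc b
      sq : (λ i → suc (qᵢ i)) ≼ (λ i → Pᵢ i * Pᵢ i)
      sq = ≼-suc {f = qᵢ} PP≥1 (≼-trans {g = Pᵢ} q≼P P≼PP)

  private
    module Lay = Layout a b s₀ w₀ rowBits
    open Runner N Lay.script using (SM; printTime; body; round; unit)

    W : ℕ
    W = Core.W SM

    roundᵢ bodyᵢ Sᵢ tailᵢ : I → ℕ
    roundᵢ i = round (Pᵢ i)
    bodyᵢ i = body (Pᵢ i)
    Sᵢ i = printTime (Pᵢ i) (codeᵢ i) + suc (tᵢ i)
    tailᵢ i = suc (((Pᵢ i + Sᵢ i) * W + (W + 1)) + suc (Pᵢ i + Sᵢ i) * W)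

    round≼P : roundᵢ ≼ Pᵢ
    round≼P = ≼-+ {f = λ i → Pᵢ i * unit + 1} (≼-+ {f = λ i → Pᵢ i * unit} (≼-scaleʳ unit {Pᵢ} (≼-refl {f = Pᵢ})) (≼-const 1 P≥1)) (≼-refl {f = Pᵢ})

    body≼P : bodyᵢ ≼ Pᵢ
    body≼P = ≼-suc {f = λ i → suc (length Lay.kinds) * suc (roundᵢ i)} P≥1
      (≼-scale (suc (length Lay.kinds)) {λ i → suc (roundᵢ i)} (≼-suc {f = roundᵢ} P≥1 round≼P))

    S≼B : Sᵢ ≼ Bᵢ
    S≼B = ≼-+ {f = λ i → printTime (Pᵢ i) (codeᵢ i)}
      (≼-+ {f = λ i → 1 + (Pᵢ i * bodyᵢ i + 1)}
        (≼-+ {f = λ i → 1} (≼-const 1 B≥1) (≼-+ {f = λ i → Pᵢ i * bodyᵢ i}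
          (≼-trans {g = λ i → Pᵢ i * Pᵢ i} (≼-* {f = Pᵢ} {g = bodyᵢ} {h = Pᵢ} {k = Pᵢ} (≼-refl {f = Pᵢ}) body≼P) PP≼B) (≼-const 1 B≥1)))
        (≼-+ {f = codeᵢ} (≼-trans {g = λ i → Pᵢ i * Pᵢ i} code≼PP PP≼B) (≼-const 1 B≥1)))
      (≼-suc {f = tᵢ} B≥1 (≼-≤ λ i → m≤n+m (tᵢ i) _))

    tail≼B : tailᵢ ≼ Bᵢ
    tail≼B = ≼-suc {f = λ i → ((Pᵢ i + Sᵢ i) * W + (W + 1)) + suc (Pᵢ i + Sᵢ i) * W} B≥1
      (≼-+ {f = λ i → (Pᵢ i + Sᵢ i) * W + (W + 1)}
        (≼-+ {f = λ i → (Pᵢ i + Sᵢ i) * W} (≼-scaleʳ W {λ i → Pᵢ i + Sᵢ i} PS) (≼-const (W + 1) B≥1))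
        (≼-scaleʳ W {λ i → suc (Pᵢ i + Sᵢ i)} (≼-suc {f = λ i → Pᵢ i + Sᵢ i} B≥1 PS)))
      where
      PS : (λ i → Pᵢ i + Sᵢ i) ≼ Bᵢ
      PS = ≼-+ {f = Pᵢ} P≼B S≼B

    B≼BB : Bᵢ ≼ (λ i → Bᵢ i * Bᵢ i)
    B≼BB = ≼-≤ λ i → ≤-trans (≤-reflexive (sym (*-identityʳ (Bᵢ i)))) (*-monoʳ-≤ (Bᵢ i) (B≥1 i))

    BB≥1 : ∀ i → 1 ≤ Bᵢ i * Bᵢ i
    BB≥1 i = *-mono-≤ (B≥1 i) (B≥1 i)

  -- All costs beyond sn: the term `suc s₀` is the excess of s passes of n + 1 steps over sn.
  spent : I → ℕ
  spent (r , t) = suc s₀ + (At.writeTime r + At.simTime r t)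

  opaque
    -- The number of trips and the length of the longest are both of order P² + t: printing makes
    -- order P² trips, the simulation t + 1. Writing the items is only linear in P.
    spent≼ : spent ≼ (λ i → Bᵢ i * Bᵢ i)
    spent≼ = ≼-+ {f = λ i → suc s₀} (≼-const (suc s₀) BB≥1) (≼-+ {f = λ i → At.writeTime (proj₁ i)}
      (≼-trans {g = Bᵢ} (≼-trans {g = Pᵢ} (≼-trans {g = λ i → Pᵢ i * suc w₀ + Pᵢ i * suc w₀} (≼-≤ λ (r , _) → ≤-reflexive (At.writeTime≡ r)) (≼-+ {f = λ i → Pᵢ i * suc w₀} wr wr)) P≼B) B≼BB)
      (≼-trans {g = λ i → Sᵢ i * tailᵢ i + 1} (≼-≤ λ (r , t) → At.simTime-≤ r t)
        (≼-+ {f = λ i → Sᵢ i * tailᵢ i} (≼-* {f = Sᵢ} {g = tailᵢ} {h = Bᵢ} {k = Bᵢ} S≼B tail≼B) (≼-const 1 BB≥1))))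
      where
      wr : (λ i → Pᵢ i * suc w₀) ≼ Pᵢ
      wr = ≼-scaleʳ (suc w₀) {Pᵢ} (≼-refl {f = Pᵢ})

-- The simulation time against P^s

^-*-distrib : ∀ x y n → (x * y) ^ n ≡ x ^ n * y ^ n
^-*-distrib x y zero = refl
^-*-distrib x y (suc n) = trans (cong (x * y *_) (^-*-distrib x y n)) (swap x y (x ^ n) (y ^ n))
  where
  swap : ∀ x y u v → x * y * (u * v) ≡ x * u * (y * v)
  swap = solve-∀

x≤x^suc : ∀ x n → 1 ≤ x → x ≤ x ^ suc n
x≤x^suc x n x≥1 = ≤-trans (≤-reflexive (sym (*-identityʳ x))) (*-monoʳ-≤ x (one≤ n))
  where
  one≤ : ∀ n → 1 ≤ x ^ n
  one≤ zero = ≤-refl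
  one≤ (suc n) = *-mono-≤ x≥1 (one≤ n)

private
  double-square : ∀ κ x → κ * ((x + x) * (x + x)) ≡ 4 * κ * (x * x)
  double-square = solve-∀

  fourth : ∀ κ x → 4 * κ * (x * x * (x * x)) ≡ 4 * κ * (x * (x * (x * x)))
  fourth = solve-∀

  fifth : ∀ x → x * (x * (x * (x * x))) ≡ x ^ 5
  fifth x = cong (λ z → x * (x * (x * (x * z)))) (sym (*-identityʳ x))

  square : ∀ κ t → 4 * κ * (t * t) * (4 * κ * (t * t)) ≡ 16 * (κ * κ) * (t * (t * (t * (t * 1))))
  square = solve-∀

  shuffle : ∀ k x y → k * (x * y) ≡ (k * y) * x
  shuffle = solve-∀

-- If t² were too large then P^s < 16 κ² μ^s, against the choice of P.
time-budget : ∀ κ μ P t s′ → let s = 5 + s′ ; q = P * μ in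
  1 ≤ P → 1 ≤ q → 4 * κ ≤ P → 16 * (κ * κ) * μ ^ s ≤ P →
  t ^ 4 * q ≤ q ^ suc s → κ * ((P * P + t) * (P * P + t)) ≤ P ^ s
time-budget κ μ P t s′ P≥1 q≥1 P≥₁ P≥₂ small with ≤-total t (P * P)
... | inj₁ t≤ = ≤-trans (*-monoʳ-≤ κ (*-mono-≤ (+-monoʳ-≤ (P * P) t≤) (+-monoʳ-≤ (P * P) t≤)))
      (≤-trans (≤-reflexive (trans (double-square κ (P * P)) (fourth κ P))) (≤-trans (*-monoˡ-≤ (P * (P * (P * P))) P≥₁)
        (≤-trans (≤-reflexive (fifth P)) (^-monoʳ-≤ P {{>-nonZero P≥1}} (m≤m+n 5 s′)))))
... | inj₂ t≥ = ≤-trans (*-monoʳ-≤ κ (*-mono-≤ (+-monoˡ-≤ t t≥) (+-monoˡ-≤ t t≥))) (≤-trans (≤-reflexive (double-square κ t)) (≮⇒≥ too-large))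
  where
  s q : ℕ
  s = 5 + s′
  q = P * μ
  t⁴≤ : t ^ 4 ≤ q ^ s
  t⁴≤ = *-cancelʳ-≤ (t ^ 4) (q ^ s) q {{>-nonZero q≥1}} (≤-trans small (≤-reflexive (*-comm q (q ^ s))))
  too-large : ¬ P ^ s < 4 * κ * (t * t)
  too-large lt = <⇒≱ P^s< (≤-trans P≥₂ (x≤x^suc P (4 + s′) P≥1))
    where
    chain : P ^ s * P ^ s < 16 * (κ * κ) * μ ^ s * P ^ s
    chain = <-≤-trans (*-mono-< lt lt) (≤-trans (≤-reflexive (square κ t)) (≤-trans (*-monoʳ-≤ (16 * (κ * κ)) t⁴≤)
      (≤-reflexive (trans (cong (16 * (κ * κ) *_) (^-*-distrib P μ s)) (shuffle (16 * (κ * κ)) (P ^ s) (μ ^ s))))))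
    P^s< : P ^ s < 16 * (κ * κ) * μ ^ s
    P^s< = *-cancelʳ-< (P ^ s) (P ^ s) (16 * (κ * κ) * μ ^ s) chain

time-budget′ : ∀ {κ μ P t s′ s C q X} → s ≡ 5 + s′ → C ≡ suc s → q ≡ P * μ →
  1 ≤ P → 1 ≤ q → 4 * κ ≤ P → 16 * (κ * κ) * μ ^ s ≤ P → (1 * t) ^ 4 * q ≤ q ^ C →
  X ≤ κ * ((P * P + t) * (P * P + t)) → X ≤ P ^ s
time-budget′ {κ} {μ} {P} {t} {s′} {q = q} refl refl refl P≥1 q≥1 P≥₁ P≥₂ small X≤ = ≤-trans X≤
  (time-budget κ μ P t s′ P≥1 q≥1 P≥₁ P≥₂ (subst (λ z → z ^ 4 * q ≤ q ^ suc (5 + s′)) (*-identityˡ t) small))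

steps-prefix : ∀ {a b} {M : NTM1 a b} {j k c c′} → j ≤ k → Steps1 M k c c′ → ∃ (Steps1 M j c)
steps-prefix {j = zero} _ _ = _ , done
steps-prefix {j = suc j} (s≤s le) (more s ss) = let (c , ts) = steps-prefix le ss in c , more s ts

-- The diagonal contradiction for C at least 6

module Large (N : MNTM) (a b C′ D : ℕ) (D≥1 : 1 ≤ D) where
  private
    s₀ : ℕ
    s₀ = 4 + C′
    s : ℕ
    s = suc s₀
    C : ℕ
    C = suc s

  open Bounds N a b s₀

  private
    κ : ℕ
    κ = proj₁ spent≼

    μ : ℕ
    μ = At.modes 0

    -- The padding makes P exceed four quantities at once: `q₀` for the bound on t, 4κ and 16κ²μ^s
    -- for the two cases of `time-budget`, and s so that n + 1 ≥ P pays for the s extra steps of the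
    -- passes.
    module Contradiction (r : ℕ) (t : ℕ → ℕ) (q₀ : ℕ) (r≡ : r ≡ q₀ + (4 * κ + (16 * (κ * κ) * μ ^ s + s))) (small : ∀ q → q₀ ≤ q → ((1 * t q) ^ 4) * q ≤ q ^ C)
      (sound : ∀ (M : NTM1 a b) → Accepts N (codeOf M) → RunsIn M (λ n → C * n + D))
      (complete : ∀ (M : NTM1 a b) → RunsIn M (λ n → C * n + D) → Accepts N (codeOf M))
      (bounded : ∀ (M : NTM1 a b) → TimeBound N (codeOf M) (t (NTM1.q M))) where

      open At r using (P; M; codeBits; accepts⇒endless; first-pass; all-passes; long⇒accepts; writeTime; simTime)

      q : ℕ
      q = P * μ

      r≤P : q₀ + (4 * κ + (16 * (κ * κ) * μ ^ s + s)) ≤ P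
      r≤P = ≤-trans (≤-reflexive (sym r≡)) (≤-trans (extra-≤ r) (m≤n+m (extra r) _))

      part₁ : 4 * κ + (16 * (κ * κ) * μ ^ s + s) ≤ P
      part₁ = ≤-trans (m≤n+m _ q₀) r≤P
      part₂ : 16 * (κ * κ) * μ ^ s + s ≤ P
      part₂ = ≤-trans (m≤n+m _ (4 * κ)) part₁

      s≤P : s ≤ P
      s≤P = ≤-trans (m≤n+m s (16 * (κ * κ) * μ ^ s)) part₂

      q₀≤q : q₀ ≤ q
      q₀≤q = ≤-trans (≤-trans (m≤m+n q₀ _) r≤P) (m≤m*n P μ)

      4κ≤P : 4 * κ ≤ P
      4κ≤P = ≤-trans (m≤m+n (4 * κ) _) part₁

      16κ²≤P : 16 * (κ * κ) * μ ^ s ≤ P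
      16κ²≤P = ≤-trans (m≤m+n (16 * (κ * κ) * μ ^ s) s) part₂

      1≤P : 1 ≤ P
      1≤P = s≤s z≤n

      1≤q : 1 ≤ q
      1≤q = ≤-trans 1≤P (m≤m*n P μ)

      spent≤ : s + (writeTime + simTime (t q)) ≤ κ * ((P * P + t q) * (P * P + t q))
      spent≤ = proj₂ spent≼ (r , t q)

      budget : s + (writeTime + simTime (t q)) ≤ P ^ s
      budget = time-budget′ {κ} {μ} {P} {t q} {C′} {s} {C} {q} {s + (writeTime + simTime (t q))} refl refl refl
        1≤P 1≤q 4κ≤P 16κ²≤P (small q q₀≤q) spent≤

      timed : TimeBound N codeBits (t q)
      timed = bounded M

      runs : Accepts N codeBits → RunsIn M (λ n → C * n + D)
      runs acc = sound M acc

      positive : ∀ x → 1 ≤ x → ∃ λ n → suc n ≡ x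
      positive (suc n) _ = n , refl

      -- All passes succeed on an input of this length, so acceptance would make the machine run
      -- forever on it although the accepted code promises a time bound.
      rejected-at : ∀ n → suc n ≡ P ^ s → ¬ Accepts N codeBits
      rejected-at n eq acc = let (c , ss) = accepts⇒endless acc eq (Vec.replicate n 0F) (suc (C * n + D)) in
        runs acc n (Vec.replicate n 0F) c ss

      rejected : ¬ Accepts N codeBits
      rejected = let (n , eq) = positive (P ^ s) (≤-trans 1≤P (x≤x^suc P s₀ 1≤P)) in rejected-at n eq

      regroup : ∀ n x → s * suc n + x ≡ s * n + (s + x)
      regroup n x = trans (cong (_+ x) (trans (*-suc s n) (+-comm s (s * n)))) (+-assoc (s * n) s x)

      -- C = s + 1: when s passes have used sn + s of the Cn + D steps, the s extra steps and x must
      -- fit into n + D, which is at least n + 1 since D ≥ 1.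
      room : ∀ n x → s + x ≤ suc n → s * suc n + suc x ≤ suc (C * n + D)
      room n x le = ≤-trans (≤-reflexive (+-suc (s * suc n) x)) (s≤s (≤-trans (≤-reflexive (regroup n x))
        (≤-trans (+-monoʳ-≤ (s * n) (≤-trans le (≤-trans (≤-reflexive (+-comm 1 n)) (+-monoʳ-≤ n D≥1))))
          (≤-reflexive (trans (sym (+-assoc (s * n) n D)) (cong (_+ D) (+-comm (s * n) n)))))))

      multiple-≥ : ∀ {n m u} → suc n ≡ m * u → m ≤ suc n
      multiple-≥ {n} {m} {zero} eq = contradiction (trans eq (*-zeroʳ m)) λ ()
      multiple-≥ {n} {m} {suc u} eq = ≤-trans (m≤m*n m (suc u)) (≤-reflexive (sym eq))

      contradictory : ⊥
      contradictory = rejected (complete M slow)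
        where
        slow : RunsIn M (λ n → C * n + D)
        slow n w c ss =
          -- Lower bounds on n are won in stages. One pass always fits the time bound, so P divides
          -- n + 1 and n + 1 ≥ P ≥ s. Then all s passes fit, so n + 1 ≥ P^s. Then the final phase
          -- fits as well, and outlasting it means that `N` accepts.
          let (u , eq₁) = first-pass w (proj₂ (steps-prefix one-pass ss))
              (v , eq₂) = all-passes w (proj₂ (steps-prefix (room n 0 (≤-trans (≤-reflexive (+-identityʳ s)) (≤-trans s≤P (multiple-≥ {u = u} eq₁)))) ss))
              (_ , acc) = long⇒accepts timed w (proj₂ (steps-prefix (room n (writeTime + simTime (t q)) (≤-trans budget (multiple-≥ {u = v} eq₂))) ss))
          in rejected acc
          where
          one-pass : suc n + 1 ≤ suc (C * n + D)
          one-pass = s≤s (≤-trans (+-monoʳ-≤ n D≥1) (+-monoˡ-≤ D (m≤m+n n (s * n))))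

  impossible : (t : ℕ → ℕ) → LittleO t C → ¬ (∀ (M : NTM1 a b) →
    (Accepts N (code M) ⇔ RunsIn M (λ n → C * n + D)) × TimeBound N (code M) (t (NTM1.q M)))
  -- `o 0` is the case ε = 1.
  impossible t o decides = let (q₀ , small) = o 0 in 
    Contradiction.contradictory _ t q₀ refl small (λ M → Equivalence.to (proj₁ (decides′ M))) (λ M → Equivalence.from (proj₁ (decides′ M))) (λ M → proj₂ (decides′ M))
    where
    decides′ : ∀ (M : NTM1 a b) → (Accepts N (codeOf M) ⇔ RunsIn M (λ n → C * n + D)) × TimeBound N (codeOf M) (t (NTM1.q M))
    decides′ M = subst (λ w → (Accepts N w ⇔ RunsIn M (λ n → C * n + D)) × TimeBound N w (t (NTM1.q M))) (sym (codeOf≡ M)) (decides M)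

-- The prefix argument for C at most 5

module Prefix (N : MNTM) where
  open MNTM N using (k; r; m; start; acc; rej)

  stepsM-prefix : ∀ {i j c c′} → i ≤ j → StepsM N j c c′ → ∃ (StepsM N i c)
  stepsM-prefix {i = zero} _ _ = _ , done
  stepsM-prefix {i = suc i} (s≤s le) (more s ss) = let (c , ts) = stepsM-prefix le ss in c , more s ts

  -- Within T steps the heads see no cell at a position ≥ T.
  module _ (T : ℕ) where
    private
      Tapes : Set
      Tapes = Vec (ℤ → Fin (3 + m)) (suc k)

    AgreeBelow : Tapes → Tapes → Set
    AgreeBelow τs σs = ∀ t i → i ℤ.< pos T → lookup τs t i ≡ lookup σs t i

    HeadsWithin : ℕ → Vec ℤ (suc k) → Set
    HeadsWithin n hs = ∀ t → lookup hs t ℤ.≤ pos n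

    private
      move-≤ : ∀ d → move d ℤ.≤ pos 1
      move-≤ 0F = ℤ.-≤+
      move-≤ 1F = ℤ.+≤+ z≤n
      move-≤ 2F = ℤₚ.≤-refl

      reads : ∀ {n hs τs σs} → n < T → HeadsWithin n hs → AgreeBelow τs σs →
              Vec.zipWith (λ τ h → τ h) τs hs ≡ Vec.zipWith (λ τ h → τ h) σs hs
      reads {hs = hs} {τs} {σs} n<T H A = lookup-ext λ i → trans (Vecₚ.lookup-zipWith _ i τs hs)
        (trans (A i (lookup hs i) (ℤₚ.≤-<-trans (H i) (ℤ.+<+ n<T))) (sym (Vecₚ.lookup-zipWith _ i σs hs)))

    local : ∀ j n {p hs τs σs c} → n + j ≤ T → HeadsWithin n hs → AgreeBelow τs σs → StepsM N j (p , hs , τs) c →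
            ∃ λ c′ → StepsM N j (p , hs , σs) c′ × proj₁ c′ ≡ proj₁ c
    local zero n le H A done = _ , done , refl
    local (suc j) n {p} {hs} {τs} {σs} le H A (more (StepM.step {ys = ys} {ds} na nr t) ss)
      with local j (suc n) (≤-trans (≤-reflexive (sym (+-suc n j))) le) H′ A′ ss
      where
      H′ : HeadsWithin (suc n) (Vec.zipWith (λ h d → h ℤ.+ move d) hs ds)
      H′ i rewrite Vecₚ.lookup-zipWith (λ h d → h ℤ.+ move d) i hs ds =
        ℤₚ.≤-trans (ℤₚ.+-mono-≤ (H i) (move-≤ (lookup ds i))) (ℤₚ.≤-reflexive (cong pos (+-comm n 1)))
      A′ : AgreeBelow (Vec.zipWith (λ f y → f y) (Vec.zipWith update τs hs) ys) (Vec.zipWith (λ f y → f y) (Vec.zipWith update σs hs) ys)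
      A′ i z z< rewrite Vecₚ.lookup-zipWith (λ f y → f y) i (Vec.zipWith update τs hs) ys | Vecₚ.lookup-zipWith update i τs hs
                      | Vecₚ.lookup-zipWith (λ f y → f y) i (Vec.zipWith update σs hs) ys | Vecₚ.lookup-zipWith update i σs hs
        with does (z ℤ.≟ lookup hs i)
      ... | true = refl
      ... | false = A i z z<
    ... | c′ , ss′ , eq = c′ , more (StepM.step na nr (trans (cong (λ v → MNTM.δ N p v _ ys ds) (sym (reads n<T H A))) t)) ss′ , eq
      where
      n<T : n < T
      n<T = ≤-trans (≤-trans (m≤m+n (suc n) j) (≤-reflexive (sym (+-suc n j)))) le

  -- An accepting run ends within t steps, before a head can read a cell in which the two words
  -- differ.
  accepts-prefix : ∀ {w w′ t} → (∀ i → i < t → nth N w i ≡ nth N w′ i) → TimeBound N w t → Accepts N w → Accepts N w′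
  accepts-prefix {w} {w′} {t} same tb (j , c , ss , eq)
    with local t j 0 j≤t (λ i → ℤₚ.≤-reflexive (Vecₚ.lookup-replicate i (pos 0))) agree ss
    where
    j≤t : j ≤ t
    j≤t = ≮⇒≥ λ t<j → let (c′ , ts) = stepsM-prefix t<j ss in tb c′ ts
    agree : AgreeBelow t (inTape N w ∷ Vec.replicate k (λ _ → 2F)) (inTape N w′ ∷ Vec.replicate k (λ _ → 2F))
    agree 0F (pos i) (ℤ.+<+ i<t) = same i i<t
    agree 0F -[1+ i ] _ = refl
    agree (Fin.suc x) i _ = refl
  ... | c′ , ss′ , eq′ = j , c′ , ss′ , trans eq′ eq

-- The code of every machine with q states begins with q ones, so if t(q) ≤ q
-- the decider cannot tell a machine that stops at once from one that never stops.
module Small (N : MNTM) (a b : ℕ) where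
  open Prefix N

  constant : ∀ n → Fin (3 + n) → NTM1 a b
  constant n target = record
    { q = 3 + n
    ; start = 0F ; acc = 1F ; rej = 2F
    ; start≢acc = λ () ; start≢rej = λ () ; acc≢rej = λ ()
    ; δ = λ _ _ p′ _ _ → does (p′ Fin.≟ target)
    ; δ-nonempty = λ _ _ _ _ → target , blank a b , true , does-≡ target }

  stopping looping : ℕ → NTM1 a b
  stopping n = constant n 1F
  looping n = constant n 0F

  stopping-short : ∀ n {k c c′} → ¬ Steps1 (stopping n) (suc (suc k)) c c′
  stopping-short n (more (step {p' = p′} _ _ t) (more (step na _ _) _)) = na (does⇒ (p′ Fin.≟ 1F) t)

  looping-long : ∀ n k {z} → ∃ (Steps1 (looping n) k (0F , z))
  looping-long n zero = _ , done
  looping-long n (suc k) {h , τ} with looping-long n k {h ℤ.+ dir true , update τ h (blank a b)}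
  ... | c , ss = c , more (step (λ ()) (λ ()) refl) ss

  nth-ones : ∀ n ys i → i < n → nth N (replicate n true ++ ys) i ≡ 1F
  nth-ones (suc n) ys zero _ = refl
  nth-ones (suc n) ys (suc i) (s≤s lt) = nth-ones n ys i lt

  nth-code : ∀ (M : NTM1 a b) i → i < NTM1.q M → nth N (code M) i ≡ 1F
  nth-code M i lt = trans (cong (λ w → nth N w i) (Listₚ.++-assoc (replicate (NTM1.q M) true) _ _)) (nth-ones (NTM1.q M) _ i lt)

  fourth-root : ∀ {t q} → t ^ 4 ≤ q ^ 4 → t ≤ q
  fourth-root {t} {q} le = ≮⇒≥ λ q<t → <⇒≱ (^-monoˡ-< 4 q<t) le

  impossible : ∀ C D → 1 ≤ D → C ≤ 5 → (t : ℕ → ℕ) → LittleO t C → ¬ (∀ (M : NTM1 a b) →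
    (Accepts N (code M) ⇔ RunsIn M (λ n → C * n + D)) × TimeBound N (code M) (t (NTM1.q M)))
  impossible C D@(suc D′) _ C≤5 t o decides =
    Equivalence.to (proj₁ (decides bad)) accepts-bad 0 [] _ (proj₂ (looping-long q₀ (suc (C * 0 + D))))
    where
    q₀ : ℕ
    q₀ = proj₁ (o 0)
    q : ℕ
    q = 3 + q₀
    good bad : NTM1 a b
    good = stopping q₀
    bad = looping q₀
    t≤q : t q ≤ q
    -- From t⁴q ≤ q^C ≤ q⁵ a factor q cancels and leaves fourth powers on both sides.
    t≤q = fourth-root (*-cancelʳ-≤ (t q ^ 4) (q ^ 4) q (≤-trans (≤-reflexive (cong (λ z → z ^ 4 * q) (sym (*-identityˡ (t q)))))
      (≤-trans (proj₂ (o 0) q (m≤n+m q₀ 3)) (≤-trans (^-monoʳ-≤ q C≤5) (≤-reflexive (*-comm q (q ^ 4)))))))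
    accepts-good : Accepts N (code good)
    -- Every computation of `good` halts after at most one step, and Cn + D is at least 1.
    accepts-good = Equivalence.from (proj₁ (decides good)) λ n w c ss →
      stopping-short q₀ (subst (λ k → Steps1 good (suc k) (init1 good w) c) (+-suc (C * n) D′) ss)
    accepts-bad : Accepts N (code bad)
    accepts-bad = accepts-prefix (λ i i<t → trans (nth-code good i (<-≤-trans i<t t≤q)) (sym (nth-code bad i (<-≤-trans i<t t≤q))))
      (proj₂ (decides good)) accepts-good

theorem4 : (a b C D : ℕ) → 1 ≤ D →
    ¬ (Σ MNTM λ N → Σ (ℕ → ℕ) λ t → LittleO t C ×
    (∀ (M : NTM1 a b) →
    (Accepts N (code M) ⇔ RunsIn M (λ n → C * n + D)) ×
    TimeBound N (code M) (t (NTM1.q M))))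
theorem4 a b C D D≥1 (N , t , o , decides) with ≤-total C 5
... | inj₁ C≤5 = Small.impossible N a b C D D≥1 C≤5 t o decides
... | inj₂ 5≤C with C ℕ.≟ 5
... | yes refl = Small.impossible N a b C D D≥1 ≤-refl t o decides
... | no C≢5 with C ∸ 6 | m+[n∸m]≡n (≤∧≢⇒< 5≤C (C≢5 ∘ sym))
-- Here C = 6 + C′, so s = 5 + C′ has the form that `time-budget` asks for.
... | C′ | refl = Large.impossible N a b C′ D D≥1 t o decides
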